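{- Let $n$ be a positive odd integer. Then, modulo $[n]\Phi_{n}(q)^2$, \[ \sum_{k=0}^{(n-1)/2}[6k+1]\frac{(q;q^{4})_{k}(q;q^{2})_{k}^{3}}{(q^{2};q^{2})_{k}(q^{4};q^{4})_{k}^{3}}q^{k^{2}+k} \equiv \begin{cases} \dfrac{(q^{2};q^{4})_{(n-1)/4}}{(q^{4};q^{4})_{(n-1)/4}}[n]\,q^{(1-n)/4}, & \text{if } n\equiv 1 \pmod 4,\\[6pt] 0, & \text{if } n\equiv 3 \pmod 4, \end{cases} \] and, modulo $[n]\Phi_{n}(q)^2$, \[ \sum_{k=0}^{n-1}[6k+1]\frac{(q;q^{4})_{k}(q;q^{2})_{k}^{3}}{(q^{2};q^{2})_{k}(q^{4};q^{4})_{k}^{3}}q^{k^{2}+k} \equiv \begin{cases} \dfrac{(q^{2};q^{4})_{(n-1)/4}}{(q^{4};q^{4})_{(n-1)/4}}[n]\,q^{(1-n)/4}, & \text{if } n\equiv 1 \pmod 4,\\[6pt] 0, & \text{if } n\equiv 3 \pmod 4. \end{cases} \]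
   Context: For an indeterminate $q$, $(a;q)_k=(1-a)(1-aq)\cdots(1-aq^{k-1})$ (with $(a;q)_0=1$) is the $q$-shifted factorial, and $[n]=[n]_q=(1-q^n)/(1-q)$ is the $q$-integer (so $[6k+1]=(1-q^{6k+1})/(1-q)$). $\Phi_n(q)$ denotes the $n$-th cyclotomic polynomial. A congruence $A\equiv B \pmod{P(q)}$ between rational functions in $q$ means that $A-B$ equals $P(q)$ times a rational function whose denominator is coprime to $P(q)$. -}

module Defs where

open import Data.Nat as ℕ using (ℕ; zero; suc; _≤?_; _∸_; _/_; _%_)
open import Data.Nat.Divisibility using (_∣?_)
open import Data.Integer as ℤ using (ℤ; 0ℤ; 1ℤ)
open import Data.List using (List; []; _∷_; map; replicate; _++_; [_]; foldr; reverse; length; drop; upTo; filter)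
open import Data.List.Relation.Unary.All using (All)
open import Data.Product using (Σ; ∃; ∃₂; _×_; _,_)
open import Relation.Binary.PropositionalEquality using (_≡_)
open import Relation.Nullary using (yes; no)

-- Polynomials in q with integer coefficients, as coefficient lists
-- (lowest degree first).  Equality is "difference has all coefficients 0".

Poly : Set
Poly = List ℤ

infixl 6 _+P_ _-P_
infixl 7 _*P_
infix 4 _≈P_

_+P_ : Poly → Poly → Poly
[] +P q = q
(a ∷ p) +P [] = a ∷ p
(a ∷ p) +P (b ∷ q) = (a ℤ.+ b) ∷ (p +P q)

negP : Poly → Poly
negP = map (λ a → ℤ.- a)

_-P_ : Poly → Poly → Poly
p -P q = p +P negP q

scaleP : ℤ → Poly → Poly
scaleP c = map (c ℤ.*_)

_*P_ : Poly → Poly → Poly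
[] *P q = []
(a ∷ p) *P q = scaleP a q +P (0ℤ ∷ (p *P q))

IsZeroP : Poly → Set
IsZeroP p = All (_≡ 0ℤ) p

_≈P_ : Poly → Poly → Set
p ≈P q = IsZeroP (p -P q)

constP : ℤ → Poly
constP c = [ c ]

oneP : Poly
oneP = constP 1ℤ

X^ : ℕ → Poly
X^ k = replicate k 0ℤ ++ [ 1ℤ ]

prodP : List Poly → Poly
prodP = foldr _*P_ oneP

prodRange : ℕ → (ℕ → Poly) → Poly
prodRange k f = prodP (map f (upTo k))

qint : ℕ → Poly
qint n = foldr _+P_ [] (map X^ (upTo n))

qpoch : ℕ → ℕ → ℕ → Poly
qpoch r s k = prodRange k (λ i → oneP -P X^ (r ℕ.+ s ℕ.* i))

-- Exact division by a monic polynomial (long division), used to define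
-- the cyclotomic polynomials via  q^n - 1 = ∏_{d ∣ n} Φ_d(q).

private
  subLead : ℤ → List ℤ → List ℤ → List ℤ
  subLead c (a ∷ as) (b ∷ bs) = (a ℤ.- c ℤ.* b) ∷ subLead c as bs
  subLead c as [] = as
  subLead c [] (b ∷ bs) = []

  -- high-degree-first dividend, divisor given by its coefficients after
  -- the leading 1 (high-degree-first); returns quotient high-first
  divH : ℕ → List ℤ → List ℤ → List ℤ
  divH zero _ _ = []
  divH (suc f) [] bt = []
  divH (suc f) (a ∷ as) bt with length bt ≤? length as
  ... | yes _ = a ∷ divH f (subLead a as bt) bt
  ... | no _ = []

-- quotient of a by a monic polynomial b (no leading zero coefficients)
monicDiv : Poly → Poly → Poly
monicDiv a b = reverse (divH (length a) (reverse a) (drop 1 (reverse b)))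

-- cycAux f n computes Φ_n whenever n ≤ f
cycAux : ℕ → ℕ → Poly
cycAux zero n = oneP
cycAux (suc f) n =
  monicDiv (X^ n -P oneP)
           (prodP (map (cycAux f) (filter (λ d → d ∣? n) (upTo n))))

Φ : ℕ → Poly
Φ n = cycAux n n

-- Rational functions  num / den  (den a nonzero polynomial)

record Frac : Set where
  constructor _//_
  field
    num : Poly
    den : Poly
open Frac public

infixl 6 _+F_

_+F_ : Frac → Frac → Frac
(a // b) +F (c // d) = (a *P d +P c *P b) // (b *P d)

zeroF : Frac
zeroF = [] // oneP

sumF : ℕ → (ℕ → Frac) → Frac
sumF zero f = zeroF
sumF (suc m) f = sumF m f +F f m

_∣P_ : Poly → Poly → Set
G ∣P D = ∃ λ H → G *P H ≈P D

CoprimeP : Poly → Poly → Set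
CoprimeP D P = ∀ G → G ∣P D → G ∣P P → ∃ λ c → G ≈P constP c

-- A ≡ B (mod P):  A - B = P · (N / D) with D coprime to P
CongF : Frac → Frac → Poly → Set
CongF A B P =
  ∃₂ λ N D → CoprimeP D P ×
    ((num A *P den B -P num B *P den A) *P D ≈P P *P N *P (den A *P den B))

term : ℕ → Frac
term k =
  (qint (6 ℕ.* k ℕ.+ 1) *P qpoch 1 4 k *P (qpoch 1 2 k *P qpoch 1 2 k *P qpoch 1 2 k)
     *P X^ (k ℕ.* k ℕ.+ k))
  // (qpoch 2 2 k *P (qpoch 4 4 k *P qpoch 4 4 k *P qpoch 4 4 k))

rhs1 : ℕ → Frac
rhs1 n = (qpoch 2 4 m *P qint n) // (qpoch 4 4 m *P X^ m)
  where m = (n ∸ 1) / 4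

modulus : ℕ → Poly
modulus n = qint n *P Φ n *P Φ n

{-# OPTIONS --safe #-}
-- Deform the general term by two parameters: a, entering as (aq, q/a; q²)_k / (aq⁴, q⁴/a; q⁴)_k, and D,
-- entering as D^k (q/D; q⁴)_k / (Dq²; q²)_k, with a = D = 1 in the theorem.  The sum has a closed form when
-- it terminates: for a = qⁿ and D = 1 it is the right-hand side of the theorem, and for D = q^(4j+1) it is
-- (q; q²)_(2j+1) / (aq⁴, q⁴/a; q⁴)_j, up to the factor 1 − q.  Both follow from a telescoping (WZ-type)
-- recurrence, in a ↦ aq⁴ and in D ↦ Dq⁴ respectively.
--
-- The term depends on a only through a + 1/a, so replacing a = 1 by a = qⁿ changes it by a multiple of
-- (1 − qⁿ)².  Replacing D = 1 by D = qⁿ or D = q³ⁿ, whichever has the form q^(4j+1), changes it by a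
-- multiple of 1 − qⁿ.  Hence the mixed second difference vanishes modulo Φₙ(q)³.  The closed form for
-- D = q^(4j+1) contains 1 − D, so its values at a = 1 and a = qⁿ also agree modulo Φₙ(q)³, and the sum at
-- (a, D) = (1, 1) is congruent to the one at (qⁿ, 1).
--
-- For a divisor d > 1 of n, the term of index jd + r is modulo Φ_d(q) a multiple (independent of r) of the
-- term of index r, so the sum splits into blocks that vanish by the case n = d.  The congruences modulo
-- the pairwise coprime factors of [n]Φₙ(q)² are then glued together.

module Submission where

open import Defs
open import Level using (0ℓ)
open import Algebra.Bundles using (CommutativeRing)
import Algebra.Properties.AbelianGroup
import Algebra.Properties.Ring
import Algebra.Properties.Semiring.Exp
import Algebra.Properties.Semiring.Mult.TCOptimised
import Algebra.Solver.Ring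
open import Algebra.Solver.Ring.AlmostCommutativeRing using (fromCommutativeRing; _-Raw-AlmostCommutative⟶_; Induced-equivalence)
open import Data.Bool using (true; false; if_then_else_)
open import Data.Integer as ℤ using (ℤ; +_; -[1+_]; 0ℤ; 1ℤ)
import Data.Integer.Properties as ℤₚ
import Data.Integer.Tactic.RingSolver as ℤ-solver
open import Data.List using (List; []; _∷_; _∷ʳ_; map; foldr; filter; replicate; reverse; length; drop; upTo; applyUpTo)
import Data.List.Properties as Listₚ
open import Data.List.Relation.Unary.All as All using (All; []; _∷_)
import Data.List.Relation.Unary.All.Properties as Allₚ
open import Data.Maybe using (just; nothing)
open import Data.Nat as ℕ using (ℕ; zero; suc; _∸_; _<_; _≤_; _≤?_; s≤s; z≤n)
import Data.Nat.Properties as ℕₚ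
open import Data.Nat.DivMod using (_/_; _%_; m≡m%n+[m/n]*n; m%n<n; m*n/n≡m)
open import Data.Nat.Divisibility using (_∣_; _∣?_; divides; ∣-refl; ∣-trans; ∣⇒≤; 0∣⇒≡0; ∣1⇒≡1; 1∣_; n∣m*n; ∣n⇒∣m*n; ∣m+n∣m⇒∣n; ∣m∣n⇒∣m+n; ∣m∸n∣n⇒∣m)
open import Data.Nat.GCD using (gcd; gcd-GCD; gcd[m,n]∣m; gcd[m,n]∣n; module Bézout)
open import Data.Nat.Induction using (<-rec)
open import Data.Nat.Tactic.RingSolver using (solve-∀)
open import Data.Product using (∃; _×_; _,_; proj₁; proj₂)
open import Data.Sum using (_⊎_; inj₁; inj₂)
open import Function using (id; _∘_)
import Relation.Binary.Reasoning.Setoid as ≈-Reasoning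
open import Relation.Binary.Definitions using (WeaklyDecidable)
open import Relation.Binary.PropositionalEquality as ≡ using (_≡_; _≢_)
open import Relation.Nullary using (¬_; yes; no; does; contradiction)

-- Moving a from 1 to qⁿ controls the sum only modulo Φₙ(q)²; the parameter D supplies the third
-- power. It can do so because n is odd: some multiple of n is 1 modulo 4, and at that power of q
-- the series terminates whatever a is, with a value divisible by 1 - D. For n = 1 no such exponent
-- falls into the range of summation, and that case is settled apart. The certificates are
-- polynomial identities with denominators cleared; an inverse enters only through its defining
-- equation. ℤ[q] is not a Bézout ring, so coprimality is expressed by U A + V B = c with a non-zero
-- integer c. Such relations multiply, and they suffice because `CoprimeP` admits constant common
-- divisors. `Φ` is computed by long division, whose exactness has to be proved: it follows from the
-- pairwise coprimality of the earlier `Φ d`, which rests on their product formulas, so both come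
-- out of one induction.

module IntegerCoefficients (K : CommutativeRing 0ℓ 0ℓ) where
  open CommutativeRing K
  open Algebra.Properties.Ring ring using (-0#≈0#; -‿distribˡ-*; -‿distribʳ-*; -‿involutive)
  open Algebra.Properties.AbelianGroup +-abelianGroup using (⁻¹-∙-comm)
  open Algebra.Properties.Semiring.Mult.TCOptimised semiring using (1+×; ×-homo-+; ×1-homo-*) renaming (_×_ to _·_)
  open ≈-Reasoning setoid

  -- Equality in the ring is not decidable, so the solver takes its coefficients in ℤ, where
  -- cancellations can be recognised.
  fromℤ : ℤ → Carrier
  fromℤ (+ n)    = n · 1#
  fromℤ -[1+ n ] = - (suc n · 1#)

  fromℤ-neg : ∀ i → fromℤ (ℤ.- i) ≈ - fromℤ i
  fromℤ-neg (+ zero)  = sym -0#≈0#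
  fromℤ-neg (+ suc n) = refl
  fromℤ-neg -[1+ n ]  = sym (-‿involutive _)

  fromℤ-⊖ : ∀ m n → fromℤ (m ℤ.⊖ n) ≈ m · 1# - n · 1#
  fromℤ-⊖ m zero = sym (trans (+-congˡ -0#≈0#) (+-identityʳ _))
  fromℤ-⊖ zero (suc n) = sym (+-identityˡ _)
  fromℤ-⊖ (suc m) (suc n) = begin
    fromℤ (suc m ℤ.⊖ suc n) ≡⟨ ≡.cong fromℤ (ℤₚ.[1+m]⊖[1+n]≡m⊖n m n) ⟩
    fromℤ (m ℤ.⊖ n) ≈⟨ fromℤ-⊖ m n ⟩
    m · 1# - n · 1# ≈⟨ +-congʳ (+-identityˡ _) ⟨
    0# + m · 1# - n · 1# ≈⟨ +-congʳ (+-congʳ (-‿inverseʳ 1#)) ⟨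
    1# - 1# + m · 1# - n · 1# ≈⟨ +-congʳ (+-assoc 1# (- 1#) _) ⟩
    1# + (- 1# + m · 1#) - n · 1# ≈⟨ +-congʳ (+-congˡ (+-comm _ _)) ⟩
    1# + (m · 1# - 1#) - n · 1# ≈⟨ +-congʳ (+-assoc 1# _ _) ⟨
    1# + m · 1# - 1# - n · 1# ≈⟨ +-assoc _ _ _ ⟩
    1# + m · 1# + (- 1# - n · 1#) ≈⟨ +-congˡ (⁻¹-∙-comm 1# _) ⟩
    1# + m · 1# - (1# + n · 1#) ≈⟨ +-cong (1+× m 1#) (-‿cong (1+× n 1#)) ⟨
    suc m · 1# - suc n · 1# ∎

  fromℤ-+ : ∀ i j → fromℤ (i ℤ.+ j) ≈ fromℤ i + fromℤ j
  fromℤ-+ (+ m)    (+ n)    = ×-homo-+ 1# m n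
  fromℤ-+ (+ m)    -[1+ n ] = fromℤ-⊖ m (suc n)
  fromℤ-+ -[1+ m ] (+ n)    = trans (fromℤ-⊖ n (suc m)) (+-comm _ _)
  fromℤ-+ -[1+ m ] -[1+ n ] = begin
    - (suc (suc (m ℕ.+ n)) · 1#) ≡⟨ ≡.cong (λ k → - (suc k · 1#)) (ℕₚ.+-suc m n) ⟨
    - ((suc m ℕ.+ suc n) · 1#) ≈⟨ -‿cong (×-homo-+ 1# (suc m) (suc n)) ⟩
    - (suc m · 1# + suc n · 1#) ≈⟨ ⁻¹-∙-comm _ _ ⟨
    - (suc m · 1#) - suc n · 1# ∎

  fromℤ-*⁺ : ∀ m j → fromℤ (+ m ℤ.* j) ≈ fromℤ (+ m) * fromℤ j
  fromℤ-*⁺ m (+ n) = trans (reflexive (≡.cong fromℤ (≡.sym (ℤₚ.pos-* m n)))) (×1-homo-* m n)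
  fromℤ-*⁺ m -[1+ n ] = begin
    fromℤ (+ m ℤ.* (ℤ.- (+ suc n))) ≡⟨ ≡.cong fromℤ (ℤₚ.neg-distribʳ-* (+ m) (+ suc n)) ⟨
    fromℤ (ℤ.- (+ m ℤ.* (+ suc n))) ≈⟨ fromℤ-neg (+ m ℤ.* (+ suc n)) ⟩
    - fromℤ (+ m ℤ.* (+ suc n)) ≈⟨ -‿cong (fromℤ-*⁺ m (+ suc n)) ⟩
    - (fromℤ (+ m) * fromℤ (+ suc n)) ≈⟨ -‿distribʳ-* _ _ ⟩
    fromℤ (+ m) * - fromℤ (+ suc n) ∎

  fromℤ-* : ∀ i j → fromℤ (i ℤ.* j) ≈ fromℤ i * fromℤ j
  fromℤ-* (+ m) j = fromℤ-*⁺ m j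
  fromℤ-* -[1+ m ] j = begin
    fromℤ ((ℤ.- (+ suc m)) ℤ.* j) ≡⟨ ≡.cong fromℤ (ℤₚ.neg-distribˡ-* (+ suc m) j) ⟨
    fromℤ (ℤ.- (+ suc m ℤ.* j)) ≈⟨ fromℤ-neg (+ suc m ℤ.* j) ⟩
    - fromℤ (+ suc m ℤ.* j) ≈⟨ -‿cong (fromℤ-*⁺ (suc m) j) ⟩
    - (fromℤ (+ suc m) * fromℤ j) ≈⟨ -‿distribˡ-* _ _ ⟩
    - fromℤ (+ suc m) * fromℤ j ∎

  private
    morphism : ℤ.+-*-rawRing -Raw-AlmostCommutative⟶ fromCommutativeRing K
    morphism = record
      { ⟦_⟧    = fromℤ
      ; +-homo = fromℤ-+
      ; *-homo = fromℤ-*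
      ; -‿homo = fromℤ-neg
      ; 0-homo = refl
      ; 1-homo = refl
      }

    coefficient≟ : WeaklyDecidable (Induced-equivalence morphism)
    coefficient≟ i j with i ℤ.≟ j
    ... | yes i≡j = just (reflexive (≡.cong fromℤ i≡j))
    ... | no  _   = nothing

  open Algebra.Solver.Ring ℤ.+-*-rawRing (fromCommutativeRing K) morphism coefficient≟ public
    using (Polynomial; con; solve; _:=_; _:+_; _:*_; _:-_; :-_; _:^_)

-- Finite sums and products

module Sums (K : CommutativeRing 0ℓ 0ℓ) where
  open CommutativeRing K
  open Algebra.Properties.Semiring.Exp semiring public using (_^_; ^-homo-*; ^-assocʳ; ^-congʳ)
  open IntegerCoefficients K public

  one : ∀ {n} → Polynomial n
  one = con 1ℤ

  Σ< : ℕ → (ℕ → Carrier) → Carrier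
  Σ< zero    f = 0#
  Σ< (suc n) f = Σ< n f + f n

  Π< : ℕ → (ℕ → Carrier) → Carrier
  Π< zero    f = 1#
  Π< (suc n) f = Π< n f * f n

  -- Read backwards, this is how denominators enter a calculation: factors a a⁻¹ are inserted,
  -- regrouped by the solver and absorbed into the next product.
  times-unit : ∀ {x a b} → a * b ≈ 1# → x * (a * b) ≈ x
  times-unit ab = trans (*-congˡ ab) (*-identityʳ _)

-- The deformed term and its telescoping recurrences

-- T is (1 − q) times the deformed term, with y/z = a + 1/a; the theorem has (z , y , D) = (1 , 2 , 1).
-- The arguments α, ε, η stand for the inverses of 1 − q⁴W², e z y (q⁴W²) and 1 − Dq²W.
module Terms (K : CommutativeRing 0ℓ 0ℓ) (q : CommutativeRing.Carrier K) where
  open CommutativeRing K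
  open Sums K

  W : ℕ → Carrier
  W k = (q ^ 2) ^ k

  -- Equals z (1 - aX)(1 - X/a). As only z and y occur, a need not be inverted: a = qⁿ becomes z =
  -- qⁿ, y = 1 + q²ⁿ, and one recurrence in D serves every a.
  e : Carrier → Carrier → Carrier → Carrier
  e z y X = z - y * X + z * (X * X)

  h : ℕ → Carrier
  h k = 1# - q * W k ^ 3

  c : (α : ℕ → Carrier) → ℕ → Carrier
  c α i = (1# - q * W i) * α i

  r : (z y : Carrier) (ε : ℕ → Carrier) → ℕ → Carrier
  r z y ε i = e z y (q * W i) * ε i

  -- The factors `q ^ 2 * W i` = q^(2i+2) multiply up to the power q^(k²+k) of the theorem.
  b : (D : Carrier) (η : ℕ → Carrier) → ℕ → Carrier
  b D η i = (D - q * W i ^ 2) * (q ^ 2 * W i) * η i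

  T : (α : ℕ → Carrier) (z y : Carrier) (ε : ℕ → Carrier) (D : Carrier) (η : ℕ → Carrier) → ℕ → Carrier
  T α z y ε D η k = h k * (Π< k (c α) * Π< k (r z y ε) * Π< k (b D η))

module ShiftD (K : CommutativeRing 0ℓ 0ℓ) (q : CommutativeRing.Carrier K) where
  open CommutativeRing K
  open Sums K
  open Terms K q

  module Certificate
    (α : ℕ → Carrier) (α-inv : ∀ i → (1# - q ^ 4 * W i ^ 2) * α i ≈ 1#)
    (z y : Carrier) (ε : ℕ → Carrier) (ε-inv : ∀ i → e z y (q ^ 4 * W i ^ 2) * ε i ≈ 1#)
    (D : Carrier) (η : ℕ → Carrier) (η-inv : ∀ i → (1# - D * (q ^ 2 * W i)) * η i ≈ 1#)
    (η′ : ℕ → Carrier) (η′-inv : ∀ i → (1# - D * q ^ 4 * (q ^ 2 * W i)) * η′ i ≈ 1#)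
    where
    open ≈-Reasoning setoid
    private
      D′ X : Carrier
      D′ = D * q ^ 4
      X = D * q ^ 3
      A B B′ : ℕ → Carrier
      A k = Π< k (c α) * Π< k (r z y ε)
      B k = Π< k (b D η)
      B′ k = Π< k (b D′ η′)

    -- Passing from D to Dq⁴ shifts the index of D - q^(4i+1) by one and that of 1 - Dq^(2i+2) by
    -- two, so in the quotient of the two products only boundary factors survive. `W k ^ 2` = q^(4k)
    -- collects the powers of q⁴ released by the first shift.
    B-shift : ∀ k → B k * (W k ^ 2 * (X - 1#) * ((1# - D * q ^ 2) * (1# - D * q ^ 4)))
                  ≈ B′ k * ((X - W k ^ 2) * ((1# - D * (q ^ 2 * W k)) * (1# - D * (q ^ 4 * W k))))
    B-shift zero = solve 2 (λ q D → one :* (one :^ 2 :* (D :* q :^ 3 :- one) :* ((one :- D :* q :^ 2) :* (one :- D :* q :^ 4)))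
          := one :* ((D :* q :^ 3 :- one :^ 2) :* ((one :- D :* (q :^ 2 :* one)) :* (one :- D :* (q :^ 4 :* one)))))
          refl q D
    B-shift (suc k) = begin
      _ ≈⟨ solve 6 (λ q W D X B η → B :* ((D :- q :* W :^ 2) :* (q :^ 2 :* W) :* η) :* ((q :^ 2 :* W) :^ 2 :* (X :- one) :* ((one :- D :* q :^ 2) :* (one :- D :* q :^ 4)))
          := B :* (W :^ 2 :* (X :- one) :* ((one :- D :* q :^ 2) :* (one :- D :* q :^ 4))) :* ((D :- q :* W :^ 2) :* (q :^ 2 :* W) :* q :^ 4 :* η))
          refl q (W k) D X (B k) (η k) ⟩
      _ ≈⟨ *-congʳ (B-shift k) ⟩
      _ ≈⟨ solve 5 (λ q W D B η → B :* ((D :* q :^ 3 :- W :^ 2) :* ((one :- D :* (q :^ 2 :* W)) :* (one :- D :* (q :^ 4 :* W)))) :* ((D :- q :* W :^ 2) :* (q :^ 2 :* W) :* q :^ 4 :* η)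
          := B :* ((D :* q :^ 4 :- q :* W :^ 2) :* (q :^ 2 :* W)) :* ((D :* q :^ 3 :- (q :^ 2 :* W) :^ 2) :* (one :- D :* (q :^ 2 :* (q :^ 2 :* W)))) :* ((one :- D :* (q :^ 2 :* W)) :* η))
          refl q (W k) D (B′ k) (η k) ⟩
      _ ≈⟨ times-unit (η-inv k) ⟩
      _ ≈⟨ times-unit (η′-inv k) ⟨
      _ ≈⟨ solve 5 (λ q W D B η → B :* ((D :* q :^ 4 :- q :* W :^ 2) :* (q :^ 2 :* W)) :* ((D :* q :^ 3 :- (q :^ 2 :* W) :^ 2) :* (one :- D :* (q :^ 2 :* (q :^ 2 :* W)))) :* ((one :- D :* q :^ 4 :* (q :^ 2 :* W)) :* η)
          := B :* ((D :* q :^ 4 :- q :* W :^ 2) :* (q :^ 2 :* W) :* η) :* ((D :* q :^ 3 :- (q :^ 2 :* W) :^ 2) :* ((one :- D :* (q :^ 2 :* (q :^ 2 :* W))) :* (one :- D :* (q :^ 4 :* (q :^ 2 :* W))))))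
          refl q (W k) D (B′ k) (η′ k) ⟩
      _ ∎

    -- The WZ certificate in summed form. The right side vanishes at k = 0 through 1 - `W k ^ 2`,
    -- and it vanishes again for large k when D′ is a power q^(4j+1), because then `B′ k` contains a
    -- zero factor.
    telescope : ∀ k → W k ^ 2 * (X - 1#) * (e z y X * Σ< k (T α z y ε D′ η′) - z * ((1# - D * q ^ 2) * (1# - D * q ^ 4)) * Σ< k (T α z y ε D η))
                    ≈ A k * B′ k * ((1# - W k ^ 2) * (e z y (W k ^ 2)) * (1# - D * (q ^ 4 * W k)) * X)
    telescope zero = solve 4 (λ q D z y → one :^ 2 :* (D :* q :^ 3 :- one) :* ((z :- y :* (D :* q :^ 3) :+ z :* (D :* q :^ 3 :* (D :* q :^ 3))) :* con 0ℤ :- z :* ((one :- D :* q :^ 2) :* (one :- D :* q :^ 4)) :* con 0ℤ)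
          := one :* one :* one :* ((one :- one :^ 2) :* (z :- y :* one :^ 2 :+ z :* (one :^ 2 :* one :^ 2)) :* (one :- D :* (q :^ 4 :* one)) :* (D :* q :^ 3)))
          refl q D z y
    telescope (suc k) = begin
      _ ≈⟨ solve 11 (λ q W X D z S R E A B B′ → (q :^ 2 :* W) :^ 2 :* (X :- one) :* (E :* (S :+ (one :- q :* W :^ 3) :* (A :* B′)) :- z :* ((one :- D :* q :^ 2) :* (one :- D :* q :^ 4)) :* (R :+ (one :- q :* W :^ 3) :* (A :* B)))
          := q :^ 4 :* (W :^ 2 :* (X :- one) :* (E :* S :- z :* ((one :- D :* q :^ 2) :* (one :- D :* q :^ 4)) :* R) :+ (one :- q :* W :^ 3) :* A :* (E :* W :^ 2 :* (X :- one) :* B′ :- z :* (B :* (W :^ 2 :* (X :- one) :* ((one :- D :* q :^ 2) :* (one :- D :* q :^ 4)))))))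
          refl q (W k) X D z (Σ< k (T α z y ε D′ η′)) (Σ< k (T α z y ε D η)) (e z y X) (A k) (B k) (B′ k) ⟩
      _ ≈⟨ *-congˡ (+-cong (telescope k) (*-congˡ (+-congˡ (-‿cong (*-congˡ (B-shift k)))))) ⟩
      -- The certificate identity proper: the old boundary term plus the new summands, all written
      -- over B′, equals the numerator of the next boundary term. The three insertions below supply
      -- its denominators.
      _ ≈⟨ solve 7 (λ q W D z y A B → q :^ 4 :* (A :* B :* ((one :- W :^ 2) :* (z :- y :* W :^ 2 :+ z :* (W :^ 2 :* W :^ 2)) :* (one :- D :* (q :^ 4 :* W)) :* (D :* q :^ 3)) :+ (one :- q :* W :^ 3) :* A :* ((z :- y :* (D :* q :^ 3) :+ z :* (D :* q :^ 3 :* (D :* q :^ 3))) :* W :^ 2 :* (D :* q :^ 3 :- one) :* B :- z :* (B :* ((D :* q :^ 3 :- W :^ 2) :* ((one :- D :* (q :^ 2 :* W)) :* (one :- D :* (q :^ 4 :* W)))))))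
          := A :* B :* ((one :- q :* W) :* (z :- y :* (q :* W) :+ z :* (q :* W :* (q :* W))) :* ((D :* q :^ 4 :- q :* W :^ 2) :* (q :^ 2 :* W)) :* (D :* q :^ 3)))
          refl q (W k) D z y (A k) (B′ k) ⟩
      _ ≈⟨ times-unit (η′-inv k) ⟨
      _ ≈⟨ times-unit (α-inv k) ⟨
      _ ≈⟨ times-unit (ε-inv k) ⟨
      _ ≈⟨ solve 12 (λ q W D z y C R B F η α ε → C :* R :* B :* ((one :- q :* W) :* F :* ((D :* q :^ 4 :- q :* W :^ 2) :* (q :^ 2 :* W)) :* (D :* q :^ 3)) :* ((one :- D :* q :^ 4 :* (q :^ 2 :* W)) :* η) :* ((one :- q :^ 4 :* W :^ 2) :* α) :* ((z :- y :* (q :^ 4 :* W :^ 2) :+ z :* (q :^ 4 :* W :^ 2 :* (q :^ 4 :* W :^ 2))) :* ε)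
          := C :* ((one :- q :* W) :* α) :* (R :* (F :* ε)) :* (B :* ((D :* q :^ 4 :- q :* W :^ 2) :* (q :^ 2 :* W) :* η)) :* ((one :- (q :^ 2 :* W) :^ 2) :* (z :- y :* (q :^ 2 :* W) :^ 2 :+ z :* ((q :^ 2 :* W) :^ 2 :* (q :^ 2 :* W) :^ 2)) :* (one :- D :* (q :^ 4 :* (q :^ 2 :* W))) :* (D :* q :^ 3)))
          refl q (W k) D z y (Π< k (c α)) (Π< k (r z y ε)) (B′ k) (e z y (q * W k)) (η′ k) (α k) (ε k) ⟩
      _ ∎

module ShiftN (K : CommutativeRing 0ℓ 0ℓ) (q : CommutativeRing.Carrier K) where
  open CommutativeRing K
  open Sums K
  open Terms K q

  module Certificate
    (α : ℕ → Carrier) (α-inv : ∀ i → (1# - q ^ 4 * W i ^ 2) * α i ≈ 1#)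
    (η : ℕ → Carrier) (η-inv : ∀ i → (1# - 1# * (q ^ 2 * W i)) * η i ≈ 1#)
    (N : Carrier)
    (ν : ℕ → Carrier) (ν-inv : ∀ i → (N - q ^ 4 * W i ^ 2) * ν i ≈ 1#)
    (μ : ℕ → Carrier) (μ-inv : ∀ i → (1# - N * (q ^ 4 * W i ^ 2)) * μ i ≈ 1#)
    (ν′ : ℕ → Carrier) (ν′-inv : ∀ i → (N * q ^ 4 - q ^ 4 * W i ^ 2) * ν′ i ≈ 1#)
    (μ′ : ℕ → Carrier) (μ′-inv : ∀ i → (1# - N * q ^ 4 * (q ^ 4 * W i ^ 2)) * μ′ i ≈ 1#)
    where
    open ≈-Reasoning setoid
    private
      N′ : Carrier
      N′ = N * q ^ 4
      S S′ : ℕ → Carrier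
      S k = Σ< k (T α N (1# + N * N) (λ i → ν i * μ i) 1# η)
      S′ k = Σ< k (T α N′ (1# + N′ * N′) (λ i → ν′ i * μ′ i) 1# η)
      C B R R′ H : ℕ → Carrier
      C k = Π< k (c α)
      B k = Π< k (b 1# η)
      R k = Π< k (r N (1# + N * N) (λ i → ν i * μ i))
      R′ k = Π< k (r N′ (1# + N′ * N′) (λ i → ν′ i * μ′ i))
      -- H takes the numerator N q⁴ - qW from R′ and 1 - N qW from R, the denominator N - q⁴W² from
      -- R and 1 - N q⁸W² from R′. With this mixture both R and R′ are polynomials in W times H, up
      -- to W² and factors independent of k.
      H k = Π< k (λ i → (N * q ^ 4 - q * W i) * (1# - N * (q * W i)) * (ν i * μ′ i))

    -- The quotient R/H contains only (N - qW)/(Nq⁴ - qW) and (1 - Nq⁸W²)/(1 - Nq⁴W²); these are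
    -- index shifts by two and by one, so the products collapse to boundary factors. `R′-shift`
    -- works in the same way.
    R-shift : ∀ k → R k * (W k ^ 2 * ((1# - N * q ^ 3) * (1# - N * q) * (1# - N * q ^ 4)))
                  ≈ H k * ((N * q ^ 3 - W k) * (N * q - W k) * (1# - N * (q ^ 4 * W k ^ 2)))
    R-shift zero = solve 2 (λ q N → one :* (one :^ 2 :* ((one :- N :* q :^ 3) :* (one :- N :* q) :* (one :- N :* q :^ 4)))
          := one :* ((N :* q :^ 3 :- one) :* (N :* q :- one) :* (one :- N :* (q :^ 4 :* one :^ 2))))
          refl q N
    R-shift (suc k) = begin
      _ ≈⟨ solve 7 (λ q W N R F ν μ → R :* (F :* (ν :* μ)) :* ((q :^ 2 :* W) :^ 2 :* ((one :- N :* q :^ 3) :* (one :- N :* q) :* (one :- N :* q :^ 4)))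
          := R :* (W :^ 2 :* ((one :- N :* q :^ 3) :* (one :- N :* q) :* (one :- N :* q :^ 4))) :* (q :^ 4 :* F :* (ν :* μ)))
          refl q (W k) N (R k) (e N (1# + N * N) (q * W k)) (ν k) (μ k) ⟩
      _ ≈⟨ *-congʳ (R-shift k) ⟩
      _ ≈⟨ solve 6 (λ q W N H ν μ → H :* ((N :* q :^ 3 :- W) :* (N :* q :- W) :* (one :- N :* (q :^ 4 :* W :^ 2))) :* (q :^ 4 :* (N :- (one :+ N :* N) :* (q :* W) :+ N :* (q :* W :* (q :* W))) :* (ν :* μ))
          := H :* ((N :* q :^ 4 :- q :* W) :* (one :- N :* (q :* W)) :* ν :* ((N :* q :^ 3 :- q :^ 2 :* W) :* (N :* q :- q :^ 2 :* W))) :* ((one :- N :* (q :^ 4 :* W :^ 2)) :* μ))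
          refl q (W k) N (H k) (ν k) (μ k) ⟩
      _ ≈⟨ times-unit (μ-inv k) ⟩
      _ ≈⟨ times-unit (μ′-inv k) ⟨
      _ ≈⟨ solve 6 (λ q W N H ν μ → H :* ((N :* q :^ 4 :- q :* W) :* (one :- N :* (q :* W)) :* ν :* ((N :* q :^ 3 :- q :^ 2 :* W) :* (N :* q :- q :^ 2 :* W))) :* ((one :- N :* q :^ 4 :* (q :^ 4 :* W :^ 2)) :* μ)
          := H :* ((N :* q :^ 4 :- q :* W) :* (one :- N :* (q :* W)) :* (ν :* μ)) :* ((N :* q :^ 3 :- q :^ 2 :* W) :* (N :* q :- q :^ 2 :* W) :* (one :- N :* (q :^ 4 :* (q :^ 2 :* W) :^ 2))))
          refl q (W k) N (H k) (ν k) (μ′ k) ⟩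
      _ ∎

    R′-shift : ∀ k → R′ k * (W k ^ 2 * ((N - 1#) * (1# - N * q) * (1# - N * q ^ 3)))
                   ≈ H k * ((1# - N * (q * W k)) * (1# - N * (q ^ 3 * W k)) * (N - W k ^ 2))
    R′-shift zero = solve 2 (λ q N → one :* (one :^ 2 :* ((N :- one) :* (one :- N :* q) :* (one :- N :* q :^ 3)))
          := one :* ((one :- N :* (q :* one)) :* (one :- N :* (q :^ 3 :* one)) :* (N :- one :^ 2)))
          refl q N
    R′-shift (suc k) = begin
      _ ≈⟨ solve 7 (λ q W N R F ν μ → R :* (F :* (ν :* μ)) :* ((q :^ 2 :* W) :^ 2 :* ((N :- one) :* (one :- N :* q) :* (one :- N :* q :^ 3)))
          := R :* (W :^ 2 :* ((N :- one) :* (one :- N :* q) :* (one :- N :* q :^ 3))) :* (q :^ 4 :* F :* (ν :* μ)))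
          refl q (W k) N (R′ k) (e N′ (1# + N′ * N′) (q * W k)) (ν′ k) (μ′ k) ⟩
      _ ≈⟨ *-congʳ (R′-shift k) ⟩
      _ ≈⟨ solve 6 (λ q W N H ν μ → H :* ((one :- N :* (q :* W)) :* (one :- N :* (q :^ 3 :* W)) :* (N :- W :^ 2)) :* (q :^ 4 :* (N :* q :^ 4 :- (one :+ N :* q :^ 4 :* (N :* q :^ 4)) :* (q :* W) :+ N :* q :^ 4 :* (q :* W :* (q :* W))) :* (ν :* μ))
          := H :* ((N :* q :^ 4 :- q :* W) :* (one :- N :* (q :* W)) :* μ :* ((one :- N :* (q :* (q :^ 2 :* W))) :* (one :- N :* (q :^ 3 :* (q :^ 2 :* W))))) :* ((N :* q :^ 4 :- q :^ 4 :* W :^ 2) :* ν))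
          refl q (W k) N (H k) (ν′ k) (μ′ k) ⟩
      _ ≈⟨ times-unit (ν′-inv k) ⟩
      _ ≈⟨ times-unit (ν-inv k) ⟨
      _ ≈⟨ solve 6 (λ q W N H ν μ → H :* ((N :* q :^ 4 :- q :* W) :* (one :- N :* (q :* W)) :* μ :* ((one :- N :* (q :* (q :^ 2 :* W))) :* (one :- N :* (q :^ 3 :* (q :^ 2 :* W))))) :* ((N :- q :^ 4 :* W :^ 2) :* ν)
          := H :* ((N :* q :^ 4 :- q :* W) :* (one :- N :* (q :* W)) :* (ν :* μ)) :* ((one :- N :* (q :* (q :^ 2 :* W))) :* (one :- N :* (q :^ 3 :* (q :^ 2 :* W))) :* (N :- (q :^ 2 :* W) :^ 2)))
          refl q (W k) N (H k) (ν k) (μ′ k) ⟩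
      _ ∎

    -- Here the boundary term is zero at k = 0 because of 1 - `W k`, and for large k because of
    -- `H k`, once N q⁴ is an odd power q^(2i+1) with i < k.
    telescope : ∀ k → W k ^ 2 * ((1# - N * q) * (1# - N * q ^ 3)) * (q * (1# - N * q ^ 3) * (1# - N) * S′ k - (1# - N * q) * (1# - N * q ^ 4) * S k)
                    ≈ C k * B k * H k * ((1# - W k) * (1# - W k ^ 2) * (N - W k ^ 2) * (1# - N * (q ^ 4 * W k ^ 2)) * (q * (1# - N * N * q ^ 4)))
    telescope zero = solve 2 (λ q N → one :^ 2 :* ((one :- N :* q) :* (one :- N :* q :^ 3)) :* (q :* (one :- N :* q :^ 3) :* (one :- N) :* con 0ℤ :- (one :- N :* q) :* (one :- N :* q :^ 4) :* con 0ℤ)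
          := one :* one :* one :* ((one :- one) :* (one :- one :^ 2) :* (N :- one :^ 2) :* (one :- N :* (q :^ 4 :* one :^ 2)) :* (q :* (one :- N :* N :* q :^ 4))))
          refl q N
    telescope (suc k) = begin
      _ ≈⟨ solve 9 (λ q N W S S′ C B R R′ → (q :^ 2 :* W) :^ 2 :* ((one :- N :* q) :* (one :- N :* q :^ 3)) :* (q :* (one :- N :* q :^ 3) :* (one :- N) :* (S′ :+ (one :- q :* W :^ 3) :* (C :* R′ :* B)) :- (one :- N :* q) :* (one :- N :* q :^ 4) :* (S :+ (one :- q :* W :^ 3) :* (C :* R :* B)))
          := q :^ 4 :* (W :^ 2 :* ((one :- N :* q) :* (one :- N :* q :^ 3)) :* (q :* (one :- N :* q :^ 3) :* (one :- N) :* S′ :- (one :- N :* q) :* (one :- N :* q :^ 4) :* S) :- (one :- q :* W :^ 3) :* (C :* B) :* (q :* (one :- N :* q :^ 3) :* (R′ :* (W :^ 2 :* ((N :- one) :* (one :- N :* q) :* (one :- N :* q :^ 3)))) :+ (one :- N :* q) :* (R :* (W :^ 2 :* ((one :- N :* q :^ 3) :* (one :- N :* q) :* (one :- N :* q :^ 4)))))))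
          refl q N (W k) (S k) (S′ k) (C k) (B k) (R k) (R′ k) ⟩
      _ ≈⟨ *-congˡ (+-cong (telescope k) (-‿cong (*-congˡ (+-cong (*-congˡ (R′-shift k)) (*-congˡ (R-shift k)))))) ⟩
      _ ≈⟨ solve 6 (λ q N W C B H → q :^ 4 :* (C :* B :* H :* ((one :- W) :* (one :- W :^ 2) :* (N :- W :^ 2) :* (one :- N :* (q :^ 4 :* W :^ 2)) :* (q :* (one :- N :* N :* q :^ 4))) :- (one :- q :* W :^ 3) :* (C :* B) :* (q :* (one :- N :* q :^ 3) :* (H :* ((one :- N :* (q :* W)) :* (one :- N :* (q :^ 3 :* W)) :* (N :- W :^ 2))) :+ (one :- N :* q) :* (H :* ((N :* q :^ 3 :- W) :* (N :* q :- W) :* (one :- N :* (q :^ 4 :* W :^ 2))))))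
          := C :* B :* H :* ((one :- q :* W) :* ((one :- q :* W :^ 2) :* (q :^ 2 :* W)) :* ((N :* q :^ 4 :- q :* W) :* (one :- N :* (q :* W))) :* (q :* (one :- N :* N :* q :^ 4))))
          refl q N (W k) (C k) (B k) (H k) ⟩
      _ ≈⟨ times-unit (α-inv k) ⟨
      _ ≈⟨ times-unit (η-inv k) ⟨
      _ ≈⟨ times-unit (ν-inv k) ⟨
      _ ≈⟨ times-unit (μ′-inv k) ⟨
      _ ≈⟨ solve 10 (λ q N W C B H α η ν μ → C :* B :* H :* ((one :- q :* W) :* ((one :- q :* W :^ 2) :* (q :^ 2 :* W)) :* ((N :* q :^ 4 :- q :* W) :* (one :- N :* (q :* W))) :* (q :* (one :- N :* N :* q :^ 4))) :* ((one :- q :^ 4 :* W :^ 2) :* α) :* ((one :- one :* (q :^ 2 :* W)) :* η) :* ((N :- q :^ 4 :* W :^ 2) :* ν) :* ((one :- N :* q :^ 4 :* (q :^ 4 :* W :^ 2)) :* μ)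
          := C :* ((one :- q :* W) :* α) :* (B :* ((one :- q :* W :^ 2) :* (q :^ 2 :* W) :* η)) :* (H :* ((N :* q :^ 4 :- q :* W) :* (one :- N :* (q :* W)) :* (ν :* μ))) :* ((one :- q :^ 2 :* W) :* (one :- (q :^ 2 :* W) :^ 2) :* (N :- (q :^ 2 :* W) :^ 2) :* (one :- N :* (q :^ 4 :* (q :^ 2 :* W) :^ 2)) :* (q :* (one :- N :* N :* q :^ 4))))
          refl q N (W k) (C k) (B k) (H k) (α k) (η k) (ν k) (μ′ k) ⟩
      _ ∎

-- Elementary facts on sums, products and units

module RingFacts (K : CommutativeRing 0ℓ 0ℓ) where
  open CommutativeRing K
  open Sums K
  open ≈-Reasoning setoid

  Σ<-cong : ∀ {f g} n → (∀ i → i < n → f i ≈ g i) → Σ< n f ≈ Σ< n g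
  Σ<-cong zero    eq = refl
  Σ<-cong (suc n) eq = +-cong (Σ<-cong n λ i i<n → eq i (ℕₚ.m<n⇒m<1+n i<n)) (eq n ℕₚ.≤-refl)

  Π<-cong : ∀ {f g} n → (∀ i → f i ≈ g i) → Π< n f ≈ Π< n g
  Π<-cong zero    eq = refl
  Π<-cong (suc n) eq = *-cong (Π<-cong n eq) (eq n)

  Π<-* : ∀ n f g → Π< n (λ i → f i * g i) ≈ Π< n f * Π< n g
  Π<-* zero    f g = sym (*-identityʳ 1#)
  Π<-* (suc n) f g = trans (*-congʳ (Π<-* n f g)) (solve 4 (λ A B x y → A :* B :* (x :* y) := A :* x :* (B :* y)) refl (Π< n f) (Π< n g) (f n) (g n))

  Π<-zero : ∀ {f i n} → i < n → f i ≈ 0# → Π< n f ≈ 0#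
  Π<-zero {f} {i} {suc n} i<1+n fi≈0 with ℕₚ.m≤n⇒m<n∨m≡n (ℕₚ.≤-pred i<1+n)
  ... | inj₁ i<n    = trans (*-congʳ (Π<-zero i<n fi≈0)) (zeroˡ _)
  ... | inj₂ ≡.refl = trans (*-congˡ fi≈0) (zeroʳ _)

  Σ<-zero : ∀ {f} n → (∀ i → f i ≈ 0#) → Σ< n f ≈ 0#
  Σ<-zero zero    eq = refl
  Σ<-zero (suc n) eq = trans (+-cong (Σ<-zero n eq) (eq n)) (+-identityʳ 0#)

  Σ<-+ : ∀ m n f → Σ< (m ℕ.+ n) f ≈ Σ< m f + Σ< n (λ i → f (m ℕ.+ i))
  Σ<-+ m zero    f = trans (reflexive (≡.cong (λ k → Σ< k f) (ℕₚ.+-identityʳ m))) (sym (+-identityʳ _))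
  Σ<-+ m (suc n) f = begin
    Σ< (m ℕ.+ suc n) f ≡⟨ ≡.cong (λ k → Σ< k f) (ℕₚ.+-suc m n) ⟩
    Σ< (m ℕ.+ n) f + f (m ℕ.+ n) ≈⟨ +-congʳ (Σ<-+ m n f) ⟩
    Σ< m f + Σ< n (λ i → f (m ℕ.+ i)) + f (m ℕ.+ n) ≈⟨ +-assoc _ _ _ ⟩
    Σ< m f + (Σ< n (λ i → f (m ℕ.+ i)) + f (m ℕ.+ n)) ∎

  Σ<-- : ∀ n f g → Σ< n (λ i → f i - g i) ≈ Σ< n f - Σ< n g
  Σ<-- zero    f g = sym (-‿inverseʳ 0#)
  Σ<-- (suc n) f g = trans (+-congʳ (Σ<-- n f g)) (solve 4 (λ A B x y → A :- B :+ (x :- y) := A :+ x :- (B :+ y)) refl (Σ< n f) (Σ< n g) (f n) (g n))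

  Σ<-*ˡ : ∀ n x f → Σ< n (λ i → x * f i) ≈ x * Σ< n f
  Σ<-*ˡ zero    x f = sym (zeroʳ x)
  Σ<-*ˡ (suc n) x f = trans (+-congʳ (Σ<-*ˡ n x f)) (sym (distribˡ _ _ _))

  Π<-+ : ∀ m n f → Π< (m ℕ.+ n) f ≈ Π< m f * Π< n (λ i → f (m ℕ.+ i))
  Π<-+ m zero    f = trans (reflexive (≡.cong (λ k → Π< k f) (ℕₚ.+-identityʳ m))) (sym (*-identityʳ _))
  Π<-+ m (suc n) f = begin
    Π< (m ℕ.+ suc n) f ≡⟨ ≡.cong (λ k → Π< k f) (ℕₚ.+-suc m n) ⟩
    Π< (m ℕ.+ n) f * f (m ℕ.+ n) ≈⟨ *-congʳ (Π<-+ m n f) ⟩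
    Π< m f * Π< n (λ i → f (m ℕ.+ i)) * f (m ℕ.+ n) ≈⟨ *-assoc _ _ _ ⟩
    Π< m f * (Π< n (λ i → f (m ℕ.+ i)) * f (m ℕ.+ n)) ∎

  unit-cancel : ∀ {a a⁻¹ x} → a * a⁻¹ ≈ 1# → a * x ≈ 0# → x ≈ 0#
  unit-cancel {a} {a⁻¹} {x} inv eq = begin
    x ≈⟨ times-unit inv ⟨
    x * (a * a⁻¹) ≈⟨ solve 3 (λ x a b → x :* (a :* b) := b :* (a :* x)) refl x a a⁻¹ ⟩
    a⁻¹ * (a * x) ≈⟨ *-congˡ eq ⟩
    a⁻¹ * 0# ≈⟨ zeroʳ _ ⟩
    0# ∎

  x-y≈0⇒x≈y : ∀ {x y} → x - y ≈ 0# → x ≈ y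
  x-y≈0⇒x≈y {x} {y} eq = begin
    x ≈⟨ solve 2 (λ x y → x := x :- y :+ y) refl x y ⟩
    (x - y) + y ≈⟨ +-congʳ eq ⟩
    0# + y ≈⟨ +-identityˡ y ⟩
    y ∎

  x≈y⇒x-y≈0 : ∀ {x y} → x ≈ y → x - y ≈ 0#
  x≈y⇒x-y≈0 eq = trans (+-congʳ eq) (-‿inverseʳ _)

-- Closed forms of the terminating sums

-- w a b is junk when a = b.
record Inverses (K : CommutativeRing 0ℓ 0ℓ) (q p : CommutativeRing.Carrier K) (w : ℕ → ℕ → CommutativeRing.Carrier K) : Set where
  open CommutativeRing K
  open Sums K
  field
    qp≈1  : q * p ≈ 1#
    w-inv : ∀ {a b} → a ≢ b → (q ^ a - q ^ b) * w a b ≈ 1#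

module Evaluation (K : CommutativeRing 0ℓ 0ℓ) (q p : CommutativeRing.Carrier K) (w : ℕ → ℕ → CommutativeRing.Carrier K)
  (inverses : Inverses K q p w) where
  open CommutativeRing K
  open Sums K
  open Terms K q
  open RingFacts K
  open Inverses inverses
  open ≈-Reasoning setoid

  q^-+ : ∀ a b {c x y} → x ≈ q ^ a → y ≈ q ^ b → a ℕ.+ b ≡ c → x * y ≈ q ^ c
  q^-+ a b x≈ y≈ ≡.refl = trans (*-cong x≈ y≈) (sym (^-homo-* q a b))

  W≈ : ∀ i → W i ≈ q ^ (2 ℕ.* i)
  W≈ i = ^-assocʳ q 2 i

  W²≈ : ∀ i → W i ^ 2 ≈ q ^ (4 ℕ.* i)
  W²≈ i = trans (*-congˡ (*-identityʳ _)) (q^-+ (2 ℕ.* i) (2 ℕ.* i) (W≈ i) (W≈ i) (eq i))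
    where
    eq : ∀ i → 2 ℕ.* i ℕ.+ 2 ℕ.* i ≡ 4 ℕ.* i
    eq = solve-∀

  W³≈ : ∀ i → W i ^ 3 ≈ q ^ (6 ℕ.* i)
  W³≈ i = q^-+ (2 ℕ.* i) (4 ℕ.* i) (W≈ i) (W²≈ i) (eq i)
    where
    eq : ∀ i → 2 ℕ.* i ℕ.+ 4 ℕ.* i ≡ 6 ℕ.* i
    eq = solve-∀

  q⁴W²≈ : ∀ i → q ^ 4 * W i ^ 2 ≈ q ^ (4 ℕ.+ 4 ℕ.* i)
  q⁴W²≈ i = q^-+ 4 (4 ℕ.* i) refl (W²≈ i) ≡.refl

  q²W≈ : ∀ i → q ^ 2 * W i ≈ q ^ (2 ℕ.+ 2 ℕ.* i)
  q²W≈ i = q^-+ 2 (2 ℕ.* i) refl (W≈ i) ≡.refl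

  w-inv′ : ∀ {a b x y} → x ≈ q ^ a → y ≈ q ^ b → a ≢ b → (x - y) * w a b ≈ 1#
  w-inv′ x≈ y≈ a≢b = trans (*-congʳ (+-cong x≈ (-‿cong y≈))) (w-inv a≢b)

  α : ℕ → Carrier
  α i = w 0 (4 ℕ.+ 4 ℕ.* i)

  α-inv : ∀ i → (1# - q ^ 4 * W i ^ 2) * α i ≈ 1#
  α-inv i = w-inv′ refl (q⁴W²≈ i) λ ()

  η : ℕ → ℕ → Carrier
  η a i = w 0 (a ℕ.+ (2 ℕ.+ 2 ℕ.* i))

  η-inv : ∀ a {D} → D ≈ q ^ a → ∀ i → (1# - D * (q ^ 2 * W i)) * η a i ≈ 1#
  η-inv a D≈ i = w-inv′ refl (q^-+ a (2 ℕ.+ 2 ℕ.* i) D≈ (q²W≈ i) ≡.refl) λ eq →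
    contradiction (≡.trans eq (ℕₚ.+-suc a (1 ℕ.+ 2 ℕ.* i))) λ ()

  ν μ ε : ℕ → ℕ → Carrier
  ν n i = w n (4 ℕ.+ 4 ℕ.* i)
  μ n i = w 0 (n ℕ.+ (4 ℕ.+ 4 ℕ.* i))
  ε n i = ν n i * μ n i

  module _ (n : ℕ) {N : Carrier} (N≈ : N ≈ q ^ n) (t : ℕ) (n-odd : n ≡ 1 ℕ.+ 2 ℕ.* t) where
    -- Parity keeps the denominator away from zero: n is odd and 4 + 4i is even, so the two
    -- exponents differ.
    ν-inv : ∀ i → (N - q ^ 4 * W i ^ 2) * ν n i ≈ 1#
    ν-inv i = w-inv′ N≈ (q⁴W²≈ i) λ n≡ → ℕₚ.even≢odd (2 ℕ.+ 2 ℕ.* i) t (≡.trans (≡.sym (≡.trans n≡ (eq i))) n-odd)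
      where
      eq : ∀ i → 4 ℕ.+ 4 ℕ.* i ≡ 2 ℕ.* (2 ℕ.+ 2 ℕ.* i)
      eq = solve-∀

    μ-inv : ∀ i → (1# - N * (q ^ 4 * W i ^ 2)) * μ n i ≈ 1#
    μ-inv i = w-inv′ refl (q^-+ n _ N≈ (q⁴W²≈ i) ≡.refl) λ eq →
      contradiction (≡.trans eq (ℕₚ.+-suc n (3 ℕ.+ 4 ℕ.* i))) λ ()

    ε-inv : ∀ i → e N (1# + N * N) (q ^ 4 * W i ^ 2) * ε n i ≈ 1#
    ε-inv i = begin
      e N (1# + N * N) (q ^ 4 * W i ^ 2) * ε n i
        ≈⟨ solve 4 (λ N Y ν μ → (N :- (one :+ N :* N) :* Y :+ N :* (Y :* Y)) :* (ν :* μ) := (N :- Y) :* ν :* ((one :- N :* Y) :* μ)) refl N (q ^ 4 * W i ^ 2) (ν n i) (μ n i) ⟩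
      (N - q ^ 4 * W i ^ 2) * ν n i * ((1# - N * (q ^ 4 * W i ^ 2)) * μ n i)
        ≈⟨ *-cong (ν-inv i) (μ-inv i) ⟩
      1# * 1#
        ≈⟨ *-identityʳ 1# ⟩
      1# ∎

  α²-inv : ∀ i → e 1# (1# + 1#) (q ^ 4 * W i ^ 2) * (α i * α i) ≈ 1#
  α²-inv i = begin
    e 1# (1# + 1#) (q ^ 4 * W i ^ 2) * (α i * α i)
      ≈⟨ solve 2 (λ Y α → (one :- (one :+ one) :* Y :+ one :* (Y :* Y)) :* (α :* α) := (one :- Y) :* α :* ((one :- Y) :* α)) refl (q ^ 4 * W i ^ 2) (α i) ⟩
    (1# - q ^ 4 * W i ^ 2) * α i * ((1# - q ^ 4 * W i ^ 2) * α i)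
      ≈⟨ *-cong (α-inv i) (α-inv i) ⟩
    1# * 1#
      ≈⟨ *-identityʳ 1# ⟩
    1# ∎

  W-inv : ∀ k → W k * p ^ (2 ℕ.* k) ≈ 1#
  W-inv k = trans (*-congʳ (W≈ k)) (pow (2 ℕ.* k))
    where
    pow : ∀ m → q ^ m * p ^ m ≈ 1#
    pow zero    = *-identityʳ 1#
    pow (suc m) = begin
      q * q ^ m * (p * p ^ m) ≈⟨ solve 4 (λ q p x y → q :* x :* (p :* y) := x :* y :* (q :* p)) refl q p (q ^ m) (p ^ m) ⟩
      q ^ m * p ^ m * (q * p) ≈⟨ times-unit qp≈1 ⟩
      q ^ m * p ^ m ≈⟨ pow m ⟩
      1# ∎

  W-cancel : ∀ k {x} → W k ^ 2 * x ≈ 0# → x ≈ 0#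
  W-cancel k eq = unit-cancel (W-inv k) (unit-cancel (W-inv k) (trans (sym (trans (*-congʳ (*-congˡ (*-identityʳ _))) (*-assoc _ _ _))) eq))

  Σ<-head : ∀ {f} n → (∀ i → f (suc i) ≈ 0#) → Σ< (suc n) f ≈ f 0
  Σ<-head {f} n eq = trans (Σ<-+ 1 n f) (trans (+-cong (+-identityˡ _) (Σ<-zero n eq)) (+-identityʳ _))

  D : ℕ → Carrier
  D zero    = q
  D (suc j) = D j * q ^ 4

  D≈ : ∀ j → D j ≈ q ^ (1 ℕ.+ 4 ℕ.* j)
  D≈ zero    = sym (*-identityʳ q)
  D≈ (suc j) = q^-+ (1 ℕ.+ 4 ℕ.* j) 4 (D≈ j) refl (eq j)
    where
    eq : ∀ j → 1 ℕ.+ 4 ℕ.* j ℕ.+ 4 ≡ 1 ℕ.+ 4 ℕ.* suc j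
    eq = solve-∀

  D-vanish : ∀ j → D j - q * W j ^ 2 ≈ 0#
  D-vanish j = x≈y⇒x-y≈0 (trans (D≈ j) (*-congˡ (sym (W²≈ j))))

  module SumD (z y : Carrier) (ε : ℕ → Carrier) (ε-inv : ∀ i → e z y (q ^ 4 * W i ^ 2) * ε i ≈ 1#) where

    factor : ℕ → Carrier
    factor i = z * ((1# - D i * q ^ 2) * (1# - D i * q ^ 4)) * ε i

    -- Since D = q^(1+4j), the factor of index j is zero: this is what makes the series terminate
    -- independently of a.
    b-vanish : ∀ j {k} (θ : ℕ → Carrier) → j < k → Π< k (b (D j) θ) ≈ 0#
    b-vanish j θ j<k = Π<-zero j<k (trans (*-congʳ (trans (*-congʳ (D-vanish j)) (zeroˡ _))) (zeroˡ _))

    -- The recurrence is iterated from D = q, where only the term of index 0 is left. At D =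
    -- q^(1+4j) the argument X = Dq³ is q^(4+4j), so the coefficient `e z y X` is exactly the
    -- denominator inverted by `ε j`.
    sum : ∀ j n → j < n → Σ< n (T α z y ε (D j) (η (1 ℕ.+ 4 ℕ.* j))) ≈ (1# - q) * Π< j factor
    sum zero (suc n) _ = begin
      Σ< (suc n) (T α z y ε q (η 1)) ≈⟨ Σ<-head {T α z y ε q (η 1)} n (λ i → trans (*-congˡ (trans (*-congˡ (b-vanish 0 {suc i} (η 1) (s≤s z≤n))) (zeroʳ _))) (zeroʳ _)) ⟩
      T α z y ε q (η 1) 0 ≈⟨ solve 1 (λ q → (one :- q :* one :^ 3) :* (one :* one :* one) := (one :- q) :* one) refl q ⟩
      (1# - q) * 1# ∎
    sum (suc j) n 1+j<n = begin
      S′ ≈⟨ times-unit (ε-inv j) ⟨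
      S′ * (e z y (q ^ 4 * W j ^ 2) * ε j) ≈⟨ *-congˡ (*-congʳ (e-cong X≈)) ⟨
      S′ * (e z y X * ε j) ≈⟨ solve 3 (λ s E ε → s :* (E :* ε) := E :* s :* ε) refl S′ (e z y X) (ε j) ⟩
      e z y X * S′ * ε j ≈⟨ *-congʳ (x-y≈0⇒x≈y (unit-cancel X-unit (W-cancel n (trans (sym (*-assoc _ _ _)) (trans (telescope n) vanish))))) ⟩
      z * ((1# - D j * q ^ 2) * (1# - D j * q ^ 4)) * S * ε j ≈⟨ *-congʳ (*-congˡ (sum j n (ℕₚ.<-trans ℕₚ.≤-refl 1+j<n))) ⟩
      z * ((1# - D j * q ^ 2) * (1# - D j * q ^ 4)) * ((1# - q) * Π< j factor) * ε j
        ≈⟨ solve 4 (λ g q P ε → g :* ((one :- q) :* P) :* ε := (one :- q) :* (P :* (g :* ε))) refl (z * ((1# - D j * q ^ 2) * (1# - D j * q ^ 4))) q (Π< j factor) (ε j) ⟩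
      (1# - q) * Π< (suc j) factor ∎
      where
      open ShiftD.Certificate K q α α-inv z y ε ε-inv (D j) (η (1 ℕ.+ 4 ℕ.* j)) (η-inv (1 ℕ.+ 4 ℕ.* j) (D≈ j)) (η (1 ℕ.+ 4 ℕ.* suc j)) (η-inv (1 ℕ.+ 4 ℕ.* suc j) (D≈ (suc j)))
      X S S′ : Carrier
      X = D j * q ^ 3
      S = Σ< n (T α z y ε (D j) (η (1 ℕ.+ 4 ℕ.* j)))
      S′ = Σ< n (T α z y ε (D (suc j)) (η (1 ℕ.+ 4 ℕ.* suc j)))
      e-cong : ∀ {x x′} → x ≈ x′ → e z y x ≈ e z y x′
      e-cong eq = +-cong (+-congˡ (-‿cong (*-congˡ eq))) (*-congˡ (*-cong eq eq))
      X≈q^ : X ≈ q ^ (4 ℕ.+ 4 ℕ.* j)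
      X≈q^ = q^-+ (1 ℕ.+ 4 ℕ.* j) 3 (D≈ j) refl (eq j)
        where
        eq : ∀ j → 1 ℕ.+ 4 ℕ.* j ℕ.+ 3 ≡ 4 ℕ.+ 4 ℕ.* j
        eq = solve-∀
      X≈ : X ≈ q ^ 4 * W j ^ 2
      X≈ = trans X≈q^ (sym (q⁴W²≈ j))
      X-unit : (X - 1#) * w (4 ℕ.+ 4 ℕ.* j) 0 ≈ 1#
      X-unit = w-inv′ X≈q^ refl λ ()
      vanish : _ ≈ 0#
      vanish = trans (*-congʳ (trans (*-congˡ (b-vanish (suc j) (η (1 ℕ.+ 4 ℕ.* suc j)) 1+j<n)) (zeroʳ _))) (zeroˡ _)

  N : ℕ → ℕ → Carrier
  N s zero    = q ^ s
  N s (suc m) = N s m * q ^ 4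

  N≈ : ∀ s m → N s m ≈ q ^ (s ℕ.+ 4 ℕ.* m)
  N≈ s zero    = reflexive (≡.cong (q ^_) (≡.sym (ℕₚ.+-identityʳ s)))
  N≈ s (suc m) = q^-+ (s ℕ.+ 4 ℕ.* m) 4 (N≈ s m) refl (eq s m)
    where
    eq : ∀ s m → s ℕ.+ 4 ℕ.* m ℕ.+ 4 ≡ s ℕ.+ 4 ℕ.* suc m
    eq = solve-∀

  module SumN (t : ℕ) where

    n : ℕ → ℕ
    n m = 1 ℕ.+ 2 ℕ.* t ℕ.+ 4 ℕ.* m

    n-odd : ∀ m → n m ≡ 1 ℕ.+ 2 ℕ.* (t ℕ.+ 2 ℕ.* m)
    n-odd m = eq t m
      where
      eq : ∀ t m → 1 ℕ.+ 2 ℕ.* t ℕ.+ 4 ℕ.* m ≡ 1 ℕ.+ 2 ℕ.* (t ℕ.+ 2 ℕ.* m)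
      eq = solve-∀

    Nₘ : ℕ → Carrier
    Nₘ = N (1 ℕ.+ 2 ℕ.* t)

    Nₘ≈ : ∀ m → Nₘ m ≈ q ^ n m
    Nₘ≈ = N≈ (1 ℕ.+ 2 ℕ.* t)

    S : ℕ → ℕ → Carrier
    S m k = Σ< k (T α (Nₘ m) (1# + Nₘ m * Nₘ m) (ε (n m)) 1# (η 0))

    -- The range must reach beyond i = t + 2(m + 1), for there Nq⁴ = q^(2i+1) annihilates H and with
    -- it the boundary term. What remains beside the recurrence, `W k ^ 2`, 1 - Nq and 1 - Nq³, is
    -- invertible.
    recurrence : ∀ m {k} → t ℕ.+ 2 ℕ.* suc m < k →
      q * (1# - Nₘ m * q ^ 3) * (1# - Nₘ m) * S (suc m) k ≈ (1# - Nₘ m * q) * (1# - Nₘ m * q ^ 4) * S m k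
    recurrence m {k} i<k = x-y≈0⇒x≈y (unit-cancel (w-inv′ {0} {n m ℕ.+ 3} refl (Nq^≈ 3 refl) λ ()) (unit-cancel (w-inv′ {0} {n m ℕ.+ 1} refl (Nq^≈ 1 (sym (*-identityʳ q))) λ ())
        (trans (sym (*-assoc _ _ _)) (W-cancel k (trans (sym (*-assoc _ _ _)) (trans (telescope k) vanish))))))
      where
      open ShiftN.Certificate K q α α-inv (η 0) (η-inv 0 refl) (Nₘ m) (ν (n m)) (ν-inv (n m) (Nₘ≈ m) (t ℕ.+ 2 ℕ.* m) (n-odd m)) (μ (n m)) (μ-inv (n m) (Nₘ≈ m) (t ℕ.+ 2 ℕ.* m) (n-odd m))
                  (ν (n (suc m))) (ν-inv (n (suc m)) (Nₘ≈ (suc m)) (t ℕ.+ 2 ℕ.* suc m) (n-odd (suc m))) (μ (n (suc m))) (μ-inv (n (suc m)) (Nₘ≈ (suc m)) (t ℕ.+ 2 ℕ.* suc m) (n-odd (suc m)))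
      Nq^≈ : ∀ c {x} → x ≈ q ^ c → Nₘ m * x ≈ q ^ (n m ℕ.+ c)
      Nq^≈ c x≈ = q^-+ (n m) c (Nₘ≈ m) x≈ ≡.refl
      vanish : _ ≈ 0#
      vanish = trans (*-congʳ (trans (*-congˡ (Π<-zero i<k (trans (*-congʳ (trans (*-congʳ
        (x≈y⇒x-y≈0 (trans (Nₘ≈ (suc m)) (trans (^-congʳ q (n-odd (suc m))) (*-congˡ (sym (W≈ (t ℕ.+ 2 ℕ.* suc m)))))))) (zeroˡ _))) (zeroˡ _)))) (zeroʳ _))) (zeroˡ _)

    step : ∀ m {k} → t ℕ.+ 2 ℕ.* suc m < k →
      S (suc m) k ≈ (1# - Nₘ m * q) * (1# - Nₘ m * q ^ 4) * S m k * (p * (w 0 (n m) * w 0 (n m ℕ.+ 3)))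
    step m {k} i<k = begin
      S (suc m) k
        ≈⟨ times-unit qp≈1 ⟨
      _ ≈⟨ times-unit (w-inv′ refl (Nₘ≈ m) λ ()) ⟨
      _ ≈⟨ times-unit (w-inv′ refl (q^-+ (n m) 3 (Nₘ≈ m) refl ≡.refl) λ ()) ⟨
      S (suc m) k * (q * p) * ((1# - Nₘ m) * w 0 (n m)) * ((1# - Nₘ m * q ^ 3) * w 0 (n m ℕ.+ 3))
        ≈⟨ solve 6 (λ s q p N a b → s :* (q :* p) :* ((one :- N) :* a) :* ((one :- N :* q :^ 3) :* b) := q :* (one :- N :* q :^ 3) :* (one :- N) :* s :* (p :* (a :* b))) refl (S (suc m) k) q p (Nₘ m) (w 0 (n m)) (w 0 (n m ℕ.+ 3)) ⟩
      q * (1# - Nₘ m * q ^ 3) * (1# - Nₘ m) * S (suc m) k * (p * (w 0 (n m) * w 0 (n m ℕ.+ 3)))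
        ≈⟨ *-congʳ (recurrence m i<k) ⟩
      (1# - Nₘ m * q) * (1# - Nₘ m * q ^ 4) * S m k * (p * (w 0 (n m) * w 0 (n m ℕ.+ 3))) ∎

  -- This is (q²;q⁴)_m q^(-m) / (q⁴;q⁴)_m.
  closed : ℕ → Carrier
  closed m = Π< m (λ i → (1# - q ^ (2 ℕ.+ 4 ℕ.* i)) * α i) * p ^ m

  module _ where
    open SumN 0

    -- For n = 1 the factor `e` is zero at index 0 and one term is left. In the step, the
    -- denominator 1 - N cancels the prefactor of the induction hypothesis and 1 - Nq⁴ takes its
    -- place.
    sum-1mod4 : ∀ m k → 2 ℕ.* m < k → S m k ≈ (1# - Nₘ m) * closed m
    sum-1mod4 zero (suc k) _ = begin
      S 0 (suc k) ≈⟨ Σ<-head {T α (Nₘ 0) (1# + Nₘ 0 * Nₘ 0) (ε (n 0)) 1# (η 0)} k (λ i → trans (*-congˡ (trans (*-congʳ (trans (*-congˡ (Π<-zero {i = 0} {n = suc i} (s≤s z≤n) vanish)) (zeroʳ _))) (zeroˡ _))) (zeroʳ _)) ⟩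
      (1# - q * 1# ^ 3) * (1# * 1# * 1#) ≈⟨ solve 1 (λ q → (one :- q :* one :^ 3) :* (one :* one :* one) := (one :- q :^ 1) :* (one :* one)) refl q ⟩
      (1# - Nₘ 0) * closed 0 ∎
      where
      vanish : e (q ^ 1) (1# + q ^ 1 * q ^ 1) (q * 1#) * ε (n 0) 0 ≈ 0#
      vanish = solve 2 (λ q ε → (q :^ 1 :- (one :+ q :^ 1 :* q :^ 1) :* (q :* one) :+ q :^ 1 :* (q :* one :* (q :* one))) :* ε := con 0ℤ) refl q (ε (n 0) 0)
    sum-1mod4 (suc m) k i<k = begin
      S (suc m) k
        ≈⟨ step m i<k ⟩
      (1# - Nₘ m * q) * (1# - Nₘ m * q ^ 4) * S m k * (p * (w 0 (n m) * w 0 (n m ℕ.+ 3)))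
        ≈⟨ *-congʳ (*-congˡ (sum-1mod4 m k (ℕₚ.≤-<-trans (ℕₚ.*-monoʳ-≤ 2 (ℕₚ.n≤1+n m)) i<k))) ⟩
      (1# - Nₘ m * q) * (1# - Nₘ m * q ^ 4) * ((1# - Nₘ m) * closed m) * (p * (w 0 (n m) * w 0 (n m ℕ.+ 3)))
        ≈⟨ solve 8 (λ N x y P Q p a b → x :* y :* ((one :- N) :* (P :* Q)) :* (p :* (a :* b)) := y :* (P :* (x :* b) :* (p :* Q)) :* ((one :- N) :* a)) refl (Nₘ m) (1# - Nₘ m * q) (1# - Nₘ m * q ^ 4) (Π< m (λ i → (1# - q ^ (2 ℕ.+ 4 ℕ.* i)) * α i)) (p ^ m) p (w 0 (n m)) (w 0 (n m ℕ.+ 3)) ⟩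
      (1# - Nₘ m * q ^ 4) * (Π< m (λ i → (1# - q ^ (2 ℕ.+ 4 ℕ.* i)) * α i) * ((1# - Nₘ m * q) * w 0 (n m ℕ.+ 3)) * (p * p ^ m)) * ((1# - Nₘ m) * w 0 (n m))
        ≈⟨ times-unit (w-inv′ refl (Nₘ≈ m) λ ()) ⟩
      (1# - Nₘ m * q ^ 4) * (Π< m (λ i → (1# - q ^ (2 ℕ.+ 4 ℕ.* i)) * α i) * ((1# - Nₘ m * q) * w 0 (n m ℕ.+ 3)) * (p * p ^ m))
        ≈⟨ *-congˡ (*-congʳ (*-congˡ (*-cong (+-congˡ (-‿cong (q^-+ (n m) 1 (Nₘ≈ m) (sym (*-identityʳ q)) (eq₁ m)))) (reflexive (≡.cong (w 0) (eq₃ m)))))) ⟩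
      (1# - Nₘ (suc m)) * closed (suc m) ∎
      where
      eq₁ : ∀ m → 1 ℕ.+ 4 ℕ.* m ℕ.+ 1 ≡ 2 ℕ.+ 4 ℕ.* m
      eq₁ = solve-∀
      eq₃ : ∀ m → 1 ℕ.+ 4 ℕ.* m ℕ.+ 3 ≡ 4 ℕ.+ 4 ℕ.* m
      eq₃ = solve-∀

  module _ where
    open SumN 1

    -- For n = 3 exactly two terms survive, 1 - q and q - 1, and they cancel; the recurrence carries
    -- the zero along.
    sum-3mod4 : ∀ m k → 1 ℕ.+ 2 ℕ.* m < k → S m k ≈ 0#
    sum-3mod4 zero (suc zero) (s≤s ())
    sum-3mod4 zero (suc (suc k)) _ = begin
      S 0 (2 ℕ.+ k)
        ≈⟨ Σ<-+ 2 k term₀ ⟩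
      0# + term₀ 0 + term₀ 1 + Σ< k (λ i → term₀ (2 ℕ.+ i))
        ≈⟨ +-cong (+-congˡ term₁) (Σ<-zero k λ i → trans (*-congˡ (trans (*-congʳ (trans (*-congˡ (Π<-zero {i = 1} {n = 2 ℕ.+ i} (s≤s (s≤s z≤n)) vanish)) (zeroʳ _))) (zeroˡ _))) (zeroʳ _)) ⟩
      0# + (1# - q * 1# ^ 3) * (1# * 1# * 1#) + (q - 1#) + 0#
        ≈⟨ solve 1 (λ q → con 0ℤ :+ (one :- q :* one :^ 3) :* (one :* one :* one) :+ (q :- one) :+ con 0ℤ := con 0ℤ) refl q ⟩
      0# ∎
      where
      term₀ : ℕ → Carrier
      term₀ = T α (Nₘ 0) (1# + Nₘ 0 * Nₘ 0) (ε (n 0)) 1# (η 0)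
      vanish : e (q ^ 3) (1# + q ^ 3 * q ^ 3) (q * W 1) * ε (n 0) 1 ≈ 0#
      vanish = solve 2 (λ q ε → (q :^ 3 :- (one :+ q :^ 3 :* q :^ 3) :* (q :* (q :^ 2 :* one)) :+ q :^ 3 :* (q :* (q :^ 2 :* one) :* (q :* (q :^ 2 :* one)))) :* ε := con 0ℤ) refl q (ε (n 0) 1)
      term₁ : term₀ 1 ≈ q - 1#
      term₁ = begin
        term₀ 1
          ≈⟨ solve 5 (λ q α ν μ η → (one :- q :* (q :^ 2 :* one) :^ 3) :* (one :* ((one :- q :* one) :* α) :* (one :* ((q :^ 3 :- (one :+ q :^ 3 :* q :^ 3) :* (q :* one) :+ q :^ 3 :* (q :* one :* (q :* one))) :* (ν :* μ))) :* (one :* ((one :- q :* one :^ 2) :* (q :^ 2 :* one) :* η)))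
          := (q :- one) :* ((one :- q :^ 4 :* one :^ 2) :* α) :* ((q :^ 3 :- q :^ 4 :* one :^ 2) :* ν) :* ((one :- q :^ 3 :* (q :^ 4 :* one :^ 2)) :* μ) :* ((one :- one :* (q :^ 2 :* one)) :* η))
          refl q (α 0) (ν 3 0) (μ 3 0) (η 0 0) ⟩
        _ ≈⟨ times-unit (η-inv 0 refl 0) ⟩
        _ ≈⟨ times-unit (μ-inv 3 refl 1 ≡.refl 0) ⟩
        _ ≈⟨ times-unit (ν-inv 3 refl 1 ≡.refl 0) ⟩
        _ ≈⟨ times-unit (α-inv 0) ⟩
        q - 1# ∎
    sum-3mod4 (suc m) k i<k = begin
      S (suc m) k
        ≈⟨ step m i<k ⟩
      (1# - Nₘ m * q) * (1# - Nₘ m * q ^ 4) * S m k * (p * (w 0 (n m) * w 0 (n m ℕ.+ 3)))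
        ≈⟨ *-congʳ (*-congˡ (sum-3mod4 m k (ℕₚ.≤-<-trans (ℕₚ.+-monoʳ-≤ 1 (ℕₚ.*-monoʳ-≤ 2 (ℕₚ.n≤1+n m))) i<k))) ⟩
      (1# - Nₘ m * q) * (1# - Nₘ m * q ^ 4) * 0# * (p * (w 0 (n m) * w 0 (n m ℕ.+ 3)))
        ≈⟨ trans (*-congʳ (zeroʳ _)) (zeroˡ _) ⟩
      0# ∎

-- Divisibility, and congruences modulo powers of u in a subring

∣∣a-b∣∧∣a⇒∣b : ∀ {n} a b → n ∣ ℕ.∣ a - b ∣ → n ∣ a → n ∣ b
∣∣a-b∣∧∣a⇒∣b {n} a b n∣a-b n∣a with ℕₚ.≤-total a b
... | inj₁ a≤b = ∣m∸n∣n⇒∣m n a≤b (≡.subst (n ∣_) (ℕₚ.m≤n⇒∣m-n∣≡n∸m a≤b) n∣a-b) n∣a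
... | inj₂ b≤a = ∣m+n∣m⇒∣n (≡.subst (n ∣_) (≡.sym (≡.trans (≡.cong (ℕ._+ b) (ℕₚ.m≤n⇒∣n-m∣≡n∸m b≤a)) (ℕₚ.m∸n+n≡m b≤a))) n∣a) n∣a-b

-- Uses the explicit combination x (1 + 2M) = M (2x) + x.
odd∣2*⇒∣ : ∀ M x → 1 ℕ.+ 2 ℕ.* M ∣ 2 ℕ.* x → 1 ℕ.+ 2 ℕ.* M ∣ x
odd∣2*⇒∣ M x n∣2x = ∣m+n∣m⇒∣n (≡.subst (1 ℕ.+ 2 ℕ.* M ∣_) (eq M x) (n∣m*n x)) (∣n⇒∣m*n M n∣2x)
  where
  eq : ∀ M x → x ℕ.* (1 ℕ.+ 2 ℕ.* M) ≡ M ℕ.* (2 ℕ.* x) ℕ.+ x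
  eq = solve-∀

record Subring (K : CommutativeRing 0ℓ 0ℓ) (Loc : CommutativeRing.Carrier K → Set) : Set where
  open CommutativeRing K
  field
    Loc-≈   : ∀ {x y} → x ≈ y → Loc x → Loc y
    Loc-1   : Loc 1#
    Loc-+   : ∀ {x y} → Loc x → Loc y → Loc (x + y)
    Loc-*   : ∀ {x y} → Loc x → Loc y → Loc (x * y)
    Loc-neg : ∀ {x} → Loc x → Loc (- x)

module Localisation (K : CommutativeRing 0ℓ 0ℓ) (Loc : CommutativeRing.Carrier K → Set) (subring : Subring K Loc)
  (u : CommutativeRing.Carrier K) (Loc-u : Loc u) where
  open CommutativeRing K
  open Sums K
  open RingFacts K
  open Algebra.Properties.Ring ring using (-‿distribʳ-*)
  open ≈-Reasoning setoid
  open Subring subring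

  Loc-- : ∀ {x y} → Loc x → Loc y → Loc (x - y)
  Loc-- x y = Loc-+ x (Loc-neg y)

  Loc-0 : Loc 0#
  Loc-0 = Loc-≈ (-‿inverseʳ 1#) (Loc-- Loc-1 Loc-1)

  Loc-^ : ∀ {x} k → Loc x → Loc (x ^ k)
  Loc-^ zero    _ = Loc-1
  Loc-^ (suc k) x = Loc-* x (Loc-^ k x)

  weaken : ∀ {n} {Q : ℕ → Set} → (∀ i → i < suc n → Q i) → ∀ i → i < n → Q i
  weaken f i i<n = f i (ℕₚ.m<n⇒m<1+n i<n)

  Loc-Π : ∀ {f} k → (∀ i → i < k → Loc (f i)) → Loc (Π< k f)
  Loc-Π zero    f = Loc-1
  Loc-Π (suc k) f = Loc-* (Loc-Π k (weaken f)) (f k ℕₚ.≤-refl)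

  infix 4 _∈u^_
  -- The cofactor is confined to the subring: in the application u is a unit of the ambient ring,
  -- where divisibility by u says nothing.
  record _∈u^_ (x : Carrier) (k : ℕ) : Set where
    constructor quotient
    field
      cofactor     : Carrier
      Loc-cofactor : Loc cofactor
      equality     : x ≈ u ^ k * cofactor

  ∈-≈ : ∀ {x y k} → x ≈ y → y ∈u^ k → x ∈u^ k
  ∈-≈ x≈y (quotient l Ll eq) = quotient l Ll (trans x≈y eq)

  0∈ : ∀ {k} → 0# ∈u^ k
  0∈ = quotient 0# Loc-0 (sym (zeroʳ _))

  ∈-+ : ∀ {x y k} → x ∈u^ k → y ∈u^ k → x + y ∈u^ k
  ∈-+ (quotient l Ll eq) (quotient l′ Ll′ eq′) = quotient (l + l′) (Loc-+ Ll Ll′) (trans (+-cong eq eq′) (sym (distribˡ _ _ _)))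

  ∈-*ˡ : ∀ {x y k} → Loc x → y ∈u^ k → x * y ∈u^ k
  ∈-*ˡ {x} {y} {k} Lx (quotient l Ll eq) = quotient (x * l) (Loc-* Lx Ll) (trans (*-congˡ eq) (solve 3 (λ x v l → x :* (v :* l) := v :* (x :* l)) refl x (u ^ k) l))

  ∈-*ʳ : ∀ {x y k} → x ∈u^ k → Loc y → x * y ∈u^ k
  ∈-*ʳ x∈ Ly = ∈-≈ (*-comm _ _) (∈-*ˡ Ly x∈)

  ∈-neg : ∀ {x k} → x ∈u^ k → - x ∈u^ k
  ∈-neg (quotient l Ll eq) = quotient (- l) (Loc-neg Ll) (trans (-‿cong eq) (-‿distribʳ-* _ _))

  ∈-- : ∀ {x y k} → x ∈u^ k → y ∈u^ k → x - y ∈u^ k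
  ∈-- x∈ y∈ = ∈-+ x∈ (∈-neg y∈)

  ∈-* : ∀ {x y j k} → x ∈u^ j → y ∈u^ k → x * y ∈u^ (j ℕ.+ k)
  ∈-* {j = j} {k} (quotient l Ll eq) (quotient l′ Ll′ eq′) = quotient (l * l′) (Loc-* Ll Ll′) (begin
    _ ≈⟨ *-cong eq eq′ ⟩
    u ^ j * l * (u ^ k * l′) ≈⟨ solve 4 (λ x y l m → x :* l :* (y :* m) := x :* y :* (l :* m)) refl (u ^ j) (u ^ k) l l′ ⟩
    u ^ j * u ^ k * (l * l′) ≈⟨ *-congʳ (^-homo-* u j k) ⟨
    u ^ (j ℕ.+ k) * (l * l′) ∎)

  ∈-Σ : ∀ {f k} n → (∀ i → i < n → f i ∈u^ k) → Σ< n f ∈u^ k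
  ∈-Σ zero    f∈ = 0∈
  ∈-Σ (suc n) f∈ = ∈-+ (∈-Σ n (weaken f∈)) (f∈ n ℕₚ.≤-refl)

  ∈-Π : ∀ {f k i} n → (∀ i → i < n → Loc (f i)) → i < n → f i ∈u^ k → Π< n f ∈u^ k
  ∈-Π {i = i} (suc n) Lf i<1+n fi∈ with ℕₚ.m≤n⇒m<n∨m≡n (ℕₚ.≤-pred i<1+n)
  ... | inj₁ i<n    = ∈-*ʳ (∈-Π n (weaken Lf) i<n fi∈) (Lf n ℕₚ.≤-refl)
  ... | inj₂ ≡.refl = ∈-*ˡ (Loc-Π n (weaken Lf)) fi∈

  infix 4 _≡_[u^_]
  _≡_[u^_] : Carrier → Carrier → ℕ → Set
  x ≡ y [u^ k ] = x - y ∈u^ k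

  ≡u-refl : ∀ {x k} → x ≡ x [u^ k ]
  ≡u-refl = ∈-≈ (-‿inverseʳ _) 0∈

  ≡u-≈ : ∀ {x x′ y y′ k} → x ≈ x′ → y ≈ y′ → x′ ≡ y′ [u^ k ] → x ≡ y [u^ k ]
  ≡u-≈ x≈ y≈ = ∈-≈ (+-cong x≈ (-‿cong y≈))

  ≡u-trans : ∀ {x y z k} → x ≡ y [u^ k ] → y ≡ z [u^ k ] → x ≡ z [u^ k ]
  ≡u-trans x≡y y≡z = ∈-≈ (solve 3 (λ x y z → x :- z := x :- y :+ (y :- z)) refl _ _ _) (∈-+ x≡y y≡z)

  ≡u-∈ : ∀ {x y k} → x ≡ y [u^ k ] → y ∈u^ k → x ∈u^ k
  ≡u-∈ x≡y y∈ = ∈-≈ (solve 2 (λ x y → x := x :- y :+ y) refl _ _) (∈-+ x≡y y∈)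

  ≡u-- : ∀ {x x′ y y′ k} → x ≡ x′ [u^ k ] → y ≡ y′ [u^ k ] → x - y ≡ x′ - y′ [u^ k ]
  ≡u-- x≡ y≡ = ∈-≈ (solve 4 (λ a b c d → a :- b :- (c :- d) := a :- c :- (b :- d)) refl _ _ _ _) (∈-- x≡ y≡)

  ≡u-+ : ∀ {x x′ y y′ k} → x ≡ x′ [u^ k ] → y ≡ y′ [u^ k ] → x + y ≡ x′ + y′ [u^ k ]
  ≡u-+ x≡ y≡ = ∈-≈ (solve 4 (λ a b c d → a :+ b :- (c :+ d) := a :- c :+ (b :- d)) refl _ _ _ _) (∈-+ x≡ y≡)

  ≡u-* : ∀ {x x′ y y′ k} → Loc x → Loc y′ → x ≡ x′ [u^ k ] → y ≡ y′ [u^ k ] → x * y ≡ x′ * y′ [u^ k ]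
  ≡u-* {x} {x′} {y} {y′} Lx Ly′ x≡ y≡ = ∈-≈ (solve 4 (λ x a y b → x :* y :- a :* b := x :* (y :- b) :+ (x :- a) :* b) refl x x′ y y′) (∈-+ (∈-*ˡ Lx y≡) (∈-*ʳ x≡ Ly′))

  ≡u-Π : ∀ {f g k} n → (∀ i → i < n → Loc (f i)) → (∀ i → i < n → Loc (g i)) →
         (∀ i → i < n → f i ≡ g i [u^ k ]) → Π< n f ≡ Π< n g [u^ k ]
  ≡u-Π zero    Lf Lg eq = ≡u-refl
  ≡u-Π (suc n) Lf Lg eq = ≡u-* (Loc-Π n (weaken Lf)) (Lg n ℕₚ.≤-refl)
    (≡u-Π n (weaken Lf) (weaken Lg) (weaken eq)) (eq n ℕₚ.≤-refl)

  ≡u-inv : ∀ {x x⁻¹ y y⁻¹ k} → x * x⁻¹ ≈ 1# → y * y⁻¹ ≈ 1# → Loc x⁻¹ → Loc y⁻¹ → y ≡ x [u^ k ] → x⁻¹ ≡ y⁻¹ [u^ k ]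
  ≡u-inv {x} {x⁻¹} {y} {y⁻¹} xx yy Lx Ly y≡x = ∈-≈ (begin
    x⁻¹ - y⁻¹ ≈⟨ +-cong (times-unit yy) (-‿cong (times-unit xx)) ⟨
    x⁻¹ * (y * y⁻¹) - y⁻¹ * (x * x⁻¹) ≈⟨ solve 4 (λ x a y b → a :* (y :* b) :- b :* (x :* a) := a :* b :* (y :- x)) refl x x⁻¹ y y⁻¹ ⟩
    x⁻¹ * y⁻¹ * (y - x) ∎) (∈-*ˡ (Loc-* Lx Ly) y≡x)

  -- Only the last denominator may fail to be local, and the factor u that repairs it comes from the
  -- numerator `f i`. Zero and pole may sit at different indices, so only the product as a whole is
  -- local.
  Loc-Π-ratio : ∀ {f g i} n → (∀ i → Loc (f i)) → i < suc n → f i ∈u^ 1 →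
                (∀ i → i < n → Loc (g i)) → Loc (u * g n) → Loc (Π< (suc n) (λ i → f i * g i))
  Loc-Π-ratio {f} {g} n Lf i<n fi∈ Lg Lugₙ with ∈-Π (suc n) (λ i _ → Lf i) i<n fi∈
  ... | quotient l Ll eq = Loc-≈ (begin
    Π< n g * l * (u * g n) ≈⟨ solve 4 (λ P l u g → P :* l :* (u :* g) := u :^ 1 :* l :* (P :* g)) refl (Π< n g) l u (g n) ⟩
    u ^ 1 * l * (Π< n g * g n) ≈⟨ *-congʳ eq ⟨
    Π< (suc n) f * Π< (suc n) g ≈⟨ Π<-* (suc n) f g ⟨
    Π< (suc n) (λ i → f i * g i) ∎) (Loc-* (Loc-* (Loc-Π n Lg) Ll) Lugₙ)

  Loc-Π-blocks : ∀ {g} n → (∀ j → Loc (Π< n (λ i → g (j ℕ.* n ℕ.+ i)))) → ∀ j → Loc (Π< (j ℕ.* n) g)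
  Loc-Π-blocks n Lb zero = Loc-1
  Loc-Π-blocks {g} n Lb (suc j) = Loc-≈ (sym (trans (reflexive (≡.cong (λ k → Π< k g) (ℕₚ.+-comm n (j ℕ.* n)))) (Π<-+ (j ℕ.* n) n g)))
    (Loc-* (Loc-Π-blocks n Lb j) (Lb j))

-- Congruences modulo (1 - qⁿ)³ and sums over blocks

record LocalRing (K : CommutativeRing 0ℓ 0ℓ) (q p : CommutativeRing.Carrier K) (w : ℕ → ℕ → CommutativeRing.Carrier K)
  (n : ℕ) (Loc : CommutativeRing.Carrier K → Set) : Set where
  open CommutativeRing K
  open Sums K
  field
    subring   : Subring K Loc
    Loc-q     : Loc q
    Loc-p     : Loc p
    -- Along Φₙ a power difference has no zero when n does not divide a - b; by `Loc-uw` it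
    -- otherwise has at most a simple one.
    Loc-w     : ∀ {a b} → ¬ (n ∣ ℕ.∣ a - b ∣) → Loc (w a b)
    Loc-uw    : ∀ {a b} → a ≢ b → Loc ((1# - q ^ n) * w a b)
    Loc-1-q^n : Loc (1# - q ^ n)

-- The index `suc j` solves n ∣ 1 + 4i with i < n. It is used twice: it gives D = q^(1+4i),
-- congruent to 1 and still terminating in range, and it locates the vanishing numerator 1 -
-- q^(1+4i) in each block.
module LocalSum (K : CommutativeRing 0ℓ 0ℓ) (q p : CommutativeRing.Carrier K) (w : ℕ → ℕ → CommutativeRing.Carrier K)
  (inverses : Inverses K q p w) (t m j : ℕ) (n∣5+4j : (1 ℕ.+ 2 ℕ.* t ℕ.+ 4 ℕ.* m) ∣ 1 ℕ.+ 4 ℕ.* suc j) (1+j<n : suc j < 1 ℕ.+ 2 ℕ.* t ℕ.+ 4 ℕ.* m)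
  (Loc : CommutativeRing.Carrier K → Set) (local : LocalRing K q p w (1 ℕ.+ 2 ℕ.* t ℕ.+ 4 ℕ.* m) Loc) where
  open CommutativeRing K
  open Sums K
  open Terms K q
  open RingFacts K
  open Inverses inverses
  open Evaluation K q p w inverses
  open LocalRing local
  open Subring subring
  open Localisation K Loc subring (1# - q ^ (1 ℕ.+ 2 ℕ.* t ℕ.+ 4 ℕ.* m)) Loc-1-q^n
  open ≈-Reasoning setoid
  open SumN t using (Nₘ; Nₘ≈; n-odd; S)

  private
    n : ℕ
    n = 1 ℕ.+ 2 ℕ.* t ℕ.+ 4 ℕ.* m
    u : Carrier
    u = 1# - q ^ n
    M : ℕ
    M = t ℕ.+ 2 ℕ.* m
    n≡1+2M : n ≡ 1 ℕ.+ 2 ℕ.* M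
    n≡1+2M = n-odd m

  n∤1+i : ∀ {i} → suc i < n → ¬ n ∣ suc i
  n∤1+i 1+i<n n∣ = ℕₚ.<⇒≱ 1+i<n (∣⇒≤ n∣)

  n∣2*⇒n∣ : ∀ x → n ∣ 2 ℕ.* x → n ∣ x
  n∣2*⇒n∣ x n∣ = ≡.subst (_∣ x) (≡.sym n≡1+2M) (odd∣2*⇒∣ M x (≡.subst (_∣ 2 ℕ.* x) n≡1+2M n∣))

  -- In a block of n indices only the last, i = n - 1, has denominators divisible by Φₙ; hence the
  -- condition `suc i < n` in the locality and congruence lemmas for single factors.
  n∤2+2i : ∀ k i → suc i < n → ¬ n ∣ 2 ℕ.+ 2 ℕ.* (k ℕ.* n ℕ.+ i)
  n∤2+2i k i 1+i<n n∣ = n∤1+i 1+i<n (n∣2*⇒n∣ (suc i) (∣m+n∣m⇒∣n (≡.subst (n ∣_) (eq n k i) n∣) (n∣m*n (2 ℕ.* k))))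
    where
    eq : ∀ n k i → 2 ℕ.+ 2 ℕ.* (k ℕ.* n ℕ.+ i) ≡ 2 ℕ.* k ℕ.* n ℕ.+ 2 ℕ.* suc i
    eq = solve-∀

  n∤4+4i : ∀ k i → suc i < n → ¬ n ∣ 4 ℕ.+ 4 ℕ.* (k ℕ.* n ℕ.+ i)
  n∤4+4i k i 1+i<n n∣ = n∤2+2i k i 1+i<n (n∣2*⇒n∣ (2 ℕ.+ 2 ℕ.* (k ℕ.* n ℕ.+ i)) (≡.subst (n ∣_) (eq n k i) n∣))
    where
    eq : ∀ n k i → 4 ℕ.+ 4 ℕ.* (k ℕ.* n ℕ.+ i) ≡ 2 ℕ.* (2 ℕ.+ 2 ℕ.* (k ℕ.* n ℕ.+ i))
    eq = solve-∀

  Loc-q^ : ∀ k → Loc (q ^ k)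
  Loc-q^ k = Loc-^ k Loc-q

  Loc-W : ∀ i → Loc (W i)
  Loc-W i = Loc-^ i (Loc-q^ 2)

  Loc-α : ∀ k i → suc i < n → Loc (α (k ℕ.* n ℕ.+ i))
  Loc-α k i 1+i<n = Loc-w (n∤4+4i k i 1+i<n)

  Loc-η : ∀ a k i → n ∣ a → suc i < n → Loc (η a (k ℕ.* n ℕ.+ i))
  Loc-η a k i n∣a 1+i<n = Loc-w λ n∣ → n∤2+2i k i 1+i<n (∣m+n∣m⇒∣n n∣ n∣a)

  Loc-ν : ∀ i → suc i < n → Loc (ν n i)
  Loc-ν i 1+i<n = Loc-w λ n∣ → n∤4+4i 0 i 1+i<n (∣∣a-b∣∧∣a⇒∣b n (4 ℕ.+ 4 ℕ.* i) n∣ ∣-refl)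

  Loc-μ : ∀ i → suc i < n → Loc (μ n i)
  Loc-μ i 1+i<n = Loc-w λ n∣ → n∤4+4i 0 i 1+i<n (∣m+n∣m⇒∣n n∣ ∣-refl)

  Loc-e : ∀ {z y X} → Loc z → Loc y → Loc X → Loc (e z y X)
  Loc-e z y X = Loc-+ (Loc-- z (Loc-* y X)) (Loc-* z (Loc-* X X))

  1-q^kn∈u : ∀ k → 1# - q ^ (k ℕ.* n) ∈u^ 1
  1-q^kn∈u zero = ≡u-refl
  1-q^kn∈u (suc k) = ∈-≈ (begin
      1# - q ^ (n ℕ.+ k ℕ.* n) ≈⟨ +-congˡ (-‿cong (^-homo-* q n (k ℕ.* n))) ⟩
      1# - q ^ n * q ^ (k ℕ.* n) ≈⟨ solve 2 (λ x y → one :- x :* y := (one :- x) :^ 1 :* one :+ x :* (one :- y)) refl (q ^ n) (q ^ (k ℕ.* n)) ⟩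
      u ^ 1 * 1# + q ^ n * (1# - q ^ (k ℕ.* n)) ∎)
    (∈-+ (quotient 1# Loc-1 refl) (∈-*ˡ (Loc-q^ n) (1-q^kn∈u k)))

  1-q^∈u : ∀ {a} → n ∣ a → 1# - q ^ a ∈u^ 1
  1-q^∈u (divides k ≡.refl) = 1-q^kn∈u k

  q^-shift : ∀ c l k i → q ^ (c ℕ.+ l ℕ.* (k ℕ.* n ℕ.+ i)) ≡ q ^ (c ℕ.+ l ℕ.* i) [u^ 1 ]
  q^-shift c l k i = ∈-≈ (begin
      q ^ (c ℕ.+ l ℕ.* (k ℕ.* n ℕ.+ i)) - y ≈⟨ +-congʳ (trans (^-congʳ q (eq n c l k i)) (^-homo-* q (l ℕ.* k ℕ.* n) _)) ⟩
      x * y - y ≈⟨ solve 2 (λ x y → x :* y :- y := (con 0ℤ :- y) :* (one :- x)) refl x y ⟩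
      (0# - y) * (1# - x) ∎)
    (∈-*ˡ (Loc-- Loc-0 (Loc-q^ (c ℕ.+ l ℕ.* i))) (1-q^kn∈u (l ℕ.* k)))
    where
    x y : Carrier
    x = q ^ (l ℕ.* k ℕ.* n)
    y = q ^ (c ℕ.+ l ℕ.* i)
    eq : ∀ n c l k i → c ℕ.+ l ℕ.* (k ℕ.* n ℕ.+ i) ≡ l ℕ.* k ℕ.* n ℕ.+ (c ℕ.+ l ℕ.* i)
    eq = solve-∀

  private
    Nₙ Dₙ : Carrier
    Nₙ = Nₘ m
    Dₙ = D (suc j)

  1-N∈u : 1# - Nₙ ∈u^ 1
  1-N∈u = ∈-≈ (+-congˡ (-‿cong (Nₘ≈ m))) (1-q^∈u ∣-refl)

  1-D∈u : 1# - Dₙ ∈u^ 1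
  1-D∈u = ∈-≈ (+-congˡ (-‿cong (D≈ (suc j)))) (1-q^∈u n∣5+4j)

  Loc-N : Loc Nₙ
  Loc-N = Loc-≈ (sym (Nₘ≈ m)) (Loc-q^ n)

  Loc-D : ∀ i → Loc (D i)
  Loc-D i = Loc-≈ (sym (D≈ i)) (Loc-q^ (1 ℕ.+ 4 ℕ.* i))

  α² : ℕ → Carrier
  α² i = α i * α i

  Loc-α² : ∀ k i → suc i < n → Loc (α² (k ℕ.* n ℕ.+ i))
  Loc-α² k i 1+i<n = Loc-* (Loc-α k i 1+i<n) (Loc-α k i 1+i<n)

  Loc-ε : ∀ i → suc i < n → Loc (ε n i)
  Loc-ε i 1+i<n = Loc-* (Loc-ν i 1+i<n) (Loc-μ i 1+i<n)

  Loc-2 : Loc (1# + 1#)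
  Loc-2 = Loc-+ Loc-1 Loc-1

  Loc-1+N² : Loc (1# + Nₙ * Nₙ)
  Loc-1+N² = Loc-+ Loc-1 (Loc-* Loc-N Loc-N)

  r₁ r₂ b₁ b₂ : ℕ → Carrier
  r₁ = r 1# (1# + 1#) α²
  r₂ = r Nₙ (1# + Nₙ * Nₙ) (ε n)
  b₁ = b 1# (η 0)
  b₂ = b Dₙ (η (1 ℕ.+ 4 ℕ.* suc j))

  Loc-qW : ∀ i → Loc (q * W i)
  Loc-qW i = Loc-* Loc-q (Loc-W i)

  Loc-c : ∀ k i → suc i < n → Loc (c α (k ℕ.* n ℕ.+ i))
  Loc-c k i 1+i<n = Loc-* (Loc-- Loc-1 (Loc-qW (k ℕ.* n ℕ.+ i))) (Loc-α k i 1+i<n)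

  Loc-r₁ : ∀ k i → suc i < n → Loc (r₁ (k ℕ.* n ℕ.+ i))
  Loc-r₁ k i 1+i<n = Loc-* (Loc-e Loc-1 Loc-2 (Loc-qW (k ℕ.* n ℕ.+ i))) (Loc-α² k i 1+i<n)

  Loc-r₂ : ∀ i → suc i < n → Loc (r₂ i)
  Loc-r₂ i 1+i<n = Loc-* (Loc-e Loc-N Loc-1+N² (Loc-qW i)) (Loc-ε i 1+i<n)

  Loc-b : ∀ {D a} k i → Loc D → n ∣ a → suc i < n → Loc (b D (η a) (k ℕ.* n ℕ.+ i))
  Loc-b {a = a} k i LD n∣a 1+i<n = Loc-* (Loc-* (Loc-- LD (Loc-* Loc-q (Loc-^ 2 (Loc-W (k ℕ.* n ℕ.+ i))))) (Loc-* (Loc-q^ 2) (Loc-W (k ℕ.* n ℕ.+ i)))) (Loc-η a k i n∣a 1+i<n)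

  Loc-h : ∀ k → Loc (h k)
  Loc-h k = Loc-- Loc-1 (Loc-* Loc-q (Loc-^ 3 (Loc-W k)))

  n∣0 : n ∣ 0
  n∣0 = divides 0 ≡.refl

  below : ∀ {k} {Q : ℕ → Set} → (∀ i → suc i < n → Q i) → k < n → ∀ i → i < k → Q i
  below f k<n i i<k = f i (ℕₚ.≤-<-trans i<k k<n)

  1+i<n : ∀ {i k} → i < k → k < n → suc i < n
  1+i<n i<k k<n = ℕₚ.≤-<-trans i<k k<n

  -- (N − Y)(1 − NY) = N (1 − Y)² − Y (1 − N)², so passing from a = 1 to a = q^n
  -- only costs a multiple of (1 − q^n)².
  r-≡ : ∀ i → suc i < n → r₁ i ≡ r₂ i [u^ 2 ]
  r-≡ i 1+i<n = ∈-≈ (begin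
      e₁ Y * a - e₂ Y * a′
        ≈⟨ +-cong (times-unit (ε-inv n (Nₘ≈ m) M n≡1+2M i)) (-‿cong (times-unit (α²-inv i))) ⟨
      e₁ Y * a * (e₂ Y′ * a′) - e₂ Y * a′ * (e₁ Y′ * a)
        ≈⟨ solve 5 (λ N Y Z a b → (one :- (one :+ one) :* Y :+ one :* (Y :* Y)) :* a :* ((N :- (one :+ N :* N) :* Z :+ N :* (Z :* Z)) :* b) :- (N :- (one :+ N :* N) :* Y :+ N :* (Y :* Y)) :* b :* ((one :- (one :+ one) :* Z :+ one :* (Z :* Z)) :* a)
          := (one :- N) :* (one :- N) :* (a :* b :* (Y :* (one :- (one :+ one) :* Z :+ one :* (Z :* Z)) :- Z :* (one :- (one :+ one) :* Y :+ one :* (Y :* Y)))))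
          refl Nₙ Y Y′ a a′ ⟩
      (1# - Nₙ) * (1# - Nₙ) * (a * a′ * (Y * e₁ Y′ - Y′ * e₁ Y)) ∎)
    (∈-*ʳ (∈-* 1-N∈u 1-N∈u) (Loc-* (Loc-* (Loc-α² 0 i 1+i<n) (Loc-ε i 1+i<n))
      (Loc-- (Loc-* (Loc-qW i) (Loc-e Loc-1 Loc-2 LY′)) (Loc-* LY′ (Loc-e Loc-1 Loc-2 (Loc-qW i))))))
    where
    e₁ e₂ : Carrier → Carrier
    e₁ = e 1# (1# + 1#)
    e₂ = e Nₙ (1# + Nₙ * Nₙ)
    Y Y′ a a′ : Carrier
    Y = q * W i
    Y′ = q ^ 4 * W i ^ 2
    a = α² i
    a′ = ε n i
    LY′ : Loc Y′
    LY′ = Loc-* (Loc-q^ 4) (Loc-^ 2 (Loc-W i))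

  -- The closed forms for D = q^(4j+1) depend on a only through these factors.
  zε-≡ : ∀ i → suc i < n → 1# * α² i ≡ Nₙ * ε n i [u^ 2 ]
  zε-≡ i 1+i<n = ∈-≈ (begin
      1# * a - Nₙ * a′
        ≈⟨ +-cong (times-unit (ε-inv n (Nₘ≈ m) M n≡1+2M i)) (-‿cong (times-unit (α²-inv i))) ⟨
      1# * a * (e Nₙ (1# + Nₙ * Nₙ) Y′ * a′) - Nₙ * a′ * (e 1# (1# + 1#) Y′ * a)
        ≈⟨ solve 4 (λ N Z a b → one :* a :* ((N :- (one :+ N :* N) :* Z :+ N :* (Z :* Z)) :* b) :- N :* b :* ((one :- (one :+ one) :* Z :+ one :* (Z :* Z)) :* a)
          := (one :- N) :* (one :- N) :* (a :* b :* (con 0ℤ :- Z)))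
          refl Nₙ Y′ a a′ ⟩
      (1# - Nₙ) * (1# - Nₙ) * (a * a′ * (0# - Y′)) ∎)
    (∈-*ʳ (∈-* 1-N∈u 1-N∈u) (Loc-* (Loc-* (Loc-α² 0 i 1+i<n) (Loc-ε i 1+i<n)) (Loc-- Loc-0 (Loc-* (Loc-q^ 4) (Loc-^ 2 (Loc-W i))))))
    where
    Y′ a a′ : Carrier
    Y′ = q ^ 4 * W i ^ 2
    a = α² i
    a′ = ε n i

  b-≡ : ∀ i → suc i < n → b₁ i ≡ b₂ i [u^ 1 ]
  b-≡ i 1+i<n = ∈-≈ (begin
      (1# - Y) * Z * x - (Dₙ - Y) * Z * y
        ≈⟨ +-cong (times-unit (η-inv a (D≈ (suc j)) i)) (-‿cong (times-unit (η-inv 0 refl i))) ⟨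
      (1# - Y) * Z * x * ((1# - Dₙ * Z) * y) - (Dₙ - Y) * Z * y * ((1# - 1# * Z) * x)
        ≈⟨ solve 5 (λ D Y Z x y → (one :- Y) :* Z :* x :* ((one :- D :* Z) :* y) :- (D :- Y) :* Z :* y :* ((one :- one :* Z) :* x) := (one :- D) :* (Z :* x :* y :* (one :- Y :* Z))) refl Dₙ Y Z x y ⟩
      (1# - Dₙ) * (Z * x * y * (1# - Y * Z)) ∎)
    (∈-*ʳ 1-D∈u (Loc-* (Loc-* (Loc-* LZ (Loc-η 0 0 i n∣0 1+i<n)) (Loc-η a 0 i n∣5+4j 1+i<n)) (Loc-- Loc-1 (Loc-* (Loc-* Loc-q (Loc-^ 2 (Loc-W i))) LZ))))
    where
    a : ℕ
    a = 1 ℕ.+ 4 ℕ.* suc j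
    Y Z x y : Carrier
    Y = q * W i ^ 2
    Z = q ^ 2 * W i
    x = η 0 i
    y = η a i
    LZ : Loc Z
    LZ = Loc-* (Loc-q^ 2) (Loc-W i)

  -- The first index is 1 for a = 1 and 2 for a = qⁿ; the second is 1 for D = 1 and 2 for D =
  -- q^(1+4·suc j).
  t₁₁ t₂₁ t₁₂ t₂₂ : ℕ → Carrier
  t₁₁ = T α 1# (1# + 1#) α² 1# (η 0)
  t₂₁ = T α Nₙ (1# + Nₙ * Nₙ) (ε n) 1# (η 0)
  t₁₂ = T α 1# (1# + 1#) α² Dₙ (η (1 ℕ.+ 4 ℕ.* suc j))
  t₂₂ = T α Nₙ (1# + Nₙ * Nₙ) (ε n) Dₙ (η (1 ℕ.+ 4 ℕ.* suc j))

  -- The a-part and the D-part of the term are separate factors, so the difference is a product h C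
  -- (R₁ - R₂)(B₁ - B₂), of order 2 + 1 in u.
  second-difference : ∀ k → k < n → t₁₁ k - t₂₁ k ≡ t₁₂ k - t₂₂ k [u^ 3 ]
  second-difference k k<n = ∈-≈
    (solve 6 (λ h C R S B D → h :* (C :* R :* B) :- h :* (C :* S :* B) :- (h :* (C :* R :* D) :- h :* (C :* S :* D)) := h :* C :* ((R :- S) :* (B :- D))) refl (h k) (Π< k (c α)) (Π< k r₁) (Π< k r₂) (Π< k b₁) (Π< k b₂))
    (∈-*ˡ (Loc-* (Loc-h k) (Loc-Π k (below (Loc-c 0) k<n)))
      (∈-* (≡u-Π k (below (Loc-r₁ 0) k<n) (below Loc-r₂ k<n) (below r-≡ k<n))
           (≡u-Π k (λ i i<k → Loc-b 0 i Loc-1 n∣0 (1+i<n i<k k<n)) (λ i i<k → Loc-b 0 i (Loc-D (suc j)) n∣5+4j (1+i<n i<k k<n)) (below b-≡ k<n))))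

  -- The two closed forms share the product of g, whose factor of index j contains 1 - D j q⁴ = 1 -
  -- D (suc j) and thus one power of u. The other products agree modulo u² by `zε-≡`.
  Σt₁₂≡Σt₂₂ : Σ< n t₁₂ ≡ Σ< n t₂₂ [u^ 3 ]
  Σt₁₂≡Σt₂₂ = ∈-≈ (begin
      Σ< n t₁₂ - Σ< n t₂₂
        ≈⟨ +-cong (sum 1# (1# + 1#) α² α²-inv (suc j) n 1+j<n) (-‿cong (sum Nₙ (1# + Nₙ * Nₙ) (ε n) (ε-inv n (Nₘ≈ m) M n≡1+2M) (suc j) n 1+j<n)) ⟩
      (1# - q) * Π< (suc j) (λ i → 1# * g i * α² i) - (1# - q) * Π< (suc j) (λ i → Nₙ * g i * ε n i)
        ≈⟨ +-cong (*-congˡ (split 1# α²)) (-‿cong (*-congˡ (split Nₙ (ε n)))) ⟩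
      (1# - q) * (Π< (suc j) g * P₁) - (1# - q) * (Π< (suc j) g * P₂)
        ≈⟨ solve 4 (λ q G x y → (one :- q) :* (G :* x) :- (one :- q) :* (G :* y) := (one :- q) :* (G :* (x :- y))) refl q (Π< (suc j) g) P₁ P₂ ⟩
      (1# - q) * (Π< (suc j) g * (P₁ - P₂)) ∎)
    (∈-*ˡ (Loc-- Loc-1 Loc-q) (∈-*
      (∈-Π (suc j) (λ i _ → Loc-g i) ℕₚ.≤-refl (∈-*ˡ (Loc-- Loc-1 (Loc-* (Loc-D j) (Loc-q^ 2))) 1-D∈u))
      (≡u-Π (suc j) (λ i i<j → Loc-* Loc-1 (Loc-α² 0 i (1+i<n i<j 1+j<n))) (λ i i<j → Loc-* Loc-N (Loc-ε i (1+i<n i<j 1+j<n))) (λ i i<j → zε-≡ i (1+i<n i<j 1+j<n)))))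
    where
    open SumD using (sum)
    g : ℕ → Carrier
    g i = (1# - D i * q ^ 2) * (1# - D i * q ^ 4)
    Loc-g : ∀ i → Loc (g i)
    Loc-g i = Loc-* (Loc-- Loc-1 (Loc-* (Loc-D i) (Loc-q^ 2))) (Loc-- Loc-1 (Loc-* (Loc-D i) (Loc-q^ 4)))
    P₁ P₂ : Carrier
    P₁ = Π< (suc j) (λ i → 1# * α² i)
    P₂ = Π< (suc j) (λ i → Nₙ * ε n i)
    split : ∀ z ε → Π< (suc j) (λ i → z * g i * ε i) ≈ Π< (suc j) g * Π< (suc j) (λ i → z * ε i)
    split z ε = trans (Π<-cong (suc j) λ i → solve 3 (λ z g ε → z :* g :* ε := g :* (z :* ε)) refl z (g i) (ε i)) (Π<-* (suc j) g (λ i → z * ε i))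

  Σt₁₁≡Σt₂₁ : Σ< n t₁₁ ≡ S m n [u^ 3 ]
  Σt₁₁≡Σt₂₁ = ∈-≈ (begin
      Σ< n t₁₁ - Σ< n t₂₁
        ≈⟨ Σ<-- n t₁₁ t₂₁ ⟨
      Σ< n d₁
        ≈⟨ solve 2 (λ x y → x := x :- y :+ y) refl (Σ< n d₁) (Σ< n d₂) ⟩
      Σ< n d₁ - Σ< n d₂ + Σ< n d₂
        ≈⟨ +-cong (Σ<-- n d₁ d₂) (sym (Σ<-- n t₁₂ t₂₂)) ⟨
      Σ< n (λ k → d₁ k - d₂ k) + (Σ< n t₁₂ - Σ< n t₂₂) ∎)
    (∈-+ (∈-Σ n second-difference) Σt₁₂≡Σt₂₂)
    where
    d₁ d₂ : ℕ → Carrier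
    d₁ k = t₁₁ k - t₂₁ k
    d₂ k = t₁₂ k - t₂₂ k

  M<n : M < n
  M<n = ≡.subst (M <_) (≡.sym n≡1+2M) (s≤s (ℕₚ.m≤m+n M (M ℕ.+ 0)))

  -- Beyond index M the numerator contains 1 - q^(2M+1) = 1 - qⁿ three times, once in c and twice in
  -- r₁, while for k < n all denominators are still units.
  t₁₁-tail : ∀ k → M < k → k < n → t₁₁ k ∈u^ 3
  t₁₁-tail k M<k k<n = ∈-*ˡ (Loc-h k) (∈-*ʳ (∈-*
      (∈-Π k (below (Loc-c 0) k<n) M<k (∈-*ʳ 1-qW∈u (Loc-α 0 M (1+i<n M<k k<n))))
      (∈-Π k (below (Loc-r₁ 0) k<n) M<k (∈-*ʳ (∈-≈ (solve 1 (λ Y → one :- (one :+ one) :* Y :+ one :* (Y :* Y) := (one :- Y) :* (one :- Y)) refl (q * W M)) (∈-* 1-qW∈u 1-qW∈u)) (Loc-α² 0 M (1+i<n M<k k<n)))))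
    (Loc-Π k (λ i i<k → Loc-b 0 i Loc-1 n∣0 (1+i<n i<k k<n))))
    where
    1-qW∈u : 1# - q * W M ∈u^ 1
    1-qW∈u = ∈-≈ (+-congˡ (-‿cong (*-congˡ (W≈ M)))) (1-q^∈u {1 ℕ.+ 2 ℕ.* M} (≡.subst (n ∣_) n≡1+2M ∣-refl))

  Σt₁₁-half : Σ< (suc M) t₁₁ ≡ Σ< n t₁₁ [u^ 3 ]
  Σt₁₁-half = ∈-≈ (begin
      Σ< (suc M) t₁₁ - Σ< n t₁₁
        ≡⟨ ≡.cong (λ k → Σ< (suc M) t₁₁ - Σ< k t₁₁) (≡.trans n≡1+2M (≡.cong (λ k → suc (M ℕ.+ k)) (ℕₚ.+-identityʳ M))) ⟩
      Σ< (suc M) t₁₁ - Σ< (suc M ℕ.+ M) t₁₁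
        ≈⟨ +-congˡ (-‿cong (Σ<-+ (suc M) M t₁₁)) ⟩
      Σ< (suc M) t₁₁ - (Σ< (suc M) t₁₁ + Σ< M (λ i → t₁₁ (suc M ℕ.+ i)))
        ≈⟨ solve 2 (λ x y → x :- (x :+ y) := con 0ℤ :- y) refl (Σ< (suc M) t₁₁) (Σ< M (λ i → t₁₁ (suc M ℕ.+ i))) ⟩
      0# - Σ< M (λ i → t₁₁ (suc M ℕ.+ i)) ∎)
    (∈-- 0∈ (∈-Σ M λ i i<M → t₁₁-tail (suc M ℕ.+ i) (s≤s (ℕₚ.m≤m+n M i))
      (≡.subst (suc M ℕ.+ i <_) (≡.sym n≡1+2M) (s≤s (ℕₚ.+-monoʳ-< M (≡.subst (i <_) (≡.sym (ℕₚ.+-identityʳ M)) i<M))))))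

  ρ : ℕ → Carrier
  ρ i = c α i * r₁ i * b₁ i

  t₁₁≈hΠρ : ∀ k → t₁₁ k ≈ h k * Π< k ρ
  t₁₁≈hΠρ k = *-congˡ (sym (trans (Π<-* k (λ i → c α i * r₁ i) b₁) (*-congʳ (Π<-* k (c α) r₁))))

  Loc-ρ : ∀ k i → suc i < n → Loc (ρ (k ℕ.* n ℕ.+ i))
  Loc-ρ k i 1+i<n = Loc-* (Loc-* (Loc-c k i 1+i<n) (Loc-r₁ k i 1+i<n)) (Loc-b k i Loc-1 n∣0 1+i<n)

  module _ (k i : ℕ) where
    private
      i′ : ℕ
      i′ = k ℕ.* n ℕ.+ i

    qW-shift : q * W i′ ≡ q * W i [u^ 1 ]
    qW-shift = ≡u-≈ (*-congˡ (W≈ i′)) (*-congˡ (W≈ i)) (q^-shift 1 2 k i)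

    qW²-shift : q * W i′ ^ 2 ≡ q * W i ^ 2 [u^ 1 ]
    qW²-shift = ≡u-≈ (*-congˡ (W²≈ i′)) (*-congˡ (W²≈ i)) (q^-shift 1 4 k i)

    q²W-shift : q ^ 2 * W i′ ≡ q ^ 2 * W i [u^ 1 ]
    q²W-shift = ≡u-≈ (q²W≈ i′) (q²W≈ i) (q^-shift 2 2 k i)

    h-shift : h i′ ≡ h i [u^ 1 ]
    h-shift = ≡u-- ≡u-refl (≡u-≈ (*-congˡ (W³≈ i′)) (*-congˡ (W³≈ i)) (q^-shift 1 6 k i))

    module _ (1+i<n : suc i < n) where

      α-shift : α i′ ≡ α i [u^ 1 ]
      α-shift = ≡u-inv (w-inv {0} λ ()) (w-inv {0} λ ()) (Loc-α k i 1+i<n) (Loc-α 0 i 1+i<n)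
        (∈-≈ (solve 2 (λ x y → one :- x :- (one :- y) := y :- x) refl (q ^ (4 ℕ.+ 4 ℕ.* i)) (q ^ (4 ℕ.+ 4 ℕ.* i′))) (q^-shift 4 4 k i))

      η-shift : η 0 i′ ≡ η 0 i [u^ 1 ]
      η-shift = ≡u-inv (w-inv {0} λ ()) (w-inv {0} λ ()) (Loc-η 0 k i n∣0 1+i<n) (Loc-η 0 0 i n∣0 1+i<n)
        (∈-≈ (solve 2 (λ x y → one :- x :- (one :- y) := y :- x) refl (q ^ (2 ℕ.+ 2 ℕ.* i)) (q ^ (2 ℕ.+ 2 ℕ.* i′))) (q^-shift 2 2 k i))

      ρ-shift : ρ i′ ≡ ρ i [u^ 1 ]
      ρ-shift = ≡u-* (Loc-* (Loc-c k i 1+i<n) (Loc-r₁ k i 1+i<n)) (Loc-b 0 i Loc-1 n∣0 1+i<n)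
        (≡u-* (Loc-c k i 1+i<n) (Loc-r₁ 0 i 1+i<n)
          (≡u-* (Loc-- Loc-1 (Loc-qW i′)) (Loc-α 0 i 1+i<n) (≡u-- ≡u-refl qW-shift) α-shift)
          (≡u-* (Loc-e Loc-1 Loc-2 (Loc-qW i′)) (Loc-α² 0 i 1+i<n)
            (≡u-+ (≡u-- ≡u-refl (≡u-* Loc-2 (Loc-qW i) ≡u-refl qW-shift)) (≡u-* Loc-1 (Loc-* (Loc-qW i) (Loc-qW i)) ≡u-refl (≡u-* (Loc-qW i′) (Loc-qW i) qW-shift qW-shift)))
            (≡u-* (Loc-α k i 1+i<n) (Loc-α 0 i 1+i<n) α-shift α-shift)))
        (≡u-* (Loc-* (Loc-- Loc-1 (Loc-* Loc-q (Loc-^ 2 (Loc-W i′)))) (Loc-* (Loc-q^ 2) (Loc-W i′))) (Loc-η 0 0 i n∣0 1+i<n)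
          (≡u-* (Loc-- Loc-1 (Loc-* Loc-q (Loc-^ 2 (Loc-W i′)))) (Loc-* (Loc-q^ 2) (Loc-W i)) (≡u-- ≡u-refl qW²-shift) q²W-shift)
          η-shift)

  Loc-1-q^ : ∀ k → Loc (1# - q ^ k)
  Loc-1-q^ k = Loc-- Loc-1 (Loc-q^ k)

  Loc-ratio-block : ∀ (a g : ℕ → ℕ) k {i} → i < n → n ∣ a (k ℕ.* n ℕ.+ i) →
    (∀ i → 0 ≢ g i) → (∀ i → suc i < n → ¬ n ∣ g (k ℕ.* n ℕ.+ i)) →
    Loc (Π< n (λ i → (1# - q ^ a (k ℕ.* n ℕ.+ i)) * w 0 (g (k ℕ.* n ℕ.+ i))))
  Loc-ratio-block a g k i<n n∣a g≢0 n∤g = Loc-Π-ratio (2 ℕ.* t ℕ.+ 4 ℕ.* m) (λ i → Loc-1-q^ (a (k ℕ.* n ℕ.+ i))) i<n (1-q^∈u n∣a)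
    (λ i i<n → Loc-w (n∤g i (s≤s i<n))) (Loc-uw (g≢0 (k ℕ.* n ℕ.+ (2 ℕ.* t ℕ.+ 4 ℕ.* m))))

  -- ρ consists of three copies of (1 - q^(2i+1))/(1 - q^(4i+4)), one of (1 - q^(4i+1))/(1 -
  -- q^(2i+2)) and a power of q. In each block the pole at i = n - 1 is balanced by the zero of the
  -- numerator, at i = M for the first kind and at i = suc j for the second.
  Loc-ρ-block : ∀ k → Loc (Π< n (λ i → ρ (k ℕ.* n ℕ.+ i)))
  Loc-ρ-block k = Loc-≈ (sym (begin
      Π< n (λ i → ρ (i′ i))
        ≈⟨ Π<-cong n (λ i → trans (factors (i′ i)) (*-cong (*-cong (*-cong (f≈ (i′ i)) (*-cong (f≈ (i′ i)) (f≈ (i′ i)))) (g≈ (i′ i))) refl)) ⟩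
      Π< n (λ i → f (i′ i) * (f (i′ i) * f (i′ i)) * g (i′ i) * v (i′ i))
        ≈⟨ Π<-* n (λ i → f (i′ i) * (f (i′ i) * f (i′ i)) * g (i′ i)) (λ i → v (i′ i)) ⟩
      Π< n (λ i → f (i′ i) * (f (i′ i) * f (i′ i)) * g (i′ i)) * Π< n (λ i → v (i′ i))
        ≈⟨ *-congʳ (Π<-* n (λ i → f (i′ i) * (f (i′ i) * f (i′ i))) (λ i → g (i′ i))) ⟩
      Π< n (λ i → f (i′ i) * (f (i′ i) * f (i′ i))) * Π< n (λ i → g (i′ i)) * Π< n (λ i → v (i′ i))
        ≈⟨ *-congʳ (*-congʳ (trans (Π<-* n (λ i → f (i′ i)) (λ i → f (i′ i) * f (i′ i))) (*-congˡ (Π<-* n (λ i → f (i′ i)) (λ i → f (i′ i)))))) ⟩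
      Π< n (λ i → f (i′ i)) * (Π< n (λ i → f (i′ i)) * Π< n (λ i → f (i′ i))) * Π< n (λ i → g (i′ i)) * Π< n (λ i → v (i′ i)) ∎))
    (Loc-* (Loc-* (Loc-* Lf (Loc-* Lf Lf)) Lg) (Loc-Π n λ i _ → Loc-* (Loc-q^ 2) (Loc-W (i′ i))))
    where
    i′ : ℕ → ℕ
    i′ i = k ℕ.* n ℕ.+ i
    f g v : ℕ → Carrier
    f i = (1# - q ^ (1 ℕ.+ 2 ℕ.* i)) * α i
    g i = (1# - q ^ (1 ℕ.+ 4 ℕ.* i)) * η 0 i
    v i = q ^ 2 * W i
    factors : ∀ i → ρ i ≈ c α i * (c α i * c α i) * ((1# - q * W i ^ 2) * η 0 i) * v i
    factors i = solve 5 (λ x α y v η → (one :- x) :* α :* ((one :- (one :+ one) :* x :+ one :* (x :* x)) :* (α :* α)) :* ((one :- y) :* v :* η)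
          := (one :- x) :* α :* ((one :- x) :* α :* ((one :- x) :* α)) :* ((one :- y) :* η) :* v)
          refl (q * W i) (α i) (q * W i ^ 2) (v i) (η 0 i)
    f≈ : ∀ i → c α i ≈ f i
    f≈ i = *-congʳ (+-congˡ (-‿cong (*-congˡ (W≈ i))))
    g≈ : ∀ i → (1# - q * W i ^ 2) * η 0 i ≈ g i
    g≈ i = *-congʳ (+-congˡ (-‿cong (*-congˡ (W²≈ i))))
    Lf : Loc (Π< n (λ i → f (i′ i)))
    Lf = Loc-ratio-block (λ i → 1 ℕ.+ 2 ℕ.* i) (λ i → 4 ℕ.+ 4 ℕ.* i) k M<n
      (≡.subst (n ∣_) (≡.sym (≡.trans (eq n k M) (≡.cong (2 ℕ.* k ℕ.* n ℕ.+_) (≡.sym n≡1+2M)))) (∣m∣n⇒∣m+n (n∣m*n (2 ℕ.* k)) ∣-refl))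
      (λ _ ()) (n∤4+4i k)
      where
      eq : ∀ n k M → 1 ℕ.+ 2 ℕ.* (k ℕ.* n ℕ.+ M) ≡ 2 ℕ.* k ℕ.* n ℕ.+ (1 ℕ.+ 2 ℕ.* M)
      eq = solve-∀
    Lg : Loc (Π< n (λ i → g (i′ i)))
    Lg = Loc-ratio-block (λ i → 1 ℕ.+ 4 ℕ.* i) (λ i → 2 ℕ.+ 2 ℕ.* i) k 1+j<n
      (≡.subst (n ∣_) (≡.sym (eq n k (suc j))) (∣m∣n⇒∣m+n (n∣m*n (4 ℕ.* k)) n∣5+4j))
      (λ _ ()) (n∤2+2i k)
      where
      eq : ∀ n k i → 1 ℕ.+ 4 ℕ.* (k ℕ.* n ℕ.+ i) ≡ 4 ℕ.* k ℕ.* n ℕ.+ (1 ℕ.+ 4 ℕ.* i)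
      eq = solve-∀

  -- m′ is arbitrary because the closed form belonging to n is also examined at proper divisors of
  -- n. Full blocks are balanced by the zero at i = M, where 2 + 4M = 2n; the incomplete last block
  -- contains no pole.
  Loc-closed : ∀ m′ → Loc (closed m′)
  Loc-closed m′ = Loc-* (Loc-≈ (sym (begin
      Π< m′ g ≡⟨ ≡.cong (λ k → Π< k g) (≡.trans (m≡m%n+[m/n]*n m′ n) (ℕₚ.+-comm (m′ % n) _)) ⟩
      Π< (k ℕ.* n ℕ.+ m′ % n) g ≈⟨ Π<-+ (k ℕ.* n) (m′ % n) g ⟩
      Π< (k ℕ.* n) g * Π< (m′ % n) (λ i → g (k ℕ.* n ℕ.+ i)) ∎))
    (Loc-* (Loc-Π-blocks n block k) (Loc-Π (m′ % n) λ i i<r → Loc-* (Loc-1-q^ (2 ℕ.+ 4 ℕ.* (k ℕ.* n ℕ.+ i))) (Loc-α k i (ℕₚ.≤-<-trans i<r (m%n<n m′ n))))))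
    (Loc-^ m′ Loc-p)
    where
    k : ℕ
    k = m′ / n
    g : ℕ → Carrier
    g i = (1# - q ^ (2 ℕ.+ 4 ℕ.* i)) * α i
    block : ∀ k → Loc (Π< n (λ i → g (k ℕ.* n ℕ.+ i)))
    block k = Loc-ratio-block (λ i → 2 ℕ.+ 4 ℕ.* i) (λ i → 4 ℕ.+ 4 ℕ.* i) k M<n
      (≡.subst (n ∣_) (≡.sym (≡.trans (eq n k M) (≡.cong (λ x → 4 ℕ.* k ℕ.* n ℕ.+ 2 ℕ.* x) (≡.sym n≡1+2M)))) (∣m∣n⇒∣m+n (n∣m*n (4 ℕ.* k)) (n∣m*n 2)))
      (λ _ ()) (n∤4+4i k)
      where
      eq : ∀ n k M → 2 ℕ.+ 4 ℕ.* (k ℕ.* n ℕ.+ M) ≡ 4 ℕ.* k ℕ.* n ℕ.+ 2 ℕ.* (1 ℕ.+ 2 ℕ.* M)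
      eq = solve-∀

  t₁₁-shift : ∀ k i → i < n → t₁₁ (k ℕ.* n ℕ.+ i) ≡ Π< (k ℕ.* n) ρ * t₁₁ i [u^ 1 ]
  t₁₁-shift k i i<n = ≡u-≈
    (begin
      t₁₁ i′ ≈⟨ t₁₁≈hΠρ i′ ⟩
      h i′ * Π< i′ ρ ≈⟨ *-congˡ (Π<-+ (k ℕ.* n) i ρ) ⟩
      h i′ * (Π< (k ℕ.* n) ρ * Π< i (λ l → ρ (k ℕ.* n ℕ.+ l))) ≈⟨ solve 3 (λ h R P → h :* (R :* P) := R :* (h :* P)) refl (h i′) (Π< (k ℕ.* n) ρ) (Π< i (λ l → ρ (k ℕ.* n ℕ.+ l))) ⟩
      Π< (k ℕ.* n) ρ * (h i′ * Π< i (λ l → ρ (k ℕ.* n ℕ.+ l))) ∎)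
    (*-congˡ (t₁₁≈hΠρ i))
    (≡u-* (Loc-Π-blocks n Loc-ρ-block k) (Loc-* (Loc-h i) (Loc-Π i (below (Loc-ρ 0) i<n))) ≡u-refl
      (≡u-* (Loc-h i′) (Loc-Π i (below (Loc-ρ 0) i<n)) (h-shift k i)
        (≡u-Π i (below (Loc-ρ k) i<n) (below (Loc-ρ 0) i<n) (below (ρ-shift k) i<n))))
    where
    i′ : ℕ
    i′ = k ℕ.* n ℕ.+ i

  Σ-block∈u : ∀ {L} k → L ≤ n → Σ< L t₁₁ ∈u^ 1 → Σ< L (λ i → t₁₁ (k ℕ.* n ℕ.+ i)) ∈u^ 1
  Σ-block∈u {L} k L≤n Σ∈ = ≡u-∈ (≡u-≈ refl (sym (Σ<-*ˡ L (Π< (k ℕ.* n) ρ) t₁₁))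
      (∈-≈ (sym (Σ<-- L (λ i → t₁₁ (k ℕ.* n ℕ.+ i)) (λ i → Π< (k ℕ.* n) ρ * t₁₁ i))) (∈-Σ L λ i i<L → t₁₁-shift k i (ℕₚ.<-≤-trans i<L L≤n))))
    (∈-*ˡ (Loc-Π-blocks n Loc-ρ-block k) Σ∈)

  module Blocks (S∈u : S m n ∈u^ 1) where

    ∈u³⇒∈u : ∀ {x} → x ∈u^ 3 → x ∈u^ 1
    ∈u³⇒∈u (quotient l Ll eq) = quotient (u * u * l) (Loc-* (Loc-* Loc-1-q^n Loc-1-q^n) Ll) (trans eq (solve 2 (λ u l → u :^ 3 :* l := u :^ 1 :* (u :* u :* l)) refl u l))

    Σ-full∈u : ∀ k → Σ< (k ℕ.* n) t₁₁ ∈u^ 1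
    Σ-full∈u zero    = 0∈
    Σ-full∈u (suc k) = ∈-≈ (trans (reflexive (≡.cong (λ l → Σ< l t₁₁) (ℕₚ.+-comm n (k ℕ.* n)))) (Σ<-+ (k ℕ.* n) n t₁₁))
      (∈-+ (Σ-full∈u k) (Σ-block∈u k ℕₚ.≤-refl (≡u-∈ (∈u³⇒∈u Σt₁₁≡Σt₂₁) S∈u)))

    Σ-half∈u : ∀ k → Σ< (k ℕ.* n ℕ.+ suc M) t₁₁ ∈u^ 1
    Σ-half∈u k = ∈-≈ (Σ<-+ (k ℕ.* n) (suc M) t₁₁)
      (∈-+ (Σ-full∈u k) (Σ-block∈u k M<n (≡u-∈ (∈u³⇒∈u Σt₁₁-half) (≡u-∈ (∈u³⇒∈u Σt₁₁≡Σt₂₁) S∈u))))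

-- Coprimality up to integer constants

module Comaximality (R : CommutativeRing 0ℓ 0ℓ) where
  open CommutativeRing R
  open Sums R
  open ≈-Reasoning setoid

  -- Over ℤ[q] this is coprimality in ℚ[q], witnessed by a Bézout relation with cleared denominators.
  record Comax (A B : Carrier) : Set where
    constructor comax
    field
      U V    : Carrier
      c      : ℤ
      c≢0    : c ≢ 0ℤ
      bezout : U * A + V * B ≈ fromℤ c

  comax-1 : ∀ {B} → Comax 1# B
  comax-1 {B} = comax 1# 0# 1ℤ (λ ()) (solve 1 (λ B → one :* one :+ con 0ℤ :* B := one) refl B)

  comax-sym : ∀ {A B} → Comax A B → Comax B A
  comax-sym (comax U V c c≢0 eq) = comax V U c c≢0 (trans (+-comm _ _) eq)

  comax-≈ : ∀ {A A′ B B′} → A ≈ A′ → B ≈ B′ → Comax A B → Comax A′ B′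
  comax-≈ A≈ B≈ (comax U V c c≢0 eq) = comax U V c c≢0 (trans (sym (+-cong (*-congˡ A≈) (*-congˡ B≈))) eq)

  comax-* : ∀ {A A′ B} → Comax A B → Comax A′ B → Comax (A * A′) B
  comax-* {A} {A′} {B} (comax U V c c≢0 eq) (comax U′ V′ c′ c′≢0 eq′) =
    comax (U * U′) (U * A * V′ + V * (U′ * A′ + V′ * B)) (c ℤ.* c′) cc′≢0 (begin
      U * U′ * (A * A′) + (U * A * V′ + V * (U′ * A′ + V′ * B)) * B
        ≈⟨ solve 7 (λ a b B u v x y → u :* x :* (a :* b) :+ (u :* a :* y :+ v :* (x :* b :+ y :* B)) :* B := (u :* a :+ v :* B) :* (x :* b :+ y :* B)) refl A A′ B U V U′ V′ ⟩
      (U * A + V * B) * (U′ * A′ + V′ * B)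
        ≈⟨ *-cong eq eq′ ⟩
      fromℤ c * fromℤ c′
        ≈⟨ fromℤ-* c c′ ⟨
      fromℤ (c ℤ.* c′) ∎)
    where
    cc′≢0 : c ℤ.* c′ ≢ 0ℤ
    cc′≢0 cc′≡0 with ℤₚ.i*j≡0⇒i≡0∨j≡0 c cc′≡0
    ... | inj₁ c≡0  = c≢0 c≡0
    ... | inj₂ c′≡0 = c′≢0 c′≡0

  comax-neg : ∀ {A B} → Comax A B → Comax (- A) B
  comax-neg {A} {B} (comax U V c c≢0 eq) = comax (- U) V c c≢0 (trans (solve 4 (λ a B u v → (:- u) :* (:- a) :+ v :* B := u :* a :+ v :* B) refl A B U V) eq)

  comax-^ : ∀ {A B} k → Comax A B → Comax (A ^ k) B
  comax-^ zero    cm = comax-1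
  comax-^ (suc k) cm = comax-* cm (comax-^ k cm)

  comax-factor : ∀ {A H B} → Comax (A * H) B → Comax A B
  comax-factor {A} {H} {B} (comax U V c c≢0 eq) = comax (U * H) V c c≢0
    (trans (solve 5 (λ a h B u v → u :* h :* a :+ v :* B := u :* (a :* h) :+ v :* B) refl A H B U V) eq)

  comax-+ : ∀ {A B} H → Comax A B → Comax (A + H * B) B
  comax-+ {A} {B} H (comax U V c c≢0 eq) = comax U (V - U * H) c c≢0
    (trans (solve 5 (λ a h B u v → u :* (a :+ h :* B) :+ (v :- u :* h) :* B := u :* a :+ v :* B) refl A H B U V) eq)

-- The ring of fractions

module Fractions (R : CommutativeRing 0ℓ 0ℓ) where
  open CommutativeRing R
  open Sums R
  open RingFacts R using (x-y≈0⇒x≈y; x≈y⇒x-y≈0)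
  open Comaximality R
  open ≈-Reasoning setoid

  record Regular (r : Carrier) : Set where
    constructor regular-by
    field cancel : ∀ {x} → r * x ≈ 0# → x ≈ 0#
  open Regular public

  regular-1 : Regular 1#
  regular-1 .cancel eq = trans (sym (*-identityˡ _)) eq

  regular-* : ∀ {r s} → Regular r → Regular s → Regular (r * s)
  regular-* reg-r reg-s .cancel eq = reg-s .cancel (reg-r .cancel (trans (sym (*-assoc _ _ _)) eq))

  regular-≈ : ∀ {r s} → r ≈ s → Regular r → Regular s
  regular-≈ r≈s reg-r .cancel eq = reg-r .cancel (trans (*-congʳ r≈s) eq)

  regular-cancel : ∀ {r} → Regular r → ∀ {x y} → r * x ≈ r * y → x ≈ y
  regular-cancel {r} reg {x} {y} eq = x-y≈0⇒x≈y (reg .cancel (trans (solve 3 (λ r x y → r :* (x :- y) := r :* x :- r :* y) refl r x y) (x≈y⇒x-y≈0 eq)))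

  -- The regularity proof is what makes equality by cross-multiplication transitive.
  record Fraction : Set where
    constructor fraction
    field
      numer   : Carrier
      denom   : Carrier
      regular : Regular denom
  open Fraction public

  infix 4 _≃_
  record _≃_ (x y : Fraction) : Set where
    constructor cross
    field equality : numer x * denom y ≈ numer y * denom x
  open _≃_ public

  private
    ≃-trans : ∀ {x y z} → x ≃ y → y ≃ z → x ≃ z
    ≃-trans {fraction a b _} {fraction c d reg} {fraction e f _} (cross ad≈cb) (cross cf≈ed) = cross (regular-cancel reg (begin
      d * (a * f) ≈⟨ solve 3 (λ a d f → d :* (a :* f) := a :* d :* f) refl a d f ⟩
      a * d * f ≈⟨ *-congʳ ad≈cb ⟩
      c * b * f ≈⟨ solve 3 (λ c b f → c :* b :* f := c :* f :* b) refl c b f ⟩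
      c * f * b ≈⟨ *-congʳ cf≈ed ⟩
      e * d * b ≈⟨ solve 3 (λ e₀ d b → e₀ :* d :* b := d :* (e₀ :* b)) refl e d b ⟩
      d * (e * b) ∎))

    _⊕_ _⊗_ : Fraction → Fraction → Fraction
    fraction a b rb ⊕ fraction c d rd = fraction (a * d + c * b) (b * d) (regular-* rb rd)
    fraction a b rb ⊗ fraction c d rd = fraction (a * c) (b * d) (regular-* rb rd)

    ⊕-cong : ∀ {x x′ y y′} → x ≃ x′ → y ≃ y′ → x ⊕ y ≃ x′ ⊕ y′
    ⊕-cong {fraction a b _} {fraction a′ b′ _} {fraction c d _} {fraction c′ d′ _} (cross eq) (cross eq′) = cross (begin
      (a * d + c * b) * (b′ * d′) ≈⟨ solve 6 (λ a b c d B D → (a :* d :+ c :* b) :* (B :* D) := a :* B :* (d :* D) :+ c :* D :* (b :* B)) refl a b c d b′ d′ ⟩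
      a * b′ * (d * d′) + c * d′ * (b * b′) ≈⟨ +-cong (*-congʳ eq) (*-congʳ eq′) ⟩
      a′ * b * (d * d′) + c′ * d * (b * b′) ≈⟨ solve 6 (λ A b C d B D → A :* b :* (d :* D) :+ C :* d :* (b :* B) := (A :* D :+ C :* B) :* (b :* d)) refl a′ b c′ d b′ d′ ⟩
      (a′ * d′ + c′ * b′) * (b * d) ∎)

    ⊗-cong : ∀ {x x′ y y′} → x ≃ x′ → y ≃ y′ → x ⊗ y ≃ x′ ⊗ y′
    ⊗-cong {fraction a b _} {fraction a′ b′ _} {fraction c d _} {fraction c′ d′ _} (cross eq) (cross eq′) = cross (begin
      a * c * (b′ * d′) ≈⟨ solve 4 (λ a c B D → a :* c :* (B :* D) := a :* B :* (c :* D)) refl a c b′ d′ ⟩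
      a * b′ * (c * d′) ≈⟨ *-cong eq eq′ ⟩
      a′ * b * (c′ * d) ≈⟨ solve 4 (λ A b C d → A :* b :* (C :* d) := A :* C :* (b :* d)) refl a′ b c′ d ⟩
      a′ * c′ * (b * d) ∎)

  fractionRing : CommutativeRing 0ℓ 0ℓ
  fractionRing = record
    { Carrier = Fraction ; _≈_ = _≃_ ; _+_ = _⊕_ ; _*_ = _⊗_
    ; -_ = λ x → fraction (- numer x) (denom x) (regular x)
    ; 0# = fraction 0# 1# regular-1 ; 1# = fraction 1# 1# regular-1
    ; isCommutativeRing = record
      { isRing = record
        { +-isAbelianGroup = record
          { isGroup = record
            { isMonoid = record
              { isSemigroup = record
                { isMagma = record
                  { isEquivalence = record { refl = cross refl ; sym = λ eq → cross (sym (equality eq)) ; trans = ≃-trans }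
                  ; ∙-cong = ⊕-cong }
                ; assoc = λ { (fraction a b _) (fraction c d _) (fraction f g _) → cross
                    (solve 6 (λ a b c d f g → ((a :* d :+ c :* b) :* g :+ f :* (b :* d)) :* (b :* (d :* g)) := (a :* (d :* g) :+ (c :* g :+ f :* d) :* b) :* (b :* d :* g)) refl a b c d f g) } }
              ; identity = (λ { (fraction a b _) → cross (solve 2 (λ a b → (con 0ℤ :* b :+ a :* one) :* b := a :* (one :* b)) refl a b) })
                         , (λ { (fraction a b _) → cross (solve 2 (λ a b → (a :* one :+ con 0ℤ :* b) :* b := a :* (b :* one)) refl a b) }) }
            ; inverse = (λ { (fraction a b _) → cross (trans (*-congʳ (trans (sym (distribʳ b (- a) a)) (trans (*-congʳ (-‿inverseˡ a)) (zeroˡ b)))) (trans (zeroˡ _) (sym (zeroˡ _)))) })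
                      , (λ { (fraction a b _) → cross (trans (*-congʳ (trans (sym (distribʳ b a (- a))) (trans (*-congʳ (-‿inverseʳ a)) (zeroˡ b)))) (trans (zeroˡ _) (sym (zeroˡ _)))) })
            ; ⁻¹-cong = λ { {fraction a b _} {fraction c d _} (cross eq) → cross (trans (sym (-‿distribˡ-* a d)) (trans (-‿cong eq) (-‿distribˡ-* c b))) } }
          ; comm = λ { (fraction a b _) (fraction c d _) → cross (solve 4 (λ a b c d → (a :* d :+ c :* b) :* (d :* b) := (c :* b :+ a :* d) :* (b :* d)) refl a b c d) } }
        ; *-cong = ⊗-cong
        ; *-assoc = λ { (fraction a b _) (fraction c d _) (fraction f g _) → cross (solve 6 (λ a b c d f g → a :* c :* f :* (b :* (d :* g)) := a :* (c :* f) :* (b :* d :* g)) refl a b c d f g) }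
        ; *-identity = (λ { (fraction a b _) → cross (solve 2 (λ a b → one :* a :* b := a :* (one :* b)) refl a b) })
                     , (λ { (fraction a b _) → cross (solve 2 (λ a b → a :* one :* b := a :* (b :* one)) refl a b) })
        ; distrib = (λ { (fraction f g _) (fraction a b _) (fraction c d _) → cross
                        (solve 6 (λ a b c d f g → f :* (a :* d :+ c :* b) :* (g :* b :* (g :* d)) := (f :* a :* (g :* d) :+ f :* c :* (g :* b)) :* (g :* (b :* d))) refl a b c d f g) })
                  , (λ { (fraction f g _) (fraction a b _) (fraction c d _) → cross
                        (solve 6 (λ a b c d f g → (a :* d :+ c :* b) :* f :* (b :* g :* (d :* g)) := (a :* f :* (d :* g) :+ c :* f :* (b :* g)) :* (b :* d :* g)) refl a b c d f g) })
        }
      ; *-comm = λ { (fraction a b _) (fraction c d _) → cross (solve 4 (λ a b c d → a :* c :* (d :* b) := c :* a :* (b :* d)) refl a b c d) } }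
    }
    where open Algebra.Properties.Ring ring using (-‿distribˡ-*)

  private module K = CommutativeRing fractionRing

  ι : Carrier → Fraction
  ι r = fraction r 1# regular-1

  ι-cong : ∀ {x y} → x ≈ y → ι x ≃ ι y
  ι-cong eq = cross (*-congʳ eq)

  ι-+ : ∀ x y → ι (x + y) ≃ ι x K.+ ι y
  ι-+ x y = cross (solve 2 (λ x y → (x :+ y) :* (one :* one) := (x :* one :+ y :* one) :* one) refl x y)

  ι-* : ∀ x y → ι (x * y) ≃ ι x K.* ι y
  ι-* x y = cross (solve 2 (λ x y → x :* y :* (one :* one) := x :* y :* one) refl x y)

  inverse : ∀ r → Regular r → Fraction
  inverse r reg = fraction 1# r reg

  ι-inverse : ∀ r (reg : Regular r) → ι r K.* inverse r reg ≃ K.1#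
  ι-inverse r reg = cross (solve 1 (λ r → r :* one :* one := one :* (one :* r)) refl r)

-- Localisation and gluing of congruences

-- The localisation of R at P, inside an extension K of R.
module LocalisationAt (R K : CommutativeRing 0ℓ 0ℓ) (ι : CommutativeRing.Carrier R → CommutativeRing.Carrier K) where
  open CommutativeRing R
  open Comaximality R
  open Sums K
  private
    module K = CommutativeRing K
    module RS = Sums R
    module K′ = Algebra.Properties.Ring K.ring
  open ≈-Reasoning K.setoid

  module Extension (ι-cong : ∀ {x y} → x ≈ y → ι x K.≈ ι y) (ι-1 : ι 1# K.≈ K.1#)
    (ι-+ : ∀ x y → ι (x + y) K.≈ ι x K.+ ι y) (ι-* : ∀ x y → ι (x * y) K.≈ ι x K.* ι y)
    where

    ι-0 : ι 0# K.≈ K.0#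
    ι-0 = K′.x+x≈x⇒x≈0 (ι 0#) (K.trans (K.sym (ι-+ 0# 0#)) (ι-cong (+-identityʳ 0#)))

    ι-neg : ∀ x → K.- ι x K.≈ ι (- x)
    ι-neg x = K.sym (K′.+-inverseʳ-unique (ι x) (ι (- x)) (K.trans (K.sym (ι-+ x (- x))) (K.trans (ι-cong (-‿inverseʳ x)) ι-0)))

    ι-- : ∀ x y → ι (x - y) K.≈ ι x K.- ι y
    ι-- x y = K.trans (ι-+ x (- y)) (K.+-congˡ (K.sym (ι-neg y)))

    ι-^ : ∀ x n → ι (x RS.^ n) K.≈ ι x ^ n
    ι-^ x zero    = ι-1
    ι-^ x (suc n) = K.trans (ι-* x (x RS.^ n)) (K.*-congˡ (ι-^ x n))

    ι-Π : ∀ n f → ι (RS.Π< n f) K.≈ Π< n (λ i → ι (f i))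
    ι-Π zero    f = ι-1
    ι-Π (suc n) f = K.trans (ι-* _ _) (K.*-congʳ (ι-Π n f))

    module _ (P : Carrier) where

      record Loc (x : K.Carrier) : Set where
        constructor loc
        field
          N D     : Carrier
          D-comax : Comax D P
          ratio   : x K.* ι D K.≈ ι N

      Loc-ι : ∀ r → Loc (ι r)
      Loc-ι r = loc r 1# comax-1 (K.trans (K.*-congˡ ι-1) (K.*-identityʳ (ι r)))

      abstract
        Loc-subring : Subring K Loc
        Loc-subring = record
          { Loc-≈   = λ x≈y (loc N D cm eq) → loc N D cm (K.trans (K.*-congʳ (K.sym x≈y)) eq)
          ; Loc-1   = loc 1# 1# comax-1 (K.*-identityˡ (ι 1#))
          ; Loc-+   = λ { {x} {y} (loc N D cm eq) (loc N′ D′ cm′ eq′) → loc (N * D′ + N′ * D) (D * D′) (comax-* cm cm′) (begin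
              (x K.+ y) K.* ι (D * D′) ≈⟨ K.*-congˡ (ι-* D D′) ⟩
              (x K.+ y) K.* (ι D K.* ι D′) ≈⟨ solve 4 (λ x y d f → (x :+ y) :* (d :* f) := x :* d :* f :+ y :* f :* d) K.refl x y (ι D) (ι D′) ⟩
              x K.* ι D K.* ι D′ K.+ y K.* ι D′ K.* ι D ≈⟨ K.+-cong (K.*-congʳ eq) (K.*-congʳ eq′) ⟩
              ι N K.* ι D′ K.+ ι N′ K.* ι D ≈⟨ K.+-cong (ι-* N D′) (ι-* N′ D) ⟨
              ι (N * D′) K.+ ι (N′ * D) ≈⟨ ι-+ _ _ ⟨
              ι (N * D′ + N′ * D) ∎) }
          ; Loc-*   = λ { {x} {y} (loc N D cm eq) (loc N′ D′ cm′ eq′) → loc (N * N′) (D * D′) (comax-* cm cm′) (begin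
              x K.* y K.* ι (D * D′) ≈⟨ K.*-congˡ (ι-* D D′) ⟩
              x K.* y K.* (ι D K.* ι D′) ≈⟨ solve 4 (λ x y d f → x :* y :* (d :* f) := x :* d :* (y :* f)) K.refl x y (ι D) (ι D′) ⟩
              x K.* ι D K.* (y K.* ι D′) ≈⟨ K.*-cong eq eq′ ⟩
              ι N K.* ι N′ ≈⟨ ι-* N N′ ⟨
              ι (N * N′) ∎) }
          ; Loc-neg = λ { {x} (loc N D cm eq) → loc (- N) D cm (begin
              K.- x K.* ι D ≈⟨ K′.-‿distribˡ-* x (ι D) ⟨
              K.- (x K.* ι D) ≈⟨ K.-‿cong eq ⟩
              K.- ι N ≈⟨ ι-neg N ⟩
              ι (- N) ∎) }
          }

    -- x ≡ 0 modulo P, in the shape of `CongF` but with coprimality as a Bézout relation.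
    record Cong (x : K.Carrier) (P : Carrier) : Set where
      constructor congruent
      field
        N D     : Carrier
        D-comax : Comax D P
        ratio   : x K.* ι D K.≈ ι (P * N)

    cong-≈ : ∀ {x y P Q} → x K.≈ y → P ≈ Q → Cong x P → Cong y Q
    cong-≈ x≈y P≈Q (congruent N D cm eq) =
      congruent N D (comax-≈ refl P≈Q cm) (K.trans (K.*-congʳ (K.sym x≈y)) (K.trans eq (ι-cong (*-congʳ P≈Q))))

    -- D₁P₂ + D₂P₁ is comaximal with P₁ (being D₁P₂ modulo P₁) and, likewise, with P₂.
    cong-* : ∀ {x P₁ P₂} → Comax P₁ P₂ → Cong x P₁ → Cong x P₂ → Cong x (P₁ * P₂)
    cong-* {x} {P₁} {P₂} cm (congruent N₁ D₁ cm₁ eq₁) (congruent N₂ D₂ cm₂ eq₂) =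
      congruent (N₁ + N₂) (D₁ * P₂ + D₂ * P₁)
        (comax-sym (comax-* (comax-sym (comax-+ D₂ (comax-* cm₁ (comax-sym cm))))
                            (comax-sym (comax-≈ (+-comm _ _) refl (comax-+ D₁ (comax-* cm₂ cm))))))
        (begin
          x K.* ι (D₁ * P₂ + D₂ * P₁) ≈⟨ K.*-congˡ (K.trans (ι-+ _ _) (K.+-cong (ι-* D₁ P₂) (ι-* D₂ P₁))) ⟩
          x K.* (ι D₁ K.* ι P₂ K.+ ι D₂ K.* ι P₁) ≈⟨ solve 5 (λ x d p f r → x :* (d :* p :+ f :* r) := x :* d :* p :+ x :* f :* r) K.refl x (ι D₁) (ι P₂) (ι D₂) (ι P₁) ⟩
          x K.* ι D₁ K.* ι P₂ K.+ x K.* ι D₂ K.* ι P₁ ≈⟨ K.+-cong (K.*-congʳ eq₁) (K.*-congʳ eq₂) ⟩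
          ι (P₁ * N₁) K.* ι P₂ K.+ ι (P₂ * N₂) K.* ι P₁ ≈⟨ K.+-cong (ι-* _ _) (ι-* _ _) ⟨
          ι (P₁ * N₁ * P₂) K.+ ι (P₂ * N₂ * P₁) ≈⟨ ι-+ _ _ ⟨
          ι (P₁ * N₁ * P₂ + P₂ * N₂ * P₁) ≈⟨ ι-cong (RS.solve 4 (λ p r n k → p RS.:* n RS.:* r RS.:+ r RS.:* k RS.:* p RS.:= p RS.:* r RS.:* (n RS.:+ k)) refl P₁ P₂ N₁ N₂) ⟩
          ι (P₁ * P₂ * (N₁ + N₂)) ∎)

-- Power differences and the ideals they generate

module PowerDifferences (R : CommutativeRing 0ℓ 0ℓ) (X : CommutativeRing.Carrier R) where
  open CommutativeRing R
  open Sums R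
  open Comaximality R
  open Algebra.Properties.Semiring.Mult.TCOptimised semiring using (1+×)
  open ≈-Reasoning setoid

  geo : ℕ → Carrier → Carrier
  geo zero    y = 0#
  geo (suc s) y = 1# + y * geo s y

  geo-sum : ∀ s y → (1# - y) * geo s y ≈ 1# - y ^ s
  geo-sum zero    y = trans (zeroʳ _) (sym (-‿inverseʳ 1#))
  geo-sum (suc s) y = begin
    (1# - y) * (1# + y * geo s y) ≈⟨ solve 2 (λ y g → (one :- y) :* (one :+ y :* g) := one :- y :+ y :* ((one :- y) :* g)) refl y (geo s y) ⟩
    1# - y + y * ((1# - y) * geo s y) ≈⟨ +-congˡ (*-congˡ (geo-sum s y)) ⟩
    1# - y + y * (1# - y ^ s) ≈⟨ solve 2 (λ y z → one :- y :+ y :* (one :- z) := one :- y :* z) refl y (y ^ s) ⟩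
    1# - y * y ^ s ∎

  -- Modulo 1 - y each of the s summands is 1.
  geo-remainder : ∀ s y → ∃ λ V → 1# * geo s y + V * (1# - y) ≈ fromℤ (+ s)
  geo-remainder zero    y = 0# , solve 1 (λ y → one :* con 0ℤ :+ con 0ℤ :* (one :- y) := con 0ℤ) refl y
  geo-remainder (suc s) y with geo-remainder s y
  ... | V , eq = geo s y + V , (begin
    1# * (1# + y * geo s y) + (geo s y + V) * (1# - y) ≈⟨ solve 3 (λ y g v → one :* (one :+ y :* g) :+ (g :+ v) :* (one :- y) := one :+ (one :* g :+ v :* (one :- y))) refl y (geo s y) V ⟩
    1# + (1# * geo s y + V * (1# - y)) ≈⟨ +-congˡ eq ⟩
    1# + fromℤ (+ s) ≈⟨ 1+× s 1# ⟨
    fromℤ (+ suc s) ∎)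

  comax-geo : ∀ s y → s ≢ 0 → Comax (geo s y) (1# - y)
  comax-geo s y s≢0 with geo-remainder s y
  ... | V , eq = comax 1# V (+ s) (λ eq → s≢0 (ℤₚ.+-injective eq)) eq

  module _ (m : ℕ) (P : Carrier) where

    private
      -- The exponents a for which 1 - X^a lies in the ideal generated by 1 - X^m and P. They are
      -- closed under addition and cancellation, hence under greatest common divisors.
      In : ℕ → Set
      In a = ∃ λ U → ∃ λ V → 1# - X ^ a ≈ U * (1# - X ^ m) + V * P

      in-+ : ∀ a b → In a → In b → In (a ℕ.+ b)
      in-+ a b (U , V , eq) (U′ , V′ , eq′) = U + X ^ a * U′ , V + X ^ a * V′ , (begin
        1# - X ^ (a ℕ.+ b) ≈⟨ +-congˡ (-‿cong (^-homo-* X a b)) ⟩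
        1# - X ^ a * X ^ b ≈⟨ solve 2 (λ x y → one :- x :* y := one :- x :+ x :* (one :- y)) refl (X ^ a) (X ^ b) ⟩
        1# - X ^ a + X ^ a * (1# - X ^ b) ≈⟨ +-cong eq (*-congˡ eq′) ⟩
        U * M + V * P + X ^ a * (U′ * M + V′ * P) ≈⟨ solve 7 (λ x u v a b m p → u :* m :+ v :* p :+ x :* (a :* m :+ b :* p) := (u :+ x :* a) :* m :+ (v :+ x :* b) :* p) refl (X ^ a) U V U′ V′ M P ⟩
        (U + X ^ a * U′) * M + (V + X ^ a * V′) * P ∎)
        where
        M : Carrier
        M = 1# - X ^ m

      in-* : ∀ k {a} → In a → In (k ℕ.* a)
      in-* zero    _  = 0# , 0# , solve 2 (λ m p → one :- one := con 0ℤ :* m :+ con 0ℤ :* p) refl (1# - X ^ m) P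
      in-* (suc k) {a} Ia = in-+ a (k ℕ.* a) Ia (in-* k Ia)

      -- 1 − X^a lies in the ideal, so X^a is invertible modulo it and can be cancelled from X^a (1 − X^b).
      in-∸ : ∀ a b → In a → In (a ℕ.+ b) → In b
      in-∸ a b (U , V , eq) (U′ , V′ , eq′) = (1# - y) * U + U′ - U , (1# - y) * V + V′ - V , (begin
        1# - y ≈⟨ solve 2 (λ x y → one :- y := (one :- y) :* (one :- x) :+ (one :- x :* y) :- (one :- x)) refl x y ⟩
        (1# - y) * (1# - x) + (1# - x * y) - (1# - x) ≈⟨ +-cong (+-cong (*-congˡ eq) (trans (+-congˡ (-‿cong (sym (^-homo-* X a b)))) eq′)) (-‿cong eq) ⟩
        (1# - y) * (U * M + V * P) + (U′ * M + V′ * P) - (U * M + V * P)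
          ≈⟨ solve 7 (λ y u v a b m p → (one :- y) :* (u :* m :+ v :* p) :+ (a :* m :+ b :* p) :- (u :* m :+ v :* p) := ((one :- y) :* u :+ a :- u) :* m :+ ((one :- y) :* v :+ b :- v) :* p) refl y U V U′ V′ M P ⟩
        ((1# - y) * U + U′ - U) * M + ((1# - y) * V + V′ - V) * P ∎)
        where
        M x y : Carrier
        M = 1# - X ^ m
        x = X ^ a
        y = X ^ b

      in-m : In m
      in-m = 1# , 0# , solve 2 (λ m p → m := one :* m :+ con 0ℤ :* p) refl (1# - X ^ m) P

      in-gcd : ∀ d → In d → In (gcd m d)
      in-gcd d Id with Bézout.identity (gcd-GCD m d)
      ... | Bézout.+- x y eq = in-∸ (y ℕ.* d) (gcd m d) (in-* y Id) (≡.subst In (≡.trans (≡.sym eq) (ℕₚ.+-comm (gcd m d) (y ℕ.* d))) (in-* x in-m))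
      ... | Bézout.-+ x y eq = in-∸ (x ℕ.* m) (gcd m d) (in-* x in-m) (≡.subst In (≡.trans (≡.sym eq) (ℕₚ.+-comm (gcd m d) (x ℕ.* m))) (in-* y Id))

    -- Since P divides 1 - X^d, the ideal (1 - X^m, P) contains 1 - X^d and therefore 1 - X^gcd.
    -- Substituting that expression into the given Bézout relation yields the new one.
    comax-gcd : ∀ d H → P * H ≈ 1# - X ^ d → Comax P (1# - X ^ gcd m d) → Comax P (1# - X ^ m)
    comax-gcd d H PH (comax U V c c≢0 eq) with in-gcd d (0# , H , trans (sym PH) (solve 3 (λ m p h → p :* h := con 0ℤ :* m :+ h :* p) refl (1# - X ^ m) P H))
    ... | U′ , V′ , eq′ = comax (U + V * V′) (V * U′) c c≢0 (begin
      (U + V * V′) * P + V * U′ * (1# - X ^ m) ≈⟨ solve 6 (λ u v a b m p → (u :+ v :* b) :* p :+ v :* a :* m := u :* p :+ v :* (a :* m :+ b :* p)) refl U V U′ V′ (1# - X ^ m) P ⟩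
      U * P + V * (U′ * (1# - X ^ m) + V′ * P) ≈⟨ +-congˡ (*-congˡ eq′) ⟨
      U * P + V * (1# - X ^ gcd m d) ≈⟨ eq ⟩
      fromℤ c ∎)

  power-difference : ∀ a b → X ^ a - X ^ b ≈ X ^ a * (1# - X ^ ℕ.∣ a - b ∣) ⊎ X ^ a - X ^ b ≈ - X ^ b * (1# - X ^ ℕ.∣ a - b ∣)
  power-difference a b with ℕₚ.≤-total a b
  ... | inj₁ a≤b = inj₁ (begin
    X ^ a - X ^ b ≡⟨ ≡.cong (λ k → X ^ a - X ^ k) (≡.trans (≡.cong (a ℕ.+_) (ℕₚ.m≤n⇒∣m-n∣≡n∸m a≤b)) (ℕₚ.m+[n∸m]≡n a≤b)) ⟨
    X ^ a - X ^ (a ℕ.+ ℕ.∣ a - b ∣) ≈⟨ +-congˡ (-‿cong (^-homo-* X a ℕ.∣ a - b ∣)) ⟩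
    X ^ a - X ^ a * X ^ ℕ.∣ a - b ∣ ≈⟨ solve 2 (λ x y → x :- x :* y := x :* (one :- y)) refl (X ^ a) (X ^ ℕ.∣ a - b ∣) ⟩
    X ^ a * (1# - X ^ ℕ.∣ a - b ∣) ∎)
  ... | inj₂ b≤a = inj₂ (begin
    X ^ a - X ^ b ≡⟨ ≡.cong (λ k → X ^ k - X ^ b) (≡.trans (≡.cong (b ℕ.+_) (ℕₚ.m≤n⇒∣n-m∣≡n∸m b≤a)) (ℕₚ.m+[n∸m]≡n b≤a)) ⟨
    X ^ (b ℕ.+ ℕ.∣ a - b ∣) - X ^ b ≈⟨ +-congʳ (^-homo-* X b ℕ.∣ a - b ∣) ⟩
    X ^ b * X ^ ℕ.∣ a - b ∣ - X ^ b ≈⟨ solve 2 (λ x y → x :* y :- x := (:- x) :* (one :- y)) refl (X ^ b) (X ^ ℕ.∣ a - b ∣) ⟩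
    - X ^ b * (1# - X ^ ℕ.∣ a - b ∣) ∎)

-- Cyclotomic factors of Xⁿ - 1

module Cyclotomic (R : CommutativeRing 0ℓ 0ℓ) (X : CommutativeRing.Carrier R) (Φ : ℕ → CommutativeRing.Carrier R) where
  open CommutativeRing R
  open Sums R
  open RingFacts R
  open Comaximality R
  open Fractions R using (Regular; regular-cancel)
  open PowerDifferences R X
  open Algebra.Properties.Ring ring using (-‿distribʳ-*)
  open ≈-Reasoning setoid

  -- Turns a product over divisors into one over an initial segment of ℕ; for n > 0 the index 0 is
  -- no divisor and contributes 1.
  χ : ℕ → ℕ → Carrier
  χ n e = if does (e ∣? n) then Φ e else 1#

  χ-yes : ∀ {n e} → e ∣ n → χ n e ≡ Φ e
  χ-yes {n} {e} e∣n with e ∣? n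
  ... | yes _   = ≡.refl
  ... | no  e∤n = contradiction e∣n e∤n

  χ-no : ∀ {n e} → ¬ e ∣ n → χ n e ≡ 1#
  χ-no {n} {e} e∤n with e ∣? n
  ... | yes e∣n = contradiction e∣n e∤n
  ... | no  _   = ≡.refl

  Factorises : ℕ → Set
  Factorises n = Φ n * Π< n (χ n) ≈ X ^ n - 1#

  Φ∣1-X^ : ∀ n → Factorises n → Φ n * (- Π< n (χ n)) ≈ 1# - X ^ n
  Φ∣1-X^ n eq = begin
    Φ n * - Π< n (χ n) ≈⟨ -‿distribʳ-* _ _ ⟨
    - (Φ n * Π< n (χ n)) ≈⟨ -‿cong eq ⟩
    - (X ^ n - 1#) ≈⟨ solve 1 (λ x → (:- (x :- one)) := one :- x) refl (X ^ n) ⟩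
    1# - X ^ n ∎

  module WithRegular (regular-1-X^ : ∀ g → Regular (1# - X ^ suc g)) where

    -- The divisors of `suc g` are among the proper divisors of n, and their factors multiply to
    -- X^(g+1) - 1; the remaining factors form ψ.
    Π<-divisors : ∀ {g n} → suc g < n → suc g ∣ n → Factorises (suc g) → ∃ λ ψ → Π< n (χ n) ≈ (X ^ suc g - 1#) * ψ
    Π<-divisors {g} {n} g<n g∣n fact = Π< n ψ , (begin
      Π< n (χ n) ≈⟨ Π<-cong n split ⟩
      Π< n (λ e → χ g′ e * ψ e) ≈⟨ Π<-* n (χ g′) ψ ⟩
      Π< n (χ g′) * Π< n ψ ≈⟨ *-congʳ (begin
        Π< n (χ g′) ≡⟨ ≡.cong (λ k → Π< k (χ g′)) (ℕₚ.m+[n∸m]≡n g<n) ⟨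
        Π< (suc g′ ℕ.+ (n ∸ suc g′)) (χ g′) ≈⟨ Π<-+ (suc g′) (n ∸ suc g′) (χ g′) ⟩
        Π< g′ (χ g′) * χ g′ g′ * Π< (n ∸ suc g′) (λ i → χ g′ (suc g′ ℕ.+ i))
          ≈⟨ *-cong (*-congˡ (reflexive (χ-yes {g′} ∣-refl))) (tail (n ∸ suc g′)) ⟩
        Π< g′ (χ g′) * Φ g′ * 1# ≈⟨ trans (*-identityʳ _) (*-comm _ _) ⟩
        Φ g′ * Π< g′ (χ g′) ≈⟨ fact ⟩
        X ^ g′ - 1# ∎) ⟩
      (X ^ g′ - 1#) * Π< n ψ ∎)
      where
      g′ : ℕ
      g′ = suc g
      ψ : ℕ → Carrier
      ψ e = if does (e ∣? g′) then 1# else χ n e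
      split : ∀ e → χ n e ≈ χ g′ e * ψ e
      split e with e ∣? g′
      ... | yes e∣g = trans (reflexive (χ-yes (∣-trans e∣g g∣n))) (sym (*-identityʳ _))
      ... | no  _   = sym (*-identityˡ _)
      tail : ∀ k → Π< k (λ i → χ g′ (suc g′ ℕ.+ i)) ≈ 1#
      tail zero    = refl
      tail (suc k) = trans (*-cong (tail k) (reflexive (χ-no λ e∣g → ℕₚ.<⇒≱ (s≤s (ℕₚ.m≤m+n g′ k)) (∣⇒≤ e∣g)))) (*-identityʳ _)

    -- Let g = gcd(m, d), a proper divisor of d. Then Φ d divides (1 - X^d)/(1 - X^g) =
    -- `geo s (X ^ g)`, which is s modulo 1 - X^g. So Φ d is coprime to 1 - X^g, and `comax-gcd`
    -- passes to 1 - X^m.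
    comax-Φ : ∀ d → (∀ k → suc k ≤ d → Factorises (suc k)) → ∀ m → 0 < d → ¬ d ∣ m → Comax (Φ d) (1# - X ^ m)
    comax-Φ (suc d) fact m 0<d d∤m with gcd m (suc d) in gcd≡ | gcd[m,n]∣m m (suc d) | gcd[m,n]∣n m (suc d)
    ... | zero  | _   | 0∣d = contradiction (0∣⇒≡0 0∣d) λ ()
    ... | suc g | g∣m | divides s d≡sg = comax-gcd m (Φ (suc d)) (suc d) _ (Φ∣1-X^ (suc d) (fact d ℕₚ.≤-refl))
        (≡.subst (λ k → Comax (Φ (suc d)) (1# - X ^ k)) (≡.sym gcd≡) (comax-factor (comax-≈ geo≈ refl (comax-geo s (X ^ suc g) s≢0))))
      where
      s≢0 : s ≢ 0
      s≢0 ≡.refl = contradiction d≡sg λ ()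
      g∣d : suc g ∣ suc d
      g∣d = divides s d≡sg
      g<d : suc g < suc d
      g<d = ℕₚ.≤∧≢⇒< (∣⇒≤ g∣d) λ g≡d → d∤m (≡.subst (_∣ m) g≡d g∣m)
      ψ : Carrier
      ψ = proj₁ (Π<-divisors g<d g∣d (fact g (ℕₚ.<⇒≤ g<d)))
      geo≈ : geo s (X ^ suc g) ≈ Φ (suc d) * ψ
      geo≈ = regular-cancel (regular-1-X^ g) (begin
        (1# - X ^ suc g) * geo s (X ^ suc g) ≈⟨ geo-sum s (X ^ suc g) ⟩
        1# - (X ^ suc g) ^ s ≈⟨ +-congˡ (-‿cong (trans (^-assocʳ X (suc g) s) (^-congʳ X (≡.trans (ℕₚ.*-comm (suc g) s) (≡.sym d≡sg))))) ⟩
        1# - X ^ suc d ≈⟨ Φ∣1-X^ (suc d) (fact d ℕₚ.≤-refl) ⟨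
        Φ (suc d) * - Π< (suc d) (χ (suc d)) ≈⟨ *-congˡ (-‿cong (proj₂ (Π<-divisors g<d g∣d (fact g (ℕₚ.<⇒≤ g<d))))) ⟩
        Φ (suc d) * - ((X ^ suc g - 1#) * ψ) ≈⟨ solve 3 (λ f x p → f :* (:- ((x :- one) :* p)) := (one :- x) :* (f :* p)) refl (Φ (suc d)) (X ^ suc g) ψ ⟩
        (1# - X ^ suc g) * (Φ (suc d) * ψ) ∎)

    comax-ΦΦ : ∀ {d e} → (∀ k → suc k ≤ e → Factorises (suc k)) → 0 < d → d < e → Comax (Φ d) (Φ e)
    comax-ΦΦ {suc d} {e} fact _ d<e = comax-factor (comax-≈ (sym (Φ∣1-X^ (suc d) (fact d (ℕₚ.<⇒≤ d<e)))) refl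
      (comax-sym (comax-Φ e fact (suc d) (ℕₚ.≤-<-trans z≤n d<e) λ e∣d → ℕₚ.<⇒≱ d<e (∣⇒≤ e∣d))))

    -- Pairwise coprime divisors have a product that divides, here up to an integer because
    -- coprimality holds only over ℚ. Only product formulas below n enter, so this can serve in the
    -- induction that establishes the one at n.
    product-divides : ∀ n → 0 < n → (∀ k → suc k < n → Factorises (suc k)) →
                      ∃ λ c → c ≢ 0ℤ × ∃ λ H → Π< n (χ n) * H ≈ fromℤ c * (X ^ n - 1#)
    product-divides n 0<n fact = go n ℕₚ.≤-refl
      where
      P : Carrier
      P = X ^ n - 1#

      0∤n : ¬ 0 ∣ n
      0∤n 0∣n = ℕₚ.<⇒≢ 0<n (≡.sym (0∣⇒≡0 0∣n))

      comax-Π : ∀ b {e} → b ≤ e → e < n → Comax (Π< b (χ n)) (Φ e)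
      comax-Π zero    b≤e e<n = comax-1
      comax-Π (suc b) {e} b<e e<n with b ∣? n
      ... | no  _   = comax-* (comax-Π b (ℕₚ.<⇒≤ b<e) e<n) comax-1
      ... | yes b∣n = comax-* (comax-Π b (ℕₚ.<⇒≤ b<e) e<n)
            (comax-ΦΦ (λ k k≤e → fact k (ℕₚ.≤-<-trans k≤e e<n)) (ℕₚ.n≢0⇒n>0 λ b≡0 → 0∤n (≡.subst (_∣ n) b≡0 b∣n)) b<e)

      Φ∣P : ∀ b → b < n → b ∣ n → ∃ λ H → Φ b * H ≈ P
      Φ∣P zero    _   0∣n = contradiction 0∣n 0∤n
      Φ∣P (suc b) b<n (divides s n≡sb) = Π< (suc b) (χ (suc b)) * geo s (X ^ suc b) , (begin
        Φ (suc b) * (Π< (suc b) (χ (suc b)) * geo s (X ^ suc b)) ≈⟨ *-assoc _ _ _ ⟨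
        Φ (suc b) * Π< (suc b) (χ (suc b)) * geo s (X ^ suc b) ≈⟨ *-congʳ (fact b b<n) ⟩
        (X ^ suc b - 1#) * geo s (X ^ suc b) ≈⟨ solve 2 (λ x g → (x :- one) :* g := con 0ℤ :- (one :- x) :* g) refl (X ^ suc b) (geo s (X ^ suc b)) ⟩
        0# - (1# - X ^ suc b) * geo s (X ^ suc b) ≈⟨ +-congˡ (-‿cong (geo-sum s (X ^ suc b))) ⟩
        0# - (1# - (X ^ suc b) ^ s) ≈⟨ solve 1 (λ x → con 0ℤ :- (one :- x) := x :- one) refl ((X ^ suc b) ^ s) ⟩
        (X ^ suc b) ^ s - 1# ≈⟨ +-congʳ (trans (^-assocʳ X (suc b) s) (^-congʳ X (≡.trans (ℕₚ.*-comm (suc b) s) (≡.sym n≡sb)))) ⟩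
        P ∎)

      go : ∀ b → b ≤ n → ∃ λ c → c ≢ 0ℤ × ∃ λ H → Π< b (χ n) * H ≈ fromℤ c * P
      go zero    _   = 1ℤ , (λ ()) , P , refl
      go (suc b) b<n with b ∣? n | go b (ℕₚ.<⇒≤ b<n)
      ... | no  _   | c , c≢0 , H , eq = c , c≢0 , H , trans (*-congʳ (*-identityʳ _)) eq
      ... | yes b∣n | c , c≢0 , H , eq with comax-Π b ℕₚ.≤-refl b<n | Φ∣P b b<n b∣n
      -- From U A + V B = c′, A H = c P and B H′ = P: multiplying c P by the first relation exhibits
      -- A B as a divisor of c′ c P.
      ... | comax U V c′ c′≢0 eq′ | H′ , eq″ = c′ ℤ.* c , cc′≢0 , U * fromℤ c * H′ + V * H , (begin
        A * B * (U * fromℤ c * H′ + V * H) ≈⟨ solve 7 (λ a b u v c h k → a :* b :* (u :* c :* k :+ v :* h) := u :* a :* c :* (b :* k) :+ v :* b :* (a :* h)) refl A B U V (fromℤ c) H H′ ⟩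
        U * A * fromℤ c * (B * H′) + V * B * (A * H) ≈⟨ +-cong (*-congˡ eq″) (*-congˡ eq) ⟩
        U * A * fromℤ c * P + V * B * (fromℤ c * P) ≈⟨ solve 6 (λ a b u v c p → u :* a :* c :* p :+ v :* b :* (c :* p) := (u :* a :+ v :* b) :* c :* p) refl A B U V (fromℤ c) P ⟩
        (U * A + V * B) * fromℤ c * P ≈⟨ *-congʳ (trans (*-congʳ eq′) (sym (fromℤ-* c′ c))) ⟩
        fromℤ (c′ ℤ.* c) * P ∎)
        where
        A B : Carrier
        A = Π< b (χ n)
        B = Φ b
        cc′≢0 : c′ ℤ.* c ≢ 0ℤ
        cc′≢0 eq with ℤₚ.i*j≡0⇒i≡0∨j≡0 c′ eq
        ... | inj₁ c′≡0 = c′≢0 c′≡0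
        ... | inj₂ c≡0  = c≢0 c≡0

-- The polynomial ring on coefficient lists

coef : Poly → ℕ → ℤ
coef []      _       = 0ℤ
coef (a ∷ p) zero    = a
coef (a ∷ p) (suc i) = coef p i

infix 4 _≐_
-- Equivalent to `_≈P_` and blind to trailing zeros; a record, so that p and q can be inferred from
-- a proof.
record _≐_ (p q : Poly) : Set where
  constructor pointwise
  field at : ∀ i → coef p i ≡ coef q i
open _≐_ public

IsZeroP⇒coef : ∀ {p} → IsZeroP p → ∀ i → coef p i ≡ 0ℤ
IsZeroP⇒coef []       i       = ≡.refl
IsZeroP⇒coef (eq ∷ _) zero    = eq
IsZeroP⇒coef (_ ∷ p)  (suc i) = IsZeroP⇒coef p i

coef⇒IsZeroP : ∀ p → (∀ i → coef p i ≡ 0ℤ) → IsZeroP p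
coef⇒IsZeroP []      eq = []
coef⇒IsZeroP (a ∷ p) eq = eq 0 ∷ coef⇒IsZeroP p (λ i → eq (suc i))

coef-+ : ∀ p q i → coef (p +P q) i ≡ coef p i ℤ.+ coef q i
coef-+ []      q       i       = ≡.sym (ℤₚ.+-identityˡ _)
coef-+ (a ∷ p) []      i       = ≡.sym (ℤₚ.+-identityʳ _)
coef-+ (a ∷ p) (b ∷ q) zero    = ≡.refl
coef-+ (a ∷ p) (b ∷ q) (suc i) = coef-+ p q i

coef-neg : ∀ p i → coef (negP p) i ≡ ℤ.- coef p i
coef-neg []      i       = ≡.refl
coef-neg (a ∷ p) zero    = ≡.refl
coef-neg (a ∷ p) (suc i) = coef-neg p i

coef-scale : ∀ c p i → coef (scaleP c p) i ≡ c ℤ.* coef p i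
coef-scale c []      i       = ≡.sym (ℤₚ.*-zeroʳ c)
coef-scale c (a ∷ p) zero    = ≡.refl
coef-scale c (a ∷ p) (suc i) = coef-scale c p i

coef-- : ∀ p q i → coef (p -P q) i ≡ coef p i ℤ.- coef q i
coef-- p q i = ≡.trans (coef-+ p (negP q) i) (≡.cong₂ ℤ._+_ (≡.refl {x = coef p i}) (coef-neg q i))

≈P⇒≐ : ∀ {p q} → p ≈P q → p ≐ q
≈P⇒≐ {p} {q} eq .at i = ℤₚ.i-j≡0⇒i≡j (coef p i) (coef q i) (≡.trans (≡.sym (coef-- p q i)) (IsZeroP⇒coef eq i))

≐⇒≈P : ∀ {p q} → p ≐ q → p ≈P q
≐⇒≈P {p} {q} eq = coef⇒IsZeroP (p -P q) λ i → ≡.trans (coef-- p q i) (ℤₚ.i≡j⇒i-j≡0 (eq .at i))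

≐-refl : ∀ {p} → p ≐ p
≐-refl .at i = ≡.refl

≐-sym : ∀ {p q} → p ≐ q → q ≐ p
≐-sym eq .at i = ≡.sym (eq .at i)

≐-trans : ∀ {p q r} → p ≐ q → q ≐ r → p ≐ r
≐-trans eq eq′ .at i = ≡.trans (eq .at i) (eq′ .at i)

∷-cong : ∀ {a b p q} → a ≡ b → p ≐ q → a ∷ p ≐ b ∷ q
∷-cong a≡b p≐q .at zero    = a≡b
∷-cong a≡b p≐q .at (suc i) = p≐q .at i

0∷[] : 0ℤ ∷ [] ≐ []
0∷[] .at zero    = ≡.refl
0∷[] .at (suc i) = ≡.refl

+P-cong : ∀ {p p′ q q′} → p ≐ p′ → q ≐ q′ → p +P q ≐ p′ +P q′
+P-cong {p} {p′} {q} {q′} eq eq′ .at i =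
  ≡.trans (coef-+ p q i) (≡.trans (≡.cong₂ ℤ._+_ (eq .at i) (eq′ .at i)) (≡.sym (coef-+ p′ q′ i)))

+P-assoc : ∀ p q r → (p +P q) +P r ≐ p +P (q +P r)
+P-assoc p q r .at i
  rewrite coef-+ (p +P q) r i | coef-+ p q i | coef-+ p (q +P r) i | coef-+ q r i = ℤₚ.+-assoc (coef p i) (coef q i) (coef r i)

+P-comm : ∀ p q → p +P q ≐ q +P p
+P-comm p q .at i rewrite coef-+ p q i | coef-+ q p i = ℤₚ.+-comm (coef p i) (coef q i)

+P-identityʳ : ∀ p → p +P [] ≐ p
+P-identityʳ p .at i = ≡.trans (coef-+ p [] i) (ℤₚ.+-identityʳ _)

negP-cong : ∀ {p q} → p ≐ q → negP p ≐ negP q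
negP-cong {p} {q} eq .at i = ≡.trans (coef-neg p i) (≡.trans (≡.cong ℤ.-_ (eq .at i)) (≡.sym (coef-neg q i)))

-P-inverseʳ : ∀ p → p +P negP p ≐ []
-P-inverseʳ p .at i = ≡.trans (coef-- p p i) (ℤₚ.i≡j⇒i-j≡0 {coef p i} ≡.refl)

scaleP-cong : ∀ c {p q} → p ≐ q → scaleP c p ≐ scaleP c q
scaleP-cong c {p} {q} eq .at i = ≡.trans (coef-scale c p i) (≡.trans (≡.cong (c ℤ.*_) (eq .at i)) (≡.sym (coef-scale c q i)))

scaleP-+ : ∀ a b p → scaleP (a ℤ.+ b) p ≐ scaleP a p +P scaleP b p
scaleP-+ a b p .at i
  rewrite coef-scale (a ℤ.+ b) p i | coef-+ (scaleP a p) (scaleP b p) i | coef-scale a p i | coef-scale b p i = ℤₚ.*-distribʳ-+ (coef p i) a b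

scaleP-+P : ∀ c p q → scaleP c (p +P q) ≐ scaleP c p +P scaleP c q
scaleP-+P c p q .at i
  rewrite coef-scale c (p +P q) i | coef-+ p q i | coef-+ (scaleP c p) (scaleP c q) i | coef-scale c p i | coef-scale c q i = ℤₚ.*-distribˡ-+ c (coef p i) (coef q i)

scaleP-scaleP : ∀ a b p → scaleP a (scaleP b p) ≐ scaleP (a ℤ.* b) p
scaleP-scaleP a b p .at i
  rewrite coef-scale a (scaleP b p) i | coef-scale b p i | coef-scale (a ℤ.* b) p i = ≡.sym (ℤₚ.*-assoc a b (coef p i))

scaleP-0 : ∀ p → scaleP 0ℤ p ≐ []
scaleP-0 p .at i = ≡.trans (coef-scale 0ℤ p i) (ℤₚ.*-zeroˡ (coef p i))

scaleP-1 : ∀ p → scaleP 1ℤ p ≐ p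
scaleP-1 p .at i = ≡.trans (coef-scale 1ℤ p i) (ℤₚ.*-identityˡ (coef p i))

scaleP-∷ : ∀ c p → scaleP c (0ℤ ∷ p) ≐ 0ℤ ∷ scaleP c p
scaleP-∷ c p = ∷-cong (ℤₚ.*-zeroʳ c) ≐-refl

+P-interchange : ∀ p q r s → (p +P q) +P (r +P s) ≐ (p +P r) +P (q +P s)
+P-interchange p q r s .at i
  rewrite coef-+ (p +P q) (r +P s) i | coef-+ p q i | coef-+ r s i | coef-+ (p +P r) (q +P s) i | coef-+ p r i | coef-+ q s i
  = eq (coef p i) (coef q i) (coef r i) (coef s i)
  where
  eq : ∀ a b c d → a ℤ.+ b ℤ.+ (c ℤ.+ d) ≡ a ℤ.+ c ℤ.+ (b ℤ.+ d)
  eq = ℤ-solver.solve-∀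

*P-congʳ : ∀ p {q q′} → q ≐ q′ → p *P q ≐ p *P q′
*P-congʳ []      eq = ≐-refl
*P-congʳ (a ∷ p) eq = +P-cong (scaleP-cong a eq) (∷-cong ≡.refl (*P-congʳ p eq))

*P-zeroʳ : ∀ p → p *P [] ≐ []
*P-zeroʳ []      = ≐-refl
*P-zeroʳ (a ∷ p) = ≐-trans (∷-cong ≡.refl (*P-zeroʳ p)) 0∷[]

*P-∷ : ∀ p b q → p *P (b ∷ q) ≐ scaleP b p +P (0ℤ ∷ p *P q)
*P-∷ []      b q = ≐-sym 0∷[]
*P-∷ (a ∷ p) b q = ≐-trans (∷-cong (≡.cong (ℤ._+ 0ℤ) (ℤₚ.*-comm a b)) (+P-cong (≐-refl {scaleP a q}) (*P-∷ p b q))) (∷-cong ≡.refl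
  (≐-trans (≐-sym (+P-assoc (scaleP a q) (scaleP b p) (0ℤ ∷ p *P q)))
  (≐-trans (+P-cong (+P-comm (scaleP a q) (scaleP b p)) ≐-refl) (+P-assoc (scaleP b p) (scaleP a q) (0ℤ ∷ p *P q)))))

*P-comm : ∀ p q → p *P q ≐ q *P p
*P-comm []      q = ≐-sym (*P-zeroʳ q)
*P-comm (a ∷ p) q = ≐-trans (+P-cong (≐-refl {scaleP a q}) (∷-cong ≡.refl (*P-comm p q))) (≐-sym (*P-∷ q a p))

*P-cong : ∀ {p p′ q q′} → p ≐ p′ → q ≐ q′ → p *P q ≐ p′ *P q′
*P-cong {p} {p′} {q} {q′} eq eq′ =
  ≐-trans (*P-congʳ p eq′) (≐-trans (*P-comm p q′) (≐-trans (*P-congʳ q′ eq) (*P-comm q′ p′)))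

*P-distribʳ : ∀ r p q → (p +P q) *P r ≐ p *P r +P q *P r
*P-distribʳ r []      q       = ≐-refl
*P-distribʳ r (a ∷ p) []      = ≐-sym (+P-identityʳ ((a ∷ p) *P r))
*P-distribʳ r (a ∷ p) (b ∷ q) = ≐-trans (+P-cong (scaleP-+ a b r) (∷-cong ≡.refl (*P-distribʳ r p q)))
  (+P-interchange (scaleP a r) (scaleP b r) (0ℤ ∷ p *P r) (0ℤ ∷ q *P r))

scaleP-*P : ∀ c p q → scaleP c p *P q ≐ scaleP c (p *P q)
scaleP-*P c []      q = ≐-refl
scaleP-*P c (a ∷ p) q = ≐-trans (+P-cong (≐-sym (scaleP-scaleP c a q)) (≐-trans (∷-cong ≡.refl (scaleP-*P c p q)) (≐-sym (scaleP-∷ c (p *P q)))))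
  (≐-sym (scaleP-+P c (scaleP a q) (0ℤ ∷ p *P q)))

0∷-*P : ∀ p q → (0ℤ ∷ p) *P q ≐ 0ℤ ∷ p *P q
0∷-*P p q = +P-cong (scaleP-0 q) ≐-refl

*P-assoc : ∀ p q r → (p *P q) *P r ≐ p *P (q *P r)
*P-assoc []      q r = ≐-refl
*P-assoc (a ∷ p) q r = ≐-trans (*P-distribʳ r (scaleP a q) (0ℤ ∷ p *P q))
  (+P-cong (scaleP-*P a q r) (≐-trans (0∷-*P (p *P q) r) (∷-cong ≡.refl (*P-assoc p q r))))

*P-identityˡ : ∀ p → oneP *P p ≐ p
*P-identityˡ p = ≐-trans (+P-cong (scaleP-1 p) 0∷[]) (+P-identityʳ p)

polyRing : CommutativeRing 0ℓ 0ℓ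
polyRing = record
  { Carrier = Poly ; _≈_ = _≐_ ; _+_ = _+P_ ; _*_ = _*P_ ; -_ = negP ; 0# = [] ; 1# = oneP
  ; isCommutativeRing = record
    { isRing = record
      { +-isAbelianGroup = record
        { isGroup = record
          { isMonoid = record
            { isSemigroup = record
              { isMagma = record
                { isEquivalence = record { refl = ≐-refl ; sym = ≐-sym ; trans = ≐-trans }
                ; ∙-cong = +P-cong }
              ; assoc = +P-assoc }
            ; identity = (λ _ → ≐-refl) , +P-identityʳ }
          ; inverse = (λ p → ≐-trans (+P-comm (negP p) p) (-P-inverseʳ p)) , -P-inverseʳ
          ; ⁻¹-cong = negP-cong }
        ; comm = +P-comm }
      ; *-cong = *P-cong
      ; *-assoc = *P-assoc
      ; *-identity = *P-identityˡ , λ p → ≐-trans (*P-comm p oneP) (*P-identityˡ p)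
      ; distrib = (λ r p q → ≐-trans (*P-comm r (p +P q)) (≐-trans (*P-distribʳ r p q) (+P-cong (*P-comm p r) (*P-comm q r)))) , *P-distribʳ
      }
    ; *-comm = *P-comm }
  }

-- The functions behind monicDiv are private: unification recovers them.
mutual
  divide : ℕ → List ℤ → List ℤ → List ℤ
  divide = _

  monicDiv-def : ∀ a b → monicDiv a b ≡ reverse (divide (length a) (reverse a) (drop 1 (reverse b)))
  monicDiv-def a b with length a | reverse a | drop 1 (reverse b)
  ... | _ | _ | _ with reverse {A = ℤ}
  ... | _ = ≡.refl

mutual
  subtractLead : ℤ → List ℤ → List ℤ → List ℤ
  subtractLead = _

  divide-yes : ∀ f a as bt → length bt ≤ length as → divide (suc f) (a ∷ as) bt ≡ a ∷ divide f (subtractLead a as bt) bt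
  divide-yes f a as bt le with length bt ≤? length as
  ... | yes _   = ≡.refl
  ... | no  ¬le = contradiction le ¬le

private
  module P = CommutativeRing polyRing
  module S = Sums polyRing
open Fractions polyRing using (Regular; cancel; regular-*; regular-≈; regular-cancel)

0∷≐ : ∀ p → 0ℤ ∷ p ≐ X^ 1 *P p
0∷≐ p = ≐-sym (≐-trans (0∷-*P (1ℤ ∷ []) p) (∷-cong ≡.refl (*P-identityˡ p)))

X^-+ : ∀ a b → X^ (a ℕ.+ b) ≐ X^ a *P X^ b
X^-+ zero    b = ≐-sym (*P-identityˡ (X^ b))
X^-+ (suc a) b = ≐-trans (∷-cong ≡.refl (X^-+ a b)) (≐-sym (0∷-*P (X^ a) (X^ b)))

X^≐^ : ∀ k → X^ k ≐ X^ 1 S.^ k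
X^≐^ zero    = ≐-refl
X^≐^ (suc k) = ≐-trans (0∷≐ (X^ k)) (P.*-congˡ {X^ 1} (X^≐^ k))

regular-X^ : ∀ k → Regular (X^ k)
regular-X^ zero    .cancel {p} eq = ≐-trans (≐-sym (*P-identityˡ p)) eq
regular-X^ (suc k) .cancel {p} eq = regular-X^ k .cancel (pointwise λ i → (≐-trans (≐-sym (0∷-*P (X^ k) p)) eq) .at (suc i))

coef-X^* : ∀ k p i → coef (X^ k *P p) (k ℕ.+ i) ≡ coef p i
coef-X^* zero    p i = *P-identityˡ p .at i
coef-X^* (suc k) p i = ≡.trans (0∷-*P (X^ k) p .at (suc (k ℕ.+ i))) (coef-X^* k p i)

coef-X^*-< : ∀ k p i → i < k → coef (X^ k *P p) i ≡ 0ℤ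
coef-X^*-< (suc k) p zero    _         = 0∷-*P (X^ k) p .at 0
coef-X^*-< (suc k) p (suc i) (s≤s i<k) = ≡.trans (0∷-*P (X^ k) p .at (suc i)) (coef-X^*-< k p i i<k)

-- An annihilated p satisfies p = X^(k+1) p, so each coefficient is 0 or equals one of lower index.
regular-1-X^ : ∀ k → Regular (oneP -P X^ (suc k))
regular-1-X^ k .cancel {p} eq = pointwise (<-rec (λ i → coef p i ≡ 0ℤ) step)
  where
  p≐X^p : p ≐ X^ (suc k) *P p
  p≐X^p = RingFacts.x-y≈0⇒x≈y polyRing (≐-trans (S.solve 2 (λ p x → p S.:- x S.:* p S.:= (S.one S.:- x) S.:* p) ≐-refl p (X^ (suc k))) eq)
  step : ∀ i → (∀ {j} → j < i → coef p j ≡ 0ℤ) → coef p i ≡ 0ℤ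
  step i rec with ℕₚ.<-≤-connex i (suc k)
  ... | inj₁ i<k = ≡.trans (p≐X^p .at i) (coef-X^*-< (suc k) p i i<k)
  ... | inj₂ k<i = ≡.trans (p≐X^p .at i) (≡.trans (≡.cong (coef (X^ (suc k) *P p)) (≡.sym (ℕₚ.m+[n∸m]≡n k<i)))
    (≡.trans (coef-X^* (suc k) p (i ∸ suc k)) (rec (ℕₚ.∸-monoʳ-< (s≤s z≤n) k<i))))

fromℤ+≐constP : ∀ n → S.fromℤ (+ n) ≐ constP (+ n)
fromℤ+≐constP zero          = ≐-sym 0∷[]
fromℤ+≐constP (suc zero)    = ≐-refl
fromℤ+≐constP (suc (suc n)) = ≐-trans (+P-cong (fromℤ+≐constP (suc n)) (≐-refl {oneP}))
  (∷-cong (≡.cong +_ (ℕₚ.+-comm (suc n) 1)) ≐-refl)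

fromℤ≐constP : ∀ c → S.fromℤ c ≐ constP c
fromℤ≐constP (+ n)    = fromℤ+≐constP n
fromℤ≐constP -[1+ n ] = negP-cong (fromℤ+≐constP (suc n))

fromℤ-*P : ∀ c p → S.fromℤ c *P p ≐ scaleP c p
fromℤ-*P c p = ≐-trans (*P-cong (fromℤ≐constP c) ≐-refl) (≐-trans (+P-cong ≐-refl 0∷[]) (+P-identityʳ _))

-- Degrees and leading coefficients

VanishesAbove : ℕ → Poly → Set
VanishesAbove d p = ∀ i → d < i → coef p i ≡ 0ℤ

coef-top : ∀ p d q k → VanishesAbove d p → VanishesAbove k q → coef (p *P q) (d ℕ.+ k) ≡ coef p d ℤ.* coef q k
coef-top []      d       q k _  _  = ≡.sym (ℤₚ.*-zeroˡ (coef q k))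
coef-top (a ∷ p) zero    q k vp vq = ≡.trans (+P-cong (≐-refl {scaleP a q}) (≐-trans (∷-cong ≡.refl (*P-cong p≐[] (≐-refl {q}))) 0∷[]) .at k)
  (≡.trans (+P-identityʳ (scaleP a q) .at k) (coef-scale a q k))
  where
  p≐[] : p ≐ []
  p≐[] .at i = vp (suc i) (s≤s z≤n)
coef-top (a ∷ p) (suc d) q k vp vq = ≡.trans (coef-+ (scaleP a q) (0ℤ ∷ p *P q) (suc (d ℕ.+ k)))
  (≡.trans (≡.cong₂ ℤ._+_ (≡.trans (coef-scale a q _) (≡.trans (≡.cong (a ℤ.*_) (vq _ (s≤s (ℕₚ.m≤n+m k d)))) (ℤₚ.*-zeroʳ a)))
    (coef-top p d q k (λ i d<i → vp (suc i) (s≤s d<i)) vq)) (ℤₚ.+-identityˡ _))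

degree : ∀ p → p ≐ [] ⊎ ∃ λ d → coef p d ≢ 0ℤ × VanishesAbove d p
degree []      = inj₁ ≐-refl
degree (a ∷ p) with degree p
... | inj₂ (d , p_d≢0 , vp) = inj₂ (suc d , p_d≢0 , λ { (suc i) (s≤s d<i) → vp i d<i })
... | inj₁ p≐[] with a ℤ.≟ 0ℤ
...   | yes a≡0 = inj₁ (≐-trans (∷-cong a≡0 p≐[]) 0∷[])
...   | no  a≢0 = inj₂ (0 , a≢0 , λ { (suc i) _ → p≐[] .at i })

-- If G had positive degree, the leading coefficients of G and H would give a non-zero coefficient
-- of positive index.
divisor-of-constant : ∀ G H {c} → c ≢ 0ℤ → G *P H ≐ constP c → ∃ λ c′ → G ≐ constP c′
divisor-of-constant G H {c} c≢0 eq with degree G | degree H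
... | inj₁ G≐[] | _         = 0ℤ , ≐-trans G≐[] (≐-sym 0∷[])
... | inj₂ _    | inj₁ H≐[] = contradiction (≡.trans (≡.sym (eq .at 0)) (≐-trans (*P-congʳ G H≐[]) (*P-zeroʳ G) .at 0)) c≢0
... | inj₂ (zero  , _     , vG) | inj₂ _                = coef G 0 , pointwise λ { zero → ≡.refl ; (suc i) → vG (suc i) (s≤s z≤n) }
... | inj₂ (suc d , G_d≢0 , vG) | inj₂ (k , H_k≢0 , vH)
  with ℤₚ.i*j≡0⇒i≡0∨j≡0 (coef G (suc d)) (≡.trans (≡.sym (coef-top G (suc d) H k vG vH)) (eq .at (suc d ℕ.+ k)))
...   | inj₁ G_d≡0 = contradiction G_d≡0 G_d≢0
...   | inj₂ H_k≡0 = contradiction H_k≡0 H_k≢0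

coef-length : ∀ p i → length p ≤ i → coef p i ≡ 0ℤ
coef-length []      i       _           = ≡.refl
coef-length (a ∷ p) (suc i) (s≤s p≤i) = coef-length p i p≤i

-- A property of the coefficient list (no trailing zeros), not of the polynomial up to _≐_: monicDiv needs it.
Monic : ℕ → Poly → Set
Monic d p = ∃ λ p′ → p ≡ p′ ∷ʳ 1ℤ × length p′ ≡ d

monic-∷ : ∀ {d p} a → Monic d p → Monic (suc d) (a ∷ p)
monic-∷ a (p′ , ≡.refl , ≡.refl) = a ∷ p′ , ≡.refl , ≡.refl

monic-+ʳ : ∀ {d} s {p} → length s ≤ d → Monic d p → Monic d (s +P p)
monic-+ʳ []      _                        mp                             = mp
monic-+ʳ (a ∷ s) (s≤s s≤d) (b ∷ p′ , ≡.refl , ≡.refl) = monic-∷ (a ℤ.+ b) (monic-+ʳ s s≤d (p′ , ≡.refl , ≡.refl))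

monic-+ˡ : ∀ {d p} s → Monic d p → length s ≤ d → Monic d (p +P s)
monic-+ˡ []      (a ∷ p′ , ≡.refl , ≡.refl) _   = a ∷ p′ , ≡.refl , ≡.refl
monic-+ˡ []      ([] , ≡.refl , ≡.refl)     _   = [] , ≡.refl , ≡.refl
monic-+ˡ (b ∷ s) (a ∷ p′ , ≡.refl , ≡.refl) (s≤s s≤d) = monic-∷ (a ℤ.+ b) (monic-+ˡ s (p′ , ≡.refl , ≡.refl) s≤d)

monic-length : ∀ {d p} → Monic d p → length p ≡ suc d
monic-length (p′ , ≡.refl , ≡.refl) = ≡.trans (Listₚ.length-++ p′) (ℕₚ.+-comm (length p′) 1)

monic-scale : ∀ {d p} → Monic d p → Monic d (scaleP 1ℤ p)
monic-scale (p′ , ≡.refl , ≡.refl) = scaleP 1ℤ p′ , Listₚ.map-++ (1ℤ ℤ.*_) p′ (1ℤ ∷ []) , Listₚ.length-map (1ℤ ℤ.*_) p′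

monic-* : ∀ {d e p q} → Monic d p → Monic e q → Monic (d ℕ.+ e) (p *P q)
monic-* {e = zero}  ([] , ≡.refl , ≡.refl) ([] , ≡.refl , ≡.refl) = [] , ≡.refl , ≡.refl
monic-* {e = suc e} ([] , ≡.refl , ≡.refl) mq = monic-+ˡ (0ℤ ∷ []) (monic-scale mq) (s≤s z≤n)
monic-* {e = e} {q = q} (a ∷ p′ , ≡.refl , ≡.refl) mq = monic-+ʳ (scaleP a q)
  (ℕₚ.≤-trans (ℕₚ.≤-reflexive (≡.trans (Listₚ.length-map (a ℤ.*_) q) (monic-length mq))) (s≤s (ℕₚ.m≤n+m e (length p′))))
  (monic-∷ 0ℤ (monic-* (p′ , ≡.refl , ≡.refl) mq))

monic-X^ : ∀ n → Monic n (X^ n)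
monic-X^ n = replicate n 0ℤ , ≡.refl , Listₚ.length-replicate n

monic-coef : ∀ {d p} → Monic d p → coef p d ≡ 1ℤ
monic-coef ([]     , ≡.refl , ≡.refl) = ≡.refl
monic-coef (a ∷ p′ , ≡.refl , ≡.refl) = monic-coef (p′ , ≡.refl , ≡.refl)

-- The leading coefficient of a non-zero G would reappear in M G at an index at least d, beyond the
-- end of s.
monic-*-short : ∀ {d M} → Monic d M → ∀ G s → M *P G ≐ s → length s ≤ d → G ≐ []
monic-*-short {d} {M} mM G s eq s≤d with degree G
... | inj₁ G≐[] = G≐[]
... | inj₂ (k , G_k≢0 , vG) = contradiction (≡.trans (≡.sym (ℤₚ.*-identityˡ (coef G k)))
    (≡.trans (≡.cong (ℤ._* coef G k) (≡.sym (monic-coef mM)))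
    (≡.trans (≡.sym (coef-top M d G k (λ i d<i → coef-length M i (≡.subst (_≤ i) (≡.sym (monic-length mM)) d<i)) vG))
    (≡.trans (eq .at (d ℕ.+ k)) (coef-length s _ (ℕₚ.≤-trans s≤d (ℕₚ.m≤m+n d k))))))) G_k≢0

-- Long division, on coefficient lists written with the highest degree first

reverse-∷ : ∀ a as → reverse (a ∷ as) ≐ reverse as +P S.fromℤ a *P X^ (length as)
reverse-∷ a as = ≐-trans (P.reflexive (Listₚ.unfold-reverse a as)) (≐-trans (∷ʳ≐ (reverse as))
    (+P-cong (≐-refl {reverse as}) (≐-trans (P.reflexive (≡.cong (scaleP a ∘ X^) (Listₚ.length-reverse as))) (≐-sym (fromℤ-*P a (X^ (length as)))))))
  where
  ∷ʳ≐ : ∀ p → p ∷ʳ a ≐ p +P scaleP a (X^ (length p))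
  ∷ʳ≐ []      = ∷-cong (≡.sym (ℤₚ.*-identityʳ a)) ≐-refl
  ∷ʳ≐ (b ∷ p) = ∷-cong (≡.sym (≡.trans (≡.cong₂ ℤ._+_ (≡.refl {x = b}) (ℤₚ.*-zeroʳ a)) (ℤₚ.+-identityʳ b))) (∷ʳ≐ p)

length-subtractLead : ∀ c as bs → length (subtractLead c as bs) ≡ length as
length-subtractLead c (a ∷ as) (b ∷ bs) = ≡.cong suc (length-subtractLead c as bs)
length-subtractLead c (a ∷ as) []       = ≡.refl
length-subtractLead c []       []       = ≡.refl
length-subtractLead c []       (b ∷ bs) = ≡.refl

-- Aligning two lists at their high ends multiplies the shorter polynomial by X to the difference of
-- lengths.
subtractLead-spec : ∀ c as bs → length bs ≤ length as →
  reverse (subtractLead c as bs) ≐ reverse as -P S.fromℤ c *P X^ (length as ∸ length bs) *P reverse bs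
subtractLead-spec c []       []       _ = ≐-sym (negP-cong (*P-zeroʳ (S.fromℤ c *P X^ 0)))
subtractLead-spec c (a ∷ as) []       _ = ≐-sym (≐-trans (+P-cong (≐-refl {reverse (a ∷ as)}) (negP-cong (*P-zeroʳ (S.fromℤ c *P X^ (suc (length as)))))) (+P-identityʳ _))
subtractLead-spec c (a ∷ as) (b ∷ bs) (s≤s bs≤as) = begin
  reverse ((a ℤ.- c ℤ.* b) ∷ subtractLead c as bs)
    ≈⟨ reverse-∷ (a ℤ.- c ℤ.* b) (subtractLead c as bs) ⟩
  reverse (subtractLead c as bs) +P S.fromℤ (a ℤ.- c ℤ.* b) *P X^ (length (subtractLead c as bs))
    ≈⟨ P.+-cong (subtractLead-spec c as bs bs≤as) (P.*-cong (P.trans (S.fromℤ-+ a (ℤ.- (c ℤ.* b))) (P.+-congˡ {S.fromℤ a} (P.trans (S.fromℤ-neg (c ℤ.* b)) (P.-‿cong (S.fromℤ-* c b))))) (P.reflexive (≡.cong X^ (length-subtractLead c as bs)))) ⟩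
  reverse as -P C *P X^ k *P reverse bs +P (A -P C *P B) *P X^ (length as)
    ≈⟨ P.+-congˡ {reverse as -P C *P X^ k *P reverse bs} (P.*-congˡ {A -P C *P B} X^≐) ⟩
  reverse as -P C *P X^ k *P reverse bs +P (A -P C *P B) *P (X^ k *P X^ (length bs))
    ≈⟨ S.solve 7 (λ r c x s a b y → r S.:- c S.:* x S.:* s S.:+ (a S.:- c S.:* b) S.:* (x S.:* y)
                     S.:= (r S.:+ a S.:* (x S.:* y)) S.:- c S.:* x S.:* (s S.:+ b S.:* y)) ≐-refl (reverse as) C (X^ k) (reverse bs) A B (X^ (length bs)) ⟩
  (reverse as +P A *P (X^ k *P X^ (length bs))) -P C *P X^ k *P (reverse bs +P B *P X^ (length bs))
    ≈⟨ P.+-cong (P.trans (P.+-congˡ {reverse as} (P.*-congˡ {A} (P.sym X^≐))) (P.sym (reverse-∷ a as))) (P.-‿cong (P.*-congˡ {C *P X^ k} (P.sym (reverse-∷ b bs)))) ⟩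
  reverse (a ∷ as) -P C *P X^ k *P reverse (b ∷ bs) ∎
  where
  open ≈-Reasoning P.setoid
  k : ℕ
  k = length as ∸ length bs
  A B C : Poly
  A = S.fromℤ a
  B = S.fromℤ b
  C = S.fromℤ c
  X^≐ : X^ (length as) ≐ X^ k *P X^ (length bs)
  X^≐ = P.trans (P.reflexive (≡.cong X^ (≡.sym (ℕₚ.m∸n+n≡m bs≤as)))) (X^-+ k (length bs))

length-divide : ∀ f as bt → length as ≤ f → length (divide f as bt) ≡ length as ∸ length bt
length-divide zero    []       bt       _ = ≡.sym (ℕₚ.0∸n≡0 (length bt))
length-divide (suc f) []       bt       _ = ≡.sym (ℕₚ.0∸n≡0 (length bt))
length-divide (suc f) (a ∷ as) bt (s≤s as≤f) with length bt ≤? length as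
... | yes le = ≡.trans (≡.cong suc (≡.trans (length-divide f (subtractLead a as bt) bt (≡.subst (_≤ f) (≡.sym (length-subtractLead a as bt)) as≤f))
                 (≡.cong (_∸ length bt) (length-subtractLead a as bt)))) (≡.sym (ℕₚ.+-∸-assoc 1 le))
... | no ¬le = ≡.sym (ℕₚ.m≤n⇒m∸n≡0 (ℕₚ.≰⇒> ¬le))

-- The divisor is 1 ∷ bt, of degree `length bt`, so the length bound on the remainder says that its
-- degree is smaller.
divide-spec : ∀ f as bt → length as ≤ f →
  ∃ λ rem → length rem ≤ length bt × reverse as ≐ reverse (divide f as bt) *P reverse (1ℤ ∷ bt) +P rem
divide-spec zero    []       bt _ = [] , z≤n , ≐-refl
divide-spec (suc f) []       bt _ = [] , z≤n , ≐-refl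
divide-spec (suc f) (a ∷ as) bt (s≤s as≤f) with length bt ≤? length as
... | no ¬le = reverse (a ∷ as) , ℕₚ.≤-trans (ℕₚ.≤-reflexive (Listₚ.length-reverse (a ∷ as))) (ℕₚ.≰⇒> ¬le) , ≐-refl
... | yes le with divide-spec f (subtractLead a as bt) bt (≡.subst (_≤ f) (≡.sym (length-subtractLead a as bt)) as≤f)
...   | rem , rem≤ , eq = rem , rem≤ , (begin
  reverse (a ∷ as)
    ≈⟨ reverse-∷ a as ⟩
  reverse as +P A *P X^ (length as)
    ≈⟨ P.+-congˡ {reverse as} (P.*-congˡ {A} X^≐) ⟩
  reverse as +P A *P (X^ k *P X^ (length bt))
    ≈⟨ S.solve 5 (λ r a x y b → r S.:+ a S.:* (x S.:* y) S.:= (r S.:- a S.:* x S.:* b) S.:+ a S.:* x S.:* (b S.:+ S.one S.:* y)) ≐-refl (reverse as) A (X^ k) (X^ (length bt)) (reverse bt) ⟩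
  reverse as -P A *P X^ k *P reverse bt +P A *P X^ k *P (reverse bt +P oneP *P X^ (length bt))
    ≈⟨ P.+-cong (P.sym (subtractLead-spec a as bt le)) (P.*-congˡ {A *P X^ k} (P.sym (reverse-∷ 1ℤ bt))) ⟩
  reverse (subtractLead a as bt) +P A *P X^ k *P M
    ≈⟨ P.+-congʳ {A *P X^ k *P M} eq ⟩
  reverse Q *P M +P rem +P A *P X^ k *P M
    ≈⟨ S.solve 5 (λ q m r a x → q S.:* m S.:+ r S.:+ a S.:* x S.:* m S.:= (q S.:+ a S.:* x) S.:* m S.:+ r) ≐-refl (reverse Q) M rem A (X^ k) ⟩
  (reverse Q +P A *P X^ k) *P M +P rem
    ≈⟨ P.+-congʳ {rem} (P.*-congʳ {M} (P.trans (P.+-congˡ {reverse Q} (P.*-congˡ {A} (P.reflexive (≡.cong X^ (≡.sym Q-length))))) (P.sym (reverse-∷ a Q)))) ⟩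
  reverse (a ∷ Q) *P M +P rem ∎)
  where
  open ≈-Reasoning P.setoid
  k : ℕ
  k = length as ∸ length bt
  A M : Poly
  A = S.fromℤ a
  M = reverse (1ℤ ∷ bt)
  Q : List ℤ
  Q = divide f (subtractLead a as bt) bt
  Q-length : length Q ≡ k
  Q-length = ≡.trans (length-divide f (subtractLead a as bt) bt (≡.subst (_≤ f) (≡.sym (length-subtractLead a as bt)) as≤f)) (≡.cong (_∸ length bt) (length-subtractLead a as bt))
  X^≐ : X^ (length as) ≐ X^ k *P X^ (length bt)
  X^≐ = P.trans (P.reflexive (≡.cong X^ (≡.sym (ℕₚ.m∸n+n≡m le)))) (X^-+ k (length bt))

reverse-monic : ∀ {d p} → Monic d p → ∃ λ bt → reverse p ≡ 1ℤ ∷ bt × length bt ≡ d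
reverse-monic (p′ , ≡.refl , ≡.refl) = reverse p′ , Listₚ.reverse-++ p′ (1ℤ ∷ []) , Listₚ.length-reverse p′

scaleP-regular : ∀ {c} → c ≢ 0ℤ → ∀ p → scaleP c p ≐ [] → p ≐ []
scaleP-regular {c} c≢0 p eq .at i with ℤₚ.i*j≡0⇒i≡0∨j≡0 c (≡.trans (≡.sym (coef-scale c p i)) (eq .at i))
... | inj₁ c≡0 = contradiction c≡0 c≢0
... | inj₂ p≡0 = p≡0

module _ {d n : ℕ} {M P H : Poly} {c : ℤ} (monic-M : Monic d M) (monic-P : Monic n P) (c≢0 : c ≢ 0ℤ) (MH≐cP : M *P H ≐ S.fromℤ c *P P) where

  monic-divisor-degree : d ≤ n
  monic-divisor-degree with d ≤? n
  ... | yes d≤n = d≤n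
  ... | no  d≰n = contradiction (≡.trans (≡.sym (ℤₚ.*-identityʳ c)) (≡.trans (≡.cong (c ℤ.*_) (≡.sym (monic-coef monic-P)))
          (≡.trans (≡.sym (coef-scale c P n)) (≐-trans (≐-sym MH≐) (≐-trans (*P-congʳ M H≐[]) (*P-zeroʳ M)) .at n)))) c≢0
    where
    MH≐ : M *P H ≐ scaleP c P
    MH≐ = ≐-trans MH≐cP (fromℤ-*P c P)
    H≐[] : H ≐ []
    H≐[] = monic-*-short monic-M H (scaleP c P) MH≐ (ℕₚ.≤-trans (ℕₚ.≤-reflexive (≡.trans (Listₚ.length-map (c ℤ.*_) P) (monic-length monic-P))) (ℕₚ.≰⇒> d≰n))

  -- With P = Q M + rem, the hypothesis gives M (H - cQ) = c · rem. The right side is too short for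
  -- a non-zero multiple of M, so it vanishes, and c ≠ 0 can be cancelled. Thus M divides P itself,
  -- not merely c P.
  monicDiv-exact : monicDiv P M *P M ≐ P
  monicDiv-exact with reverse-monic monic-M
  ... | bt , rev-M , bt≡d with divide-spec (length P) (reverse P) bt (ℕₚ.≤-reflexive (Listₚ.length-reverse P))
  ...   | rem , rem≤ , eq = P.sym (P.trans (P.trans P≐ (P.+-congˡ {Q *P M} rem≐[])) (+P-identityʳ (Q *P M)))
    where
    Q : Poly
    Q = monicDiv P M
    M≡ : M ≡ reverse (1ℤ ∷ bt)
    M≡ = ≡.trans (≡.sym (Listₚ.reverse-involutive M)) (≡.cong reverse rev-M)
    Q≡ : Q ≡ reverse (divide (length P) (reverse P) bt)
    Q≡ = ≡.trans (monicDiv-def P M) (≡.cong (λ l → reverse (divide (length P) (reverse P) (drop 1 l))) rev-M)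
    P≐ : P ≐ Q *P M +P rem
    P≐ = P.trans (P.reflexive (≡.sym (Listₚ.reverse-involutive P))) (P.trans eq (P.reflexive (≡.cong₂ (λ q m → q *P m +P rem) (≡.sym Q≡) (≡.sym M≡))))
    C : Poly
    C = S.fromℤ c
    c-rem : M *P (H -P C *P Q) ≐ scaleP c rem
    c-rem = begin
      M *P (H -P C *P Q) ≈⟨ S.solve 4 (λ m h c q → m S.:* (h S.:- c S.:* q) S.:= m S.:* h S.:- c S.:* (q S.:* m)) ≐-refl M H C Q ⟩
      M *P H -P C *P (Q *P M) ≈⟨ P.+-congʳ {negP (C *P (Q *P M))} (P.trans MH≐cP (P.*-congˡ {C} P≐)) ⟩
      C *P (Q *P M +P rem) -P C *P (Q *P M) ≈⟨ S.solve 3 (λ c y r → c S.:* (y S.:+ r) S.:- c S.:* y S.:= c S.:* r) ≐-refl C (Q *P M) rem ⟩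
      C *P rem ≈⟨ fromℤ-*P c rem ⟩
      scaleP c rem ∎
      where open ≈-Reasoning P.setoid
    G≐[] : H -P C *P Q ≐ []
    G≐[] = monic-*-short monic-M (H -P C *P Q) (scaleP c rem) c-rem
      (ℕₚ.≤-trans (ℕₚ.≤-reflexive (Listₚ.length-map (c ℤ.*_) rem)) (≡.subst (length rem ≤_) bt≡d rem≤))
    rem≐[] : rem ≐ []
    rem≐[] = scaleP-regular c≢0 rem (≐-trans (≐-sym c-rem) (≐-trans (*P-congʳ M G≐[]) (*P-zeroʳ M)))

  -- As d ≤ n, the first division step is carried out, and it emits the leading coefficient 1 of P.
  monic-monicDiv : ∃ λ k → Monic k (monicDiv P M)
  monic-monicDiv with reverse-monic monic-M | reverse-monic monic-P
  ... | bt , rev-M , bt≡d | ap , rev-P , ap≡n = _ , reverse Q , ≡.trans Q≡ (Listₚ.unfold-reverse 1ℤ Q) , ≡.refl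
    where
    Q : List ℤ
    Q = divide n (subtractLead 1ℤ ap bt) bt
    Q≡ : monicDiv P M ≡ reverse (1ℤ ∷ Q)
    Q≡ = ≡.trans (monicDiv-def P M) (≡.trans (≡.cong (λ l → reverse (divide (length P) (reverse P) (drop 1 l))) rev-M)
      (≡.trans (≡.cong₂ (λ k l → reverse (divide k l bt)) (monic-length monic-P) rev-P)
      (≡.cong reverse (divide-yes n 1ℤ ap bt (≡.subst₂ _≤_ (≡.sym bt≡d) (≡.sym ap≡n) monic-divisor-degree)))))

-- The product formula for the computed `Φ`

properDivisors : ℕ → List ℕ
properDivisors n = filter (λ d → d ∣? n) (upTo n)

properDivisors-All : ∀ n → 0 < n → All (λ d → 0 < d × d < n) (properDivisors n)
properDivisors-All n 0<n = All.zipWith (λ { (d∣n , d<n) → ℕₚ.n≢0⇒n>0 (λ { ≡.refl → ℕₚ.<⇒≢ 0<n (≡.sym (0∣⇒≡0 d∣n)) }) , d<n })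
  (Allₚ.all-filter (λ d → d ∣? n) (upTo n) , Allₚ.filter⁺ (λ d → d ∣? n) (Allₚ.all-upTo n))

-- d = 0 has to be excluded: `cycAux f 0` is 1 without fuel and 0 with fuel. Proper divisors of a
-- positive number are positive, so the recursion never gets there.
cycAux-fuel : ∀ f f′ d → 0 < d → d ≤ f → d ≤ f′ → cycAux f d ≡ cycAux f′ d
cycAux-fuel zero    _        d       0<d d≤0 _    = contradiction 0<d (ℕₚ.≤⇒≯ d≤0)
cycAux-fuel (suc f) zero     d       0<d _   d≤0  = contradiction 0<d (ℕₚ.≤⇒≯ d≤0)
cycAux-fuel (suc f) (suc f′) d       0<d d≤f d≤f′ = ≡.cong (λ l → monicDiv (X^ d -P oneP) (prodP l))
  (Listₚ.map-cong-local (All.map (λ { {e} (0<e , e<d) → cycAux-fuel f f′ e 0<e (ℕₚ.≤-pred (ℕₚ.<-≤-trans e<d d≤f)) (ℕₚ.≤-pred (ℕₚ.<-≤-trans e<d d≤f′)) }) (properDivisors-All d 0<d)))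

Φ-def : ∀ n → 0 < n → Φ n ≡ monicDiv (X^ n -P oneP) (prodP (map Φ (properDivisors n)))
Φ-def (suc n) 0<n = ≡.cong (λ l → monicDiv (X^ (suc n) -P oneP) (prodP l))
  (Listₚ.map-cong-local (All.map (λ { {e} (0<e , e<n) → cycAux-fuel n e e 0<e (ℕₚ.≤-pred e<n) ℕₚ.≤-refl }) (properDivisors-All (suc n) 0<n)))

regular-1-X^P : ∀ g → Regular (oneP -P X^ 1 S.^ suc g)
regular-1-X^P g = regular-≈ (P.+-congˡ {oneP} (P.-‿cong (X^≐^ (suc g)))) (regular-1-X^ g)

X : Poly
X = X^ 1

open Comaximality polyRing
open PowerDifferences polyRing X using (geo; geo-sum; comax-geo; power-difference)
open Cyclotomic polyRing X Φ using (χ; χ-yes; χ-no; Factorises; Φ∣1-X^)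
open Cyclotomic.WithRegular polyRing X Φ regular-1-X^P using (product-divides; comax-Φ; comax-ΦΦ)

Π<-head : ∀ n f → S.Π< (suc n) f ≐ f 0 *P S.Π< n (f ∘ suc)
Π<-head n f = P.trans (RingFacts.Π<-+ polyRing 1 n f) (P.*-congʳ {S.Π< n (f ∘ suc)} (*P-identityˡ (f 0)))

prodP-filter : ∀ n b (h : ℕ → ℕ) → prodP (map Φ (filter (λ d → d ∣? n) (applyUpTo h b))) ≐ S.Π< b (χ n ∘ h)
prodP-filter n zero    h = ≐-refl
prodP-filter n (suc b) h = P.trans (step (prodP-filter n b (h ∘ suc))) (P.sym (Π<-head b (χ n ∘ h)))
  where
  step : prodP (map Φ (filter (λ d → d ∣? n) (applyUpTo (h ∘ suc) b))) ≐ S.Π< b (χ n ∘ h ∘ suc) →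
         prodP (map Φ (filter (λ d → d ∣? n) (applyUpTo h (suc b)))) ≐ χ n (h 0) *P S.Π< b (χ n ∘ h ∘ suc)
  step eq with does (h 0 ∣? n)
  ... | true  = P.*-congˡ {Φ (h 0)} eq
  ... | false = P.trans eq (P.sym (*P-identityˡ _))

monic-prodP : ∀ {l} → All (λ e → ∃ λ d → Monic d (Φ e)) l → ∃ λ d → Monic d (prodP (map Φ l))
monic-prodP []               = 0 , [] , ≡.refl , ≡.refl
monic-prodP ((d , me) ∷ mes) with monic-prodP mes
... | k , mk = d ℕ.+ k , monic-* me mk

-- Both properties are carried by one induction: monicity of the smaller `Φ` makes their product an
-- admissible divisor for `monicDiv`, and their product formulas make the division exact.
Φ-factorises∧monic : ∀ n → 0 < n → Factorises n × ∃ λ d → Monic d (Φ n)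
Φ-factorises∧monic = <-rec (λ n → 0 < n → Factorises n × ∃ λ d → Monic d (Φ n)) step
  where
  step : ∀ n → (∀ {k} → k < n → 0 < k → Factorises k × ∃ λ d → Monic d (Φ k)) → 0 < n → Factorises n × ∃ λ d → Monic d (Φ n)
  step n rec 0<n with product-divides n 0<n (λ k k<n → proj₁ (rec k<n (s≤s z≤n)))
                    | monic-prodP (All.map (λ { (0<e , e<n) → proj₂ (rec e<n 0<e) }) (properDivisors-All n 0<n))
  ... | c , c≢0 , H , eq | d , monic-M = factorises , (proj₁ monic-Φ , ≡.subst (Monic _) (≡.sym (Φ-def n 0<n)) (proj₂ monic-Φ))
    where
    M Q : Poly
    M = prodP (map Φ (properDivisors n))
    Q = X^ n -P oneP
    M≐ : M ≐ S.Π< n (χ n)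
    M≐ = prodP-filter n n id
    Q≐ : X^ 1 S.^ n -P oneP ≐ Q
    Q≐ = P.+-congʳ {negP oneP} (≐-sym (X^≐^ n))
    monic-Q : Monic n Q
    monic-Q = monic-+ˡ (negP oneP) (monic-X^ n) 0<n
    MH≐cQ : M *P H ≐ S.fromℤ c *P Q
    MH≐cQ = P.trans (P.*-congʳ {H} M≐) (P.trans eq (P.*-congˡ {S.fromℤ c} Q≐))
    monic-Φ : ∃ λ k → Monic k (monicDiv Q M)
    monic-Φ = monic-monicDiv monic-M monic-Q c≢0 MH≐cQ
    factorises : Factorises n
    factorises = P.trans (P.*-cong (P.reflexive (Φ-def n 0<n)) (P.sym M≐)) (P.trans (monicDiv-exact monic-M monic-Q c≢0 MH≐cQ) (P.sym Q≐))

Φ-factorises : ∀ k → Factorises (suc k)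
Φ-factorises k = proj₁ (Φ-factorises∧monic (suc k) (s≤s z≤n))

-- A common divisor of D and P divides the integer in the Bézout relation.
comax⇒CoprimeP : ∀ {D P} → Comax D P → CoprimeP D P
comax⇒CoprimeP {D} {P} (comax U V c c≢0 eq) G (H , GH≈D) (H′ , GH′≈P) = proj₁ constant , ≐⇒≈P (proj₂ constant)
  where
  open ≈-Reasoning P.setoid
  constant : ∃ λ c′ → G ≐ constP c′
  constant = divisor-of-constant G (U *P H +P V *P H′) c≢0 (begin
    G *P (U *P H +P V *P H′) ≈⟨ S.solve 5 (λ g u h v k → g S.:* (u S.:* h S.:+ v S.:* k) S.:= u S.:* (g S.:* h) S.:+ v S.:* (g S.:* k)) ≐-refl G U H V H′ ⟩
    U *P (G *P H) +P V *P (G *P H′) ≈⟨ P.+-cong (P.*-congˡ {U} (≈P⇒≐ GH≈D)) (P.*-congˡ {V} (≈P⇒≐ GH′≈P)) ⟩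
    U *P D +P V *P P ≈⟨ eq ⟩
    S.fromℤ c ≈⟨ fromℤ≐constP c ⟩
    constP c ∎)

-- q-factorials, q-integers and power differences as polynomials

prodP-applyUpTo : ∀ (f : ℕ → Poly) (h : ℕ → ℕ) k → prodP (map f (applyUpTo h k)) ≐ S.Π< k (f ∘ h)
prodP-applyUpTo f h zero    = ≐-refl
prodP-applyUpTo f h (suc k) = P.trans (P.*-congˡ {f (h 0)} (prodP-applyUpTo f (h ∘ suc) k)) (P.sym (Π<-head k (f ∘ h)))

qpoch≐ : ∀ r s k → qpoch r s k ≐ S.Π< k (λ i → oneP -P X S.^ (r ℕ.+ s ℕ.* i))
qpoch≐ r s k = P.trans (prodP-applyUpTo (λ i → oneP -P X^ (r ℕ.+ s ℕ.* i)) id k)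
  (RingFacts.Π<-cong polyRing k λ i → P.+-congˡ {oneP} (P.-‿cong (X^≐^ (r ℕ.+ s ℕ.* i))))

qint≐ : ∀ n → qint n ≐ S.Σ< n X^
qint≐ n = go id n
  where
  go : ∀ (h : ℕ → ℕ) k → foldr _+P_ [] (map X^ (applyUpTo h k)) ≐ S.Σ< k (X^ ∘ h)
  go h zero    = ≐-refl
  go h (suc k) = P.trans (P.+-congˡ {X^ (h 0)} (go (h ∘ suc) k)) (P.sym (RingFacts.Σ<-+ polyRing 1 k (X^ ∘ h)))

qint-sum : ∀ n → (oneP -P X) *P qint n ≐ oneP -P X S.^ n
qint-sum n = P.trans (P.*-congˡ {oneP -P X} (qint≐ n)) (go n)
  where
  open ≈-Reasoning P.setoid
  go : ∀ k → (oneP -P X) *P S.Σ< k X^ ≐ oneP -P X S.^ k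
  go zero    = P.trans (*P-zeroʳ (oneP -P X)) (P.sym (-P-inverseʳ oneP))
  go (suc k) = begin
    (oneP -P X) *P (S.Σ< k X^ +P X^ k) ≈⟨ P.distribˡ (oneP -P X) (S.Σ< k X^) (X^ k) ⟩
    (oneP -P X) *P S.Σ< k X^ +P (oneP -P X) *P X^ k ≈⟨ P.+-cong (go k) (P.*-congˡ {oneP -P X} (X^≐^ k)) ⟩
    oneP -P X S.^ k +P (oneP -P X) *P X S.^ k ≈⟨ S.solve 2 (λ x y → S.one S.:- y S.:+ (S.one S.:- x) S.:* y S.:= S.one S.:- x S.:* y) ≐-refl X (X S.^ k) ⟩
    oneP -P X *P X S.^ k ∎

regular-neg : ∀ {r} → Regular r → Regular (negP r)
regular-neg {r} reg .cancel {x} eq = reg .cancel (P.trans (S.solve 2 (λ r x → r S.:* x S.:= S.:- ((S.:- r) S.:* x)) ≐-refl r x) (P.trans (P.-‿cong eq) ≐-refl))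

regular-X^P : ∀ k → Regular (X S.^ k)
regular-X^P k = regular-≈ (X^≐^ k) (regular-X^ k)

regular-power-difference : ∀ {a b} → a ≢ b → Regular (X S.^ a -P X S.^ b)
regular-power-difference {a} {b} a≢b = unit ℕ.∣ a - b ∣ (a≢b ∘ ℕₚ.∣m-n∣≡0⇒m≡n) (power-difference a b)
  where
  unit : ∀ k → k ≢ 0 → X S.^ a -P X S.^ b ≐ X S.^ a *P (oneP -P X S.^ k) ⊎ X S.^ a -P X S.^ b ≐ negP (X S.^ b) *P (oneP -P X S.^ k) →
         Regular (X S.^ a -P X S.^ b)
  unit zero    k≢0 _           = contradiction ≡.refl k≢0
  unit (suc g) k≢0 (inj₁ diff) = regular-≈ (P.sym diff) (regular-* (regular-X^P a) (regular-1-X^P g))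
  unit (suc g) k≢0 (inj₂ diff) = regular-≈ (P.sym diff) (regular-* (regular-neg (regular-X^P b)) (regular-1-X^P g))

factorises≤ : ∀ d k → suc k ≤ d → Factorises (suc k)
factorises≤ d k _ = Φ-factorises k

-- The Bézout relation is X^(d+1) + (1 - X^(d+1)) = 1, whose second summand is a multiple of Φ.
comax-X : ∀ d → Comax X (Φ (suc d))
comax-X d = comax (X S.^ d) H 1ℤ (λ ()) (begin
  X S.^ d *P X +P H *P Φ (suc d) ≈⟨ P.+-cong (*P-comm (X S.^ d) X) (P.trans (*P-comm H (Φ (suc d))) (Φ∣1-X^ (suc d) (Φ-factorises d))) ⟩
  X *P X S.^ d +P (oneP -P X *P X S.^ d) ≈⟨ S.solve 1 (λ x → x S.:+ (S.one S.:- x) S.:= S.one) ≐-refl (X *P X S.^ d) ⟩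
  oneP ∎)
  where
  open ≈-Reasoning P.setoid
  H : Poly
  H = negP (S.Π< (suc d) (χ (suc d)))

comax-power-difference : ∀ d a b → ¬ (suc d ∣ ℕ.∣ a - b ∣) → Comax (X S.^ a -P X S.^ b) (Φ (suc d))
comax-power-difference d a b d∤ = unit (power-difference a b)
  where
  cm : Comax (oneP -P X S.^ ℕ.∣ a - b ∣) (Φ (suc d))
  cm = comax-sym (comax-Φ (suc d) (factorises≤ (suc d)) ℕ.∣ a - b ∣ (s≤s z≤n) d∤)
  unit : _ → _
  unit (inj₁ diff) = comax-≈ (P.sym diff) P.refl (comax-* (comax-^ a (comax-X d)) cm)
  unit (inj₂ diff) = comax-≈ (P.sym diff) P.refl (comax-* (comax-neg (comax-^ b (comax-X d))) cm)

-- Up to sign and a power of X, E is `geo s Y`, congruent to s ≠ 0 modulo 1 - Y: the zero along Φ is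
-- simple.
power-difference-multiple : ∀ d a b → a ≢ b → suc d ∣ ℕ.∣ a - b ∣ → ∃ λ E → Comax E (Φ (suc d)) × E *P (oneP -P X S.^ suc d) ≐ X S.^ a -P X S.^ b
power-difference-multiple d a b a≢b (divides s eq) = unit (power-difference a b)
  where
  Y : Poly
  Y = X S.^ suc d
  s≢0 : s ≢ 0
  s≢0 ≡.refl = a≢b (ℕₚ.∣m-n∣≡0⇒m≡n eq)
  comax-geoΦ : Comax (geo s Y) (Φ (suc d))
  comax-geoΦ = comax-sym (comax-factor (comax-≈ (P.sym (Φ∣1-X^ (suc d) (Φ-factorises d))) P.refl (comax-sym (comax-geo s Y s≢0))))
  split : ∀ F → F *P geo s Y *P (oneP -P Y) ≐ F *P (oneP -P X S.^ ℕ.∣ a - b ∣)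
  split F = P.trans (S.solve 3 (λ f g y → f S.:* g S.:* y S.:= f S.:* (y S.:* g)) ≐-refl F (geo s Y) (oneP -P Y))
    (P.*-congˡ {F} (P.trans (geo-sum s Y) (P.+-congˡ {oneP} (P.-‿cong (P.trans (S.^-assocʳ X (suc d) s) (S.^-congʳ X (≡.trans (ℕₚ.*-comm (suc d) s) (≡.sym eq))))))))
  unit : _ → _
  unit (inj₁ diff) = X S.^ a *P geo s Y , comax-* (comax-^ a (comax-X d)) comax-geoΦ , P.trans (split (X S.^ a)) (P.sym diff)
  unit (inj₂ diff) = negP (X S.^ b) *P geo s Y , comax-* (comax-neg (comax-^ b (comax-X d))) comax-geoΦ , P.trans (split (negP (X S.^ b))) (P.sym diff)

-- The factor Φ 1 = X - 1 of Xⁿ - 1 accounts for the denominator of [n]; the sign is absorbed in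
-- `Φ∣1-X^`.
qint-factors : ∀ n → qint (2 ℕ.+ n) ≐ Φ (2 ℕ.+ n) *P S.Π< n (λ i → χ (2 ℕ.+ n) (2 ℕ.+ i))
qint-factors n = regular-cancel {oneP -P X} (regular-≈ 1-X≐ (regular-1-X^P 0)) {qint N} {Φ N *P R} (begin
  (oneP -P X) *P qint N ≈⟨ qint-sum N ⟩
  oneP -P X S.^ N ≈⟨ Φ∣1-X^ N (Φ-factorises (suc n)) ⟨
  Φ N *P negP (S.Π< N (χ N)) ≈⟨ P.*-congˡ {Φ N} (P.-‿cong (RingFacts.Π<-+ polyRing 2 n (χ N))) ⟩
  Φ N *P negP (oneP *P χ N 0 *P χ N 1 *P R) ≈⟨ P.*-congˡ {Φ N} (P.-‿cong (P.*-congʳ {R} (P.*-cong (P.*-congˡ {oneP} (P.reflexive (χ-no {N} {0} 0∤N))) Φ₁))) ⟩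
  Φ N *P negP (oneP *P oneP *P (X -P oneP) *P R) ≈⟨ S.solve 3 (λ f x r → f S.:* (S.:- (S.one S.:* S.one S.:* (x S.:- S.one) S.:* r)) S.:= (S.one S.:- x) S.:* (f S.:* r)) ≐-refl (Φ N) X R ⟩
  (oneP -P X) *P (Φ N *P R) ∎)
  where
  open ≈-Reasoning P.setoid
  N : ℕ
  N = 2 ℕ.+ n
  R : Poly
  R = S.Π< n (λ i → χ N (2 ℕ.+ i))
  0∤N : ¬ 0 ∣ N
  0∤N 0∣N = contradiction (0∣⇒≡0 0∣N) λ ()
  1-X≐ : oneP -P X S.^ 1 ≐ oneP -P X
  1-X≐ = P.+-congˡ {oneP} (P.-‿cong (P.*-identityʳ X))
  Φ₁ : χ N 1 ≐ X -P oneP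
  Φ₁ = P.trans (P.reflexive (χ-yes {N} {1} (1∣ N))) (P.trans (P.sym (P.*-identityʳ (Φ 1))) (P.trans (P.*-congˡ {Φ 1} (P.sym (P.trans (*P-identityˡ (χ 1 0)) (P.reflexive (χ-no {1} {0} λ 0∣1 → contradiction (0∣⇒≡0 0∣1) λ ())))))
    (P.trans (Φ-factorises 0) (P.+-congʳ {negP oneP} (P.*-identityʳ X)))))

-- The indices have the form 1 + 2t + 4m taken by LocalSum.
data Shape : ℕ → Set where
  1mod4 : ∀ m → Shape (1 ℕ.+ 2 ℕ.* 0 ℕ.+ 4 ℕ.* suc m)
  3mod4 : ∀ m → Shape (1 ℕ.+ 2 ℕ.* 1 ℕ.+ 4 ℕ.* m)

private
  eq₁ : ∀ t m → 1 ℕ.+ 2 ℕ.* t ℕ.+ 4 ℕ.* suc m ≡ 4 ℕ.+ (1 ℕ.+ 2 ℕ.* t ℕ.+ 4 ℕ.* m)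
  eq₁ = solve-∀
  eq₂ : ∀ M → 4 ℕ.+ (1 ℕ.+ 2 ℕ.* suc M) ≡ 1 ℕ.+ 2 ℕ.* suc (suc (suc M))
  eq₂ = solve-∀

shape : ∀ M → Shape (1 ℕ.+ 2 ℕ.* suc M)
shape zero          = 3mod4 0
shape (suc zero)    = 1mod4 0
shape (suc (suc M)) with 1 ℕ.+ 2 ℕ.* suc M in eq | shape M
... | _ | 1mod4 m = ≡.subst Shape (≡.trans (eq₁ 0 (suc m)) (≡.trans (≡.cong (4 ℕ.+_) (≡.sym eq)) (eq₂ M))) (1mod4 (suc m))
... | _ | 3mod4 m = ≡.subst Shape (≡.trans (eq₁ 1 m) (≡.trans (≡.cong (4 ℕ.+_) (≡.sym eq)) (eq₂ M))) (3mod4 (suc m))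

-- Assembling the congruences in the ring of fractions

record Embedding (K : CommutativeRing 0ℓ 0ℓ) (ι : Poly → CommutativeRing.Carrier K) : Set where
  open CommutativeRing K
  field
    ι-cong      : ∀ {x y} → x ≐ y → ι x ≈ ι y
    ι-injective : ∀ {x y} → ι x ≈ ι y → x ≐ y
    ι-1         : ι oneP ≈ 1#
    ι-+         : ∀ x y → ι (x +P y) ≈ ι x + ι y
    ι-*         : ∀ x y → ι (x *P y) ≈ ι x * ι y
    ι-unit      : ∀ {r} → Regular r → ∃ λ y → ι r * y ≈ 1#

module Assembly (K : CommutativeRing 0ℓ 0ℓ) (ι : Poly → CommutativeRing.Carrier K) (embedding : Embedding K ι) where
  open CommutativeRing K
  open Sums K
  open RingFacts K
  open ≈-Reasoning setoid
  open Embedding embedding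
  open LocalisationAt.Extension polyRing K ι ι-cong ι-1 ι-+ ι-*

  -- Ties an unreduced fraction of the statement to its value without inverting its denominator.
  Represents : Frac → Carrier → Set
  Represents f x = x * ι (den f) ≈ ι (num f)

  represents-sumF : ∀ {f x} → (∀ k → Represents (f k) (x k)) → ∀ n → Represents (sumF n f) (Σ< n x)
  represents-sumF rep zero    = trans (zeroˡ _) (sym ι-0)
  represents-sumF {f} {x} rep (suc n) = begin
    (Σ< n x + x n) * ι (B *P D) ≈⟨ *-congˡ (ι-* B D) ⟩
    (Σ< n x + x n) * (ι B * ι D) ≈⟨ solve 4 (λ s y b d → (s :+ y) :* (b :* d) := s :* b :* d :+ y :* d :* b) refl (Σ< n x) (x n) (ι B) (ι D) ⟩
    Σ< n x * ι B * ι D + x n * ι D * ι B ≈⟨ +-cong (*-congʳ (represents-sumF rep n)) (*-congʳ (rep n)) ⟩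
    ι A * ι D + ι C * ι B ≈⟨ +-cong (ι-* A D) (ι-* C B) ⟨
    ι (A *P D) + ι (C *P B) ≈⟨ ι-+ _ _ ⟨
    ι (A *P D +P C *P B) ∎
    where
    A B C D : Poly
    A = num (sumF n f)
    B = den (sumF n f)
    C = num (f n)
    D = den (f n)

  represents-difference : ∀ {A B x y} → Represents A x → Represents B y →
    (x - y) * ι (den A *P den B) ≈ ι (num A *P den B -P num B *P den A)
  represents-difference {A} {B} {x} {y} repA repB = begin
    (x - y) * ι (den A *P den B) ≈⟨ *-congˡ (ι-* (den A) (den B)) ⟩
    (x - y) * (ι (den A) * ι (den B)) ≈⟨ solve 4 (λ x y a b → (x :- y) :* (a :* b) := x :* a :* b :- y :* b :* a) refl x y (ι (den A)) (ι (den B)) ⟩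
    x * ι (den A) * ι (den B) - y * ι (den B) * ι (den A) ≈⟨ +-cong (*-congʳ repA) (-‿cong (*-congʳ repB)) ⟩
    ι (num A) * ι (den B) - ι (num B) * ι (den A) ≈⟨ +-cong (ι-* (num A) (den B)) (-‿cong (ι-* (num B) (den A))) ⟨
    ι (num A *P den B) - ι (num B *P den A) ≈⟨ ι-- (num A *P den B) (num B *P den A) ⟨
    ι (num A *P den B -P num B *P den A) ∎

  congF : ∀ {A B x y P} → Represents A x → Represents B y → Cong (x - y) P → CongF A B P
  congF {A} {B} {x} {y} {P} repA repB (congruent N D cm eq) = N , D , comax⇒CoprimeP cm , ≐⇒≈P (ι-injective (begin
    ι ((num A *P den B -P num B *P den A) *P D) ≈⟨ ι-* _ D ⟩
    ι (num A *P den B -P num B *P den A) * ι D ≈⟨ *-congʳ (represents-difference {A} {B} repA repB) ⟨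
    (x - y) * ι (den A *P den B) * ι D ≈⟨ solve 3 (λ x d f → x :* d :* f := x :* f :* d) refl (x - y) (ι (den A *P den B)) (ι D) ⟩
    (x - y) * ι D * ι (den A *P den B) ≈⟨ *-congʳ eq ⟩
    ι (P *P N) * ι (den A *P den B) ≈⟨ ι-* (P *P N) _ ⟨
    ι (P *P N *P (den A *P den B)) ∎))

  q p : Carrier
  q = ι X
  p = proj₁ (ι-unit (regular-X^ 1))

  qp≈1 : q * p ≈ 1#
  qp≈1 = proj₂ (ι-unit (regular-X^ 1))

  ι-1-X^ : ∀ a → ι (oneP -P X S.^ a) ≈ 1# - q ^ a
  ι-1-X^ a = trans (ι-- oneP (X S.^ a)) (+-cong ι-1 (-‿cong (ι-^ X a)))

  ι-X^-X^ : ∀ a b → ι (X S.^ a -P X S.^ b) ≈ q ^ a - q ^ b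
  ι-X^-X^ a b = trans (ι-- (X S.^ a) (X S.^ b)) (+-cong (ι-^ X a) (-‿cong (ι-^ X b)))

  abstract
    w : ℕ → ℕ → Carrier
    w a b with a ℕ.≟ b
    ... | yes _  = 0#
    ... | no a≢b = proj₁ (ι-unit (regular-power-difference a≢b))

    w-inv : ∀ {a b} → a ≢ b → (q ^ a - q ^ b) * w a b ≈ 1#
    w-inv {a} {b} a≢b with a ℕ.≟ b
    ... | yes a≡b = contradiction a≡b a≢b
    ... | no a≢b  = trans (*-congʳ (sym (ι-X^-X^ a b))) (proj₂ (ι-unit (regular-power-difference a≢b)))

  inverses : Inverses K q p w
  inverses = record { qp≈1 = qp≈1 ; w-inv = w-inv }

  open Evaluation K q p w inverses
  open Terms K q

  term₁ : ℕ → Carrier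
  term₁ = T α 1# (1# + 1#) (λ i → α i * α i) 1# (η 0)

  ι-qpoch : ∀ r s k → ι (qpoch r s k) ≈ Π< k (λ i → 1# - q ^ (r ℕ.+ s ℕ.* i))
  ι-qpoch r s k = trans (ι-cong (qpoch≐ r s k)) (trans (ι-Π k _) (Π<-cong k λ i → ι-1-X^ (r ℕ.+ s ℕ.* i)))

  w₁ : Carrier
  w₁ = w 0 1

  w₁-inv : (1# - q) * w₁ ≈ 1#
  w₁-inv = trans (*-congʳ (+-congˡ (-‿cong (sym (*-identityʳ q))))) (w-inv {0} {1} λ ())

  ι-qint : ∀ n → ι (qint n) ≈ w₁ * (1# - q ^ n)
  ι-qint n = begin
    ι (qint n) ≈⟨ times-unit w₁-inv ⟨
    ι (qint n) * ((1# - q) * w₁) ≈⟨ solve 3 (λ i x w → i :* (x :* w) := w :* (x :* i)) refl (ι (qint n)) (1# - q) w₁ ⟩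
    w₁ * ((1# - q) * ι (qint n)) ≈⟨ *-congˡ (*-congʳ (trans (ι-- oneP X) (+-congʳ ι-1))) ⟨
    w₁ * (ι (oneP -P X) * ι (qint n)) ≈⟨ *-congˡ (ι-* (oneP -P X) (qint n)) ⟨
    w₁ * ι ((oneP -P X) *P qint n) ≈⟨ *-congˡ (trans (ι-cong (qint-sum n)) (ι-1-X^ n)) ⟩
    w₁ * (1# - q ^ n) ∎

  private
    Q : ℕ → ℕ → ℕ → Carrier
    Q r s k = Π< k (λ i → 1# - q ^ (r ℕ.+ s ℕ.* i))

    CRB : ℕ → Carrier
    CRB k = Π< k (c α) * Π< k (r 1# (1# + 1#) (λ i → α i * α i)) * Π< k (b 1# (η 0))

  term-products : ∀ k → CRB k * (Q 2 2 k * (Q 4 4 k * Q 4 4 k * Q 4 4 k)) ≈ Q 1 4 k * (Q 1 2 k * Q 1 2 k * Q 1 2 k) * q ^ (k ℕ.* k ℕ.+ k)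
  term-products zero = solve 1 (λ q → one :* one :* one :* (one :* (one :* one :* one)) := one :* (one :* one :* one) :* one) refl q
  term-products (suc k) = begin
    C * ((1# - q * W k) * α k) * (R * (e 1# (1# + 1#) (q * W k) * (α k * α k))) * (B * ((1# - q * W k ^ 2) * (q ^ 2 * W k) * η 0 k))
      * (Q 2 2 k * y₂ * (Q 4 4 k * y₄ * (Q 4 4 k * y₄) * (Q 4 4 k * y₄)))
      ≈⟨ solve 12 (λ C R B x a z v h Q₂ Q₄ y u → C :* ((one :- x) :* a) :* (R :* ((one :- (one :+ one) :* x :+ one :* (x :* x)) :* (a :* a))) :* (B :* ((one :- z) :* v :* h)) :* (Q₂ :* y :* (Q₄ :* u :* (Q₄ :* u) :* (Q₄ :* u)))
          := C :* R :* B :* (Q₂ :* (Q₄ :* Q₄ :* Q₄)) :* ((one :- z) :* ((one :- x) :* (one :- x) :* (one :- x)) :* v) :* (y :* h) :* (u :* a) :* (u :* a) :* (u :* a))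
          refl C R B (q * W k) (α k) (q * W k ^ 2) (q ^ 2 * W k) (η 0 k) (Q 2 2 k) (Q 4 4 k) y₂ y₄ ⟩
    _ ≈⟨ times-unit (w-inv {0} λ ()) ⟩
    _ ≈⟨ times-unit (w-inv {0} λ ()) ⟩
    _ ≈⟨ times-unit (w-inv {0} λ ()) ⟩
    _ ≈⟨ times-unit (w-inv {0} λ ()) ⟩
    CRB k * (Q 2 2 k * (Q 4 4 k * Q 4 4 k * Q 4 4 k)) * ((1# - q * W k ^ 2) * ((1# - q * W k) * (1# - q * W k) * (1# - q * W k)) * (q ^ 2 * W k))
      ≈⟨ *-cong (term-products k) (*-cong (*-cong z≈ (*-cong (*-cong x≈ x≈) x≈)) (q²W≈ k)) ⟩
    Q 1 4 k * (Q 1 2 k * Q 1 2 k * Q 1 2 k) * q ^ (k ℕ.* k ℕ.+ k) * (z * (x * x * x) * q ^ (2 ℕ.+ 2 ℕ.* k))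
      ≈⟨ solve 6 (λ Q P f z x g → Q :* (P :* P :* P) :* f :* (z :* (x :* x :* x) :* g) := Q :* z :* (P :* x :* (P :* x) :* (P :* x)) :* (f :* g)) refl (Q 1 4 k) (Q 1 2 k) (q ^ (k ℕ.* k ℕ.+ k)) z x (q ^ (2 ℕ.+ 2 ℕ.* k)) ⟩
    Q 1 4 (suc k) * (Q 1 2 (suc k) * Q 1 2 (suc k) * Q 1 2 (suc k)) * (q ^ (k ℕ.* k ℕ.+ k) * q ^ (2 ℕ.+ 2 ℕ.* k))
      ≈⟨ *-congˡ (q^-+ (k ℕ.* k ℕ.+ k) (2 ℕ.+ 2 ℕ.* k) refl refl (eq k)) ⟩
    Q 1 4 (suc k) * (Q 1 2 (suc k) * Q 1 2 (suc k) * Q 1 2 (suc k)) * q ^ (suc k ℕ.* suc k ℕ.+ suc k) ∎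
    where
    C R B x z y₂ y₄ : Carrier
    C = Π< k (c α)
    R = Π< k (r 1# (1# + 1#) (λ i → α i * α i))
    B = Π< k (b 1# (η 0))
    x = 1# - q ^ (1 ℕ.+ 2 ℕ.* k)
    z = 1# - q ^ (1 ℕ.+ 4 ℕ.* k)
    y₂ = 1# - q ^ (2 ℕ.+ 2 ℕ.* k)
    y₄ = 1# - q ^ (4 ℕ.+ 4 ℕ.* k)
    x≈ : 1# - q * W k ≈ x
    x≈ = +-congˡ (-‿cong (*-congˡ (W≈ k)))
    z≈ : 1# - q * W k ^ 2 ≈ z
    z≈ = +-congˡ (-‿cong (*-congˡ (W²≈ k)))
    eq : ∀ k → k ℕ.* k ℕ.+ k ℕ.+ (2 ℕ.+ 2 ℕ.* k) ≡ suc k ℕ.* suc k ℕ.+ suc k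
    eq = solve-∀

  represents-term : ∀ k → Represents (term k) (w₁ * term₁ k)
  represents-term k = begin
    w₁ * (h k * CRB k) * ι (qpoch 2 2 k *P (qpoch 4 4 k *P qpoch 4 4 k *P qpoch 4 4 k))
      ≈⟨ *-congˡ (trans (ι-* _ _) (*-cong (ι-qpoch 2 2 k) (ι-cube 4 4))) ⟩
    w₁ * (h k * CRB k) * (Q 2 2 k * (Q 4 4 k * Q 4 4 k * Q 4 4 k))
      ≈⟨ solve 4 (λ w h C D → w :* (h :* C) :* D := w :* h :* (C :* D)) refl w₁ (h k) (CRB k) (Q 2 2 k * (Q 4 4 k * Q 4 4 k * Q 4 4 k)) ⟩
    w₁ * h k * (CRB k * (Q 2 2 k * (Q 4 4 k * Q 4 4 k * Q 4 4 k)))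
      ≈⟨ *-cong (*-congˡ (+-congˡ (-‿cong (trans (*-congˡ (W³≈ k)) (^-congʳ q (ℕₚ.+-comm 1 (6 ℕ.* k))))))) (term-products k) ⟩
    w₁ * (1# - q ^ (6 ℕ.* k ℕ.+ 1)) * (Q 1 4 k * (Q 1 2 k * Q 1 2 k * Q 1 2 k) * q ^ (k ℕ.* k ℕ.+ k))
      ≈⟨ solve 4 (λ w a b f → w :* (a :* b :* f) := w :* a :* b :* f) refl (w₁ * (1# - q ^ (6 ℕ.* k ℕ.+ 1))) (Q 1 4 k) (Q 1 2 k * Q 1 2 k * Q 1 2 k) (q ^ (k ℕ.* k ℕ.+ k)) ⟩
    w₁ * (1# - q ^ (6 ℕ.* k ℕ.+ 1)) * Q 1 4 k * (Q 1 2 k * Q 1 2 k * Q 1 2 k) * q ^ (k ℕ.* k ℕ.+ k)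
      ≈⟨ trans (ι-* _ _) (*-cong (trans (ι-* _ _) (*-cong (trans (ι-* _ _) (*-cong (ι-qint (6 ℕ.* k ℕ.+ 1)) (ι-qpoch 1 4 k))) (ι-cube 1 2))) (trans (ι-cong (X^≐^ (k ℕ.* k ℕ.+ k))) (ι-^ X (k ℕ.* k ℕ.+ k)))) ⟨
    ι (qint (6 ℕ.* k ℕ.+ 1) *P qpoch 1 4 k *P (qpoch 1 2 k *P qpoch 1 2 k *P qpoch 1 2 k) *P X^ (k ℕ.* k ℕ.+ k)) ∎
    where
    ι-cube : ∀ r s → ι (qpoch r s k *P qpoch r s k *P qpoch r s k) ≈ Q r s k * Q r s k * Q r s k
    ι-cube r s = trans (ι-* _ _) (*-cong (trans (ι-* _ _) (*-cong (ι-qpoch r s k) (ι-qpoch r s k))) (ι-qpoch r s k))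

  closed-products : ∀ m → closed m * (Q 4 4 m * q ^ m) ≈ Q 2 4 m
  closed-products zero = solve 1 (λ q → one :* one :* (one :* one) := one) refl q
  closed-products (suc m) = begin
    A * (y * α m) * (p * p ^ m) * (Q 4 4 m * u * (q * q ^ m))
      ≈⟨ solve 9 (λ A y a p P D u q f → A :* (y :* a) :* (p :* P) :* (D :* u :* (q :* f)) := A :* P :* (D :* f) :* y :* (u :* a) :* (q :* p)) refl A y (α m) p (p ^ m) (Q 4 4 m) u q (q ^ m) ⟩
    A * p ^ m * (Q 4 4 m * q ^ m) * y * (u * α m) * (q * p)
      ≈⟨ times-unit qp≈1 ⟩
    _ ≈⟨ times-unit (w-inv {0} λ ()) ⟩
    closed m * (Q 4 4 m * q ^ m) * y
      ≈⟨ *-congʳ (closed-products m) ⟩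
    Q 2 4 (suc m) ∎
    where
    A y u : Carrier
    A = Π< m (λ i → (1# - q ^ (2 ℕ.+ 4 ℕ.* i)) * α i)
    y = 1# - q ^ (2 ℕ.+ 4 ℕ.* m)
    u = 1# - q ^ (4 ℕ.+ 4 ℕ.* m)

  represents-rhs : ∀ n m → Represents ((qpoch 2 4 m *P qint n) // (qpoch 4 4 m *P X^ m)) (w₁ * ((1# - q ^ n) * closed m))
  represents-rhs n m = begin
    w₁ * ((1# - q ^ n) * closed m) * ι (qpoch 4 4 m *P X^ m)
      ≈⟨ *-congˡ (trans (ι-* _ _) (*-cong (ι-qpoch 4 4 m) (trans (ι-cong (X^≐^ m)) (ι-^ X m)))) ⟩
    w₁ * ((1# - q ^ n) * closed m) * (Q 4 4 m * q ^ m)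
      ≈⟨ solve 4 (λ w x c d → w :* (x :* c) :* d := c :* d :* (w :* x)) refl w₁ (1# - q ^ n) (closed m) (Q 4 4 m * q ^ m) ⟩
    closed m * (Q 4 4 m * q ^ m) * (w₁ * (1# - q ^ n))
      ≈⟨ *-cong (closed-products m) refl ⟩
    Q 2 4 m * (w₁ * (1# - q ^ n))
      ≈⟨ trans (ι-* _ _) (*-cong (ι-qpoch 2 4 m) (ι-qint n)) ⟨
    ι (qpoch 2 4 m *P qint n) ∎

  represents-zeroF : Represents zeroF 0#
  represents-zeroF = trans (zeroˡ _) (sym ι-0)

  -- P will be Φ d or its cube, while locality always refers to Φ d.
  record MultipleAt (d : ℕ) (P : Poly) (x : Carrier) : Set where
    constructor multiple
    field
      cofactor : Carrier
      local    : Loc (Φ d) cofactor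
      equality : x ≈ ι P * cofactor

  module At (d′ : ℕ) where

    d : ℕ
    d = suc d′

    open Subring (Loc-subring (Φ d)) public

    Loc-u : Loc (Φ d) (1# - q ^ d)
    Loc-u = Loc-≈ (ι-1-X^ d) (Loc-ι (Φ d) (oneP -P X S.^ d))

    open Localisation K (Loc (Φ d)) (Loc-subring (Φ d)) (1# - q ^ d) Loc-u using (_∈u^_; quotient)

    Loc-p : Loc (Φ d) p
    Loc-p = loc oneP X (comax-X d′) (trans (*-comm p q) (trans qp≈1 (sym ι-1)))

    w-ι : ∀ {a b} → a ≢ b → w a b * ι (X S.^ a -P X S.^ b) ≈ ι oneP
    w-ι {a} {b} a≢b = trans (*-comm _ _) (trans (*-congʳ (ι-X^-X^ a b)) (trans (w-inv a≢b) (sym ι-1)))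

    Loc-w : ∀ {a b} → ¬ (d ∣ ℕ.∣ a - b ∣) → Loc (Φ d) (w a b)
    Loc-w {a} {b} d∤ = loc oneP (X S.^ a -P X S.^ b) (comax-power-difference d′ a b d∤)
      (w-ι λ a≡b → d∤ (divides 0 (ℕₚ.m≡n⇒∣m-n∣≡0 a≡b)))

    Loc-uw : ∀ {a b} → a ≢ b → Loc (Φ d) ((1# - q ^ d) * w a b)
    Loc-uw {a} {b} a≢b with d ∣? ℕ.∣ a - b ∣
    ... | no  d∤ = Loc-* Loc-u (Loc-w d∤)
    ... | yes d∣ = loc oneP E (proj₁ (proj₂ diff)) (begin
      (1# - q ^ d) * w a b * ι E ≈⟨ *-congʳ (*-congʳ (ι-1-X^ d)) ⟨
      ι (oneP -P X S.^ d) * w a b * ι E ≈⟨ solve 3 (λ u w f → u :* w :* f := w :* (f :* u)) refl (ι (oneP -P X S.^ d)) (w a b) (ι E) ⟩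
      w a b * (ι E * ι (oneP -P X S.^ d)) ≈⟨ *-congˡ (trans (sym (ι-* E _)) (ι-cong (proj₂ (proj₂ diff)))) ⟩
      w a b * ι (X S.^ a -P X S.^ b) ≈⟨ w-ι a≢b ⟩
      ι oneP ∎)
      where
      diff : ∃ λ E → Comax E (Φ d) × E *P (oneP -P X S.^ d) ≐ X S.^ a -P X S.^ b
      diff = power-difference-multiple d′ a b a≢b d∣
      E : Poly
      E = proj₁ diff

    H : Poly
    H = negP (S.Π< d (χ d))

    u≈ : 1# - q ^ d ≈ ι (Φ d) * ι H
    u≈ = trans (sym (ι-1-X^ d)) (trans (ι-cong (P.sym (Φ∣1-X^ d (Φ-factorises d′)))) (ι-* (Φ d) H))

    -- 1 - q^d is Φ d times a polynomial, so a power of u is a multiple of the same power of Φ d.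
    ∈u⇒multiple : ∀ {x} → x ∈u^ 1 → MultipleAt d (Φ d) x
    ∈u⇒multiple {x} (quotient l Ll eq) = multiple (ι H * l) (Loc-* (Loc-ι (Φ d) H) Ll) (begin
      x ≈⟨ eq ⟩
      (1# - q ^ d) * 1# * l ≈⟨ *-congʳ (*-congʳ u≈) ⟩
      ι (Φ d) * ι H * 1# * l ≈⟨ solve 3 (λ f h l → f :* h :* one :* l := f :* (h :* l)) refl (ι (Φ d)) (ι H) l ⟩
      ι (Φ d) * (ι H * l) ∎)

    ∈u³⇒multiple : ∀ {x} → x ∈u^ 3 → MultipleAt d (Φ d *P Φ d *P Φ d) x
    ∈u³⇒multiple {x} (quotient l Ll eq) = multiple (ι H * (ι H * (ι H * l))) (Loc-* LH (Loc-* LH (Loc-* LH Ll))) (begin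
      x ≈⟨ eq ⟩
      (1# - q ^ d) ^ 3 * l ≈⟨ *-congʳ (*-cong u≈ (*-cong u≈ (*-congʳ u≈))) ⟩
      (ι (Φ d) * ι H) ^ 3 * l ≈⟨ solve 3 (λ f h l → (f :* h) :^ 3 :* l := f :* f :* f :* (h :* (h :* (h :* l)))) refl (ι (Φ d)) (ι H) l ⟩
      ι (Φ d) * ι (Φ d) * ι (Φ d) * (ι H * (ι H * (ι H * l))) ≈⟨ *-congʳ (trans (ι-* _ _) (*-congʳ (ι-* _ _))) ⟨
      ι (Φ d *P Φ d *P Φ d) * (ι H * (ι H * (ι H * l))) ∎)
      where
      LH : Loc (Φ d) (ι H)
      LH = Loc-ι (Φ d) H

  half : ∀ {d} → Shape d → ℕ
  half (1mod4 m) = 0 ℕ.+ 2 ℕ.* suc m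
  half (3mod4 m) = 1 ℕ.+ 2 ℕ.* m

  half≡ : ∀ {d} (s : Shape d) → d ≡ 1 ℕ.+ 2 ℕ.* half s
  half≡ (1mod4 m) = eq m
    where
    eq : ∀ m → 1 ℕ.+ 2 ℕ.* 0 ℕ.+ 4 ℕ.* suc m ≡ 1 ℕ.+ 2 ℕ.* (0 ℕ.+ 2 ℕ.* suc m)
    eq = solve-∀
  half≡ (3mod4 m) = eq m
    where
    eq : ∀ m → 1 ℕ.+ 2 ℕ.* 1 ℕ.+ 4 ℕ.* m ≡ 1 ℕ.+ 2 ℕ.* (1 ℕ.+ 2 ℕ.* m)
    eq = solve-∀

  -- The sum at a = q^d and D = 1, which is 1 - q times the right-hand side of the theorem.
  value : ∀ {d} → Shape d → Carrier
  value (1mod4 m) = (1# - q ^ (1 ℕ.+ 2 ℕ.* 0 ℕ.+ 4 ℕ.* suc m)) * closed (suc m)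
  value (3mod4 m) = 0#

  -- The first powers, over any number of blocks, serve the proper divisors d of n; the cubes serve
  -- d = n.
  record Facts (d M : ℕ) (v : Carrier) : Set where
    field
      Loc-w₁           : Loc (Φ d) w₁
      full             : ∀ k → MultipleAt d (Φ d) (Σ< (k ℕ.* d) term₁)
      up-to-half       : ∀ k → MultipleAt d (Φ d) (Σ< (k ℕ.* d ℕ.+ suc M) term₁)
      closed-multiple  : ∀ k m → MultipleAt d (Φ d) ((1# - q ^ (k ℕ.* d)) * closed m)
      full-cube        : MultipleAt d (Φ d *P Φ d *P Φ d) (Σ< d term₁ - v)
      up-to-half-cube  : MultipleAt d (Φ d *P Φ d *P Φ d) (Σ< (suc M) term₁ - v)

  module _ (t m j : ℕ) (n∣5+4j : (1 ℕ.+ 2 ℕ.* t ℕ.+ 4 ℕ.* m) ∣ 1 ℕ.+ 4 ℕ.* suc j) (1+j<n : suc j < 1 ℕ.+ 2 ℕ.* t ℕ.+ 4 ℕ.* m) where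
    private
      n : ℕ
      n = 1 ℕ.+ 2 ℕ.* t ℕ.+ 4 ℕ.* m
      open module A = At (2 ℕ.* t ℕ.+ 4 ℕ.* m)
      local : LocalRing K q p w n (Loc (Φ n))
      local = record { subring = Loc-subring (Φ n) ; Loc-q = Loc-ι (Φ n) X ; Loc-p = Loc-p ; Loc-w = Loc-w ; Loc-uw = Loc-uw ; Loc-1-q^n = Loc-u }
      open module L = LocalSum K q p w inverses t m j n∣5+4j 1+j<n (Loc (Φ n)) local
      open module U = Localisation K (Loc (Φ n)) (Loc-subring (Φ n)) (1# - q ^ n) Loc-u

    facts-at : ∀ {v} → SumN.S t m n ≈ v → (∃ λ m′ → v ≈ (1# - q ^ n) * closed m′) ⊎ v ≈ 0# → Facts n (t ℕ.+ 2 ℕ.* m) v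
    facts-at {v} S≈v v-shape = record
      { Loc-w₁ = Loc-w λ n∣1 → ℕₚ.<⇒≱ (ℕₚ.≤-<-trans (s≤s z≤n) 1+j<n) (ℕₚ.≤-reflexive (∣1⇒≡1 n∣1))
      ; full = λ k → ∈u⇒multiple (Blocks.Σ-full∈u S∈u k)
      ; up-to-half = λ k → ∈u⇒multiple (Blocks.Σ-half∈u S∈u k)
      ; closed-multiple = λ k m → ∈u⇒multiple (closed-∈u k m)
      ; full-cube = ∈u³⇒multiple full≡v
      ; up-to-half-cube = ∈u³⇒multiple (≡u-trans Σt₁₁-half full≡v)
      }
      where
      closed-∈u : ∀ k m → (1# - q ^ (k ℕ.* n)) * closed m ∈u^ 1
      closed-∈u k m = ∈-*ʳ (1-q^kn∈u k) (Loc-closed m)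
      v∈u : (∃ λ m′ → v ≈ (1# - q ^ n) * closed m′) ⊎ v ≈ 0# → v ∈u^ 1
      v∈u (inj₁ (m′ , v≈)) = ∈-≈ (trans v≈ (*-congʳ (+-congˡ (-‿cong (^-congʳ q (≡.sym (ℕₚ.*-identityˡ n))))))) (closed-∈u 1 m′)
      v∈u (inj₂ v≈0)       = ∈-≈ v≈0 0∈
      S∈u : SumN.S t m n ∈u^ 1
      S∈u = ∈-≈ S≈v (v∈u v-shape)
      full≡v : Σ< n term₁ ≡ v [u^ 3 ]
      full≡v = ≡u-≈ refl (sym S≈v) Σt₁₁≡Σt₂₁

  -- For d = 1 + 4(m+1) the exponent 1 + 4·suc j is d itself, with j = m. For d = 3 + 4m it is 3d,
  -- with j = 1 + 3m.
  facts : ∀ {d} (s : Shape d) → Facts d (half s) (value s)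
  facts (1mod4 m) = facts-at 0 (suc m) m ∣-refl (s≤s (ℕₚ.m≤n*m (suc m) 4))
    (trans (sum-1mod4 (suc m) (1 ℕ.+ 2 ℕ.* 0 ℕ.+ 4 ℕ.* suc m) (s≤s (ℕₚ.*-monoˡ-≤ (suc m) (s≤s (s≤s (z≤n {2}))))))
           (*-congʳ (+-congˡ (-‿cong (SumN.Nₘ≈ 0 (suc m))))))
    (inj₁ (suc m , refl))
  facts (3mod4 m) = facts-at 1 m (1 ℕ.+ 3 ℕ.* m) (divides 3 (eq m)) (ℕₚ.+-monoʳ-≤ 3 (ℕₚ.*-monoˡ-≤ m (ℕₚ.n≤1+n 3)))
    (sum-3mod4 m (1 ℕ.+ 2 ℕ.* 1 ℕ.+ 4 ℕ.* m) (s≤s (s≤s (ℕₚ.m≤n⇒m≤1+n (ℕₚ.*-monoˡ-≤ m (s≤s (s≤s (z≤n {2}))))))))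
    (inj₂ refl)
    where
    eq : ∀ m → 1 ℕ.+ 4 ℕ.* suc (1 ℕ.+ 3 ℕ.* m) ≡ 3 ℕ.* (1 ℕ.+ 2 ℕ.* 1 ℕ.+ 4 ℕ.* m)
    eq = solve-∀

  cong-multiple : ∀ {d P x} → (∀ {D} → Comax D (Φ d) → Comax D P) → MultipleAt d P x → Cong x P
  cong-multiple {d} {P} {x} lift (multiple l (loc N D cm ratio) eq) = congruent N D (lift cm) (begin
    x * ι D ≈⟨ *-congʳ eq ⟩
    ι P * l * ι D ≈⟨ *-assoc _ _ _ ⟩
    ι P * (l * ι D) ≈⟨ *-congˡ ratio ⟩
    ι P * ι N ≈⟨ ι-* P N ⟨
    ι (P *P N) ∎)

  multiple-*ˡ : ∀ {d P x y} → Loc (Φ d) y → MultipleAt d P x → MultipleAt d P (y * x)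
  multiple-*ˡ {d} {P} {x} {y} Ly (multiple l Ll eq) = multiple (y * l) (Subring.Loc-* (Loc-subring (Φ d)) Ly Ll)
    (trans (*-congˡ eq) (solve 3 (λ y p l → y :* (p :* l) := p :* (y :* l)) refl y (ι P) l))

  multiple-- : ∀ {d P x y} → MultipleAt d P x → MultipleAt d P y → MultipleAt d P (x - y)
  multiple-- {d} {P} {x} {y} (multiple l Ll eq) (multiple l′ Ll′ eq′) =
    multiple (l - l′) (Subring.Loc-+ (Loc-subring (Φ d)) Ll (Subring.Loc-neg (Loc-subring (Φ d)) Ll′))
      (trans (+-cong eq (-‿cong eq′)) (solve 3 (λ p l k → p :* l :- p :* k := p :* (l :- k)) refl (ι P) l l′))

  multiple-≈ : ∀ {d P x y} → x ≈ y → MultipleAt d P y → MultipleAt d P x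
  multiple-≈ x≈y (multiple l Ll eq) = multiple l Ll (trans x≈y eq)

  multiple-0 : ∀ {d P} → MultipleAt d P 0#
  multiple-0 {d} {P} = multiple 0# (Subring.Loc-≈ (Loc-subring (Φ d)) ι-0 (Loc-ι (Φ d) [])) (sym (zeroʳ (ι P)))

  modulus≐ : ∀ n → S.Π< n (λ i → χ (2 ℕ.+ n) (2 ℕ.+ i)) *P (Φ (2 ℕ.+ n) *P Φ (2 ℕ.+ n) *P Φ (2 ℕ.+ n)) ≐ modulus (2 ℕ.+ n)
  modulus≐ n = P.trans (S.solve 2 (λ r f → r S.:* (f S.:* f S.:* f) S.:= f S.:* r S.:* f S.:* f) ≐-refl R F)
    (P.trans (P.*-congʳ {F} (P.*-congʳ {F} (P.sym (qint-factors n)))) ≐-refl)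
    where
    R F : Poly
    R = S.Π< n (λ i → χ (2 ℕ.+ n) (2 ℕ.+ i))
    F = Φ (2 ℕ.+ n)

  cong-modulus : ∀ n {x} → Cong x oneP → (∀ d → 1 < d → d < 2 ℕ.+ n → d ∣ 2 ℕ.+ n → Cong x (Φ d)) →
                 Cong x (Φ (2 ℕ.+ n) *P Φ (2 ℕ.+ n) *P Φ (2 ℕ.+ n)) → Cong x (modulus (2 ℕ.+ n))
  cong-modulus n {x} cong-1 cong-d cong-n = cong-≈ refl (modulus≐ n)
    (cong-* (comax-sym (comax-* (comax-* cm cm) cm)) (go n ℕₚ.≤-refl) cong-n)
    where
    n₂ : ℕ
    n₂ = 2 ℕ.+ n
    comax-Π : ∀ b {e} → 2 ℕ.+ b ≤ e → Comax (S.Π< b (λ i → χ n₂ (2 ℕ.+ i))) (Φ e)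
    comax-Π zero    b≤e = comax-1
    comax-Π (suc b) {e} b<e = comax-* (comax-Π b (ℕₚ.<⇒≤ b<e)) factor
      where
      factor : Comax (χ n₂ (2 ℕ.+ b)) (Φ e)
      factor with (2 ℕ.+ b) ∣? n₂
      ... | yes d∣n = ≡.subst (λ y → Comax y (Φ e)) (≡.sym (χ-yes d∣n)) (comax-ΦΦ (factorises≤ e) (s≤s z≤n) b<e)
      ... | no  d∤n = ≡.subst (λ y → Comax y (Φ e)) (≡.sym (χ-no d∤n)) comax-1
    cm : Comax (Φ n₂) (S.Π< n (λ i → χ n₂ (2 ℕ.+ i)))
    cm = comax-sym (comax-Π n ℕₚ.≤-refl)
    go : ∀ b → b ≤ n → Cong x (S.Π< b (λ i → χ n₂ (2 ℕ.+ i)))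
    go zero    _   = cong-1
    go (suc b) b<n with (2 ℕ.+ b) ∣? n₂
    ... | yes d∣n = ≡.subst (λ y → Cong x (S.Π< b (λ i → χ n₂ (2 ℕ.+ i)) *P y)) (≡.sym (χ-yes d∣n))
          (cong-* (comax-Π b ℕₚ.≤-refl) (go b (ℕₚ.<⇒≤ b<n)) (cong-d (2 ℕ.+ b) (s≤s (s≤s z≤n)) (s≤s (s≤s b<n)) d∣n))
    ... | no  d∤n = ≡.subst (λ y → Cong x (S.Π< b (λ i → χ n₂ (2 ℕ.+ i)) *P y)) (≡.sym (χ-no d∤n))
          (cong-≈ refl (P.sym (P.*-identityʳ (S.Π< b (λ i → χ n₂ (2 ℕ.+ i))))) (go b (ℕₚ.<⇒≤ b<n)))

  -- Start of the gluing: modulo 1 a congruence only asserts that x is a quotient of polynomials.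
  cong-one : ∀ {x D N} → x * ι D ≈ ι N → Cong x oneP
  cong-one {x} {D} {N} eq = congruent N D (comax-sym comax-1) (trans eq (ι-cong (P.sym (*P-identityˡ N))))

  parity : ∀ k → (∃ λ a → k ≡ 2 ℕ.* a) ⊎ (∃ λ a → k ≡ 1 ℕ.+ 2 ℕ.* a)
  parity zero    = inj₁ (0 , ≡.refl)
  parity (suc k) with parity k
  ... | inj₁ (a , ≡.refl) = inj₂ (a , ≡.refl)
  ... | inj₂ (a , ≡.refl) = inj₁ (suc a , eq a)
    where
    eq : ∀ a → 2 ℕ.+ 2 ℕ.* a ≡ 2 ℕ.* suc a
    eq = solve-∀

  data Length {n} (s : Shape n) : ℕ → Set where
    whole  : Length s n
    halved : Length s (suc (half s))

  module _ {n : ℕ} (s : Shape n) where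

    -- As n is odd, n = (2k′ + 1) d with d odd, so (n - 1)/2 = k′ d + (d - 1)/2: the truncated sum
    -- consists of k′ full blocks and one half block. The value contains 1 - qⁿ, a multiple of Φ d,
    -- or is 0.
    divisor-multiple : ∀ {L} → Length s L → ∀ d → 1 < d → d ∣ n → MultipleAt d (Φ d) (w₁ * (Σ< L term₁ - value s))
    divisor-multiple {L} len d 1<d (divides k n≡kd) with parity k | parity d
    ... | inj₁ (a , ≡.refl) | _ = contradiction (≡.trans (≡.sym (≡.trans n≡kd (ℕₚ.*-assoc 2 a d))) (half≡ s)) (ℕₚ.even≢odd (a ℕ.* d) (half s))
    ... | inj₂ _ | inj₁ (a , ≡.refl) = contradiction (≡.trans (≡.sym (≡.trans n≡kd (eq k a))) (half≡ s)) (ℕₚ.even≢odd (k ℕ.* a) (half s))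
      where
      eq : ∀ k a → k ℕ.* (2 ℕ.* a) ≡ 2 ℕ.* (k ℕ.* a)
      eq = solve-∀
    ... | inj₂ _ | inj₂ (zero , ≡.refl) = contradiction 1<d (ℕₚ.<-irrefl ≡.refl)
    ... | inj₂ (k′ , ≡.refl) | inj₂ (suc M , ≡.refl) = multiple-*ˡ F.Loc-w₁ (multiple-- (sum-multiple len) (value-multiple s n≡kd))
      where
      sd : Shape (1 ℕ.+ 2 ℕ.* suc M)
      sd = shape M
      module F = Facts (facts sd)
      value-multiple : ∀ {n} (s : Shape n) → n ≡ (1 ℕ.+ 2 ℕ.* k′) ℕ.* (1 ℕ.+ 2 ℕ.* suc M) → MultipleAt d (Φ d) (value s)
      value-multiple (1mod4 m) eq = multiple-≈ (*-congʳ (+-congˡ (-‿cong (^-congʳ q eq)))) (F.closed-multiple (1 ℕ.+ 2 ℕ.* k′) (suc m))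
      value-multiple (3mod4 m) eq = multiple-0
      half-sd : half sd ≡ suc M
      half-sd = ℕₚ.*-cancelˡ-≡ _ _ 2 (ℕₚ.suc-injective (≡.sym (half≡ sd)))
      half-s : suc (half s) ≡ k′ ℕ.* d ℕ.+ suc (half sd)
      half-s = ≡.trans (≡.cong suc (ℕₚ.*-cancelˡ-≡ _ _ 2 (ℕₚ.suc-injective (≡.trans (≡.sym (half≡ s)) (≡.trans n≡kd (eq k′ (suc M)))))))
        (≡.trans (≡.sym (ℕₚ.+-suc (k′ ℕ.* d) (suc M))) (≡.cong (λ h → k′ ℕ.* d ℕ.+ suc h) (≡.sym half-sd)))
        where
        eq : ∀ k M → (1 ℕ.+ 2 ℕ.* k) ℕ.* (1 ℕ.+ 2 ℕ.* M) ≡ 1 ℕ.+ 2 ℕ.* (k ℕ.* (1 ℕ.+ 2 ℕ.* M) ℕ.+ M)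
        eq = solve-∀
      sum-multiple : ∀ {L} → Length s L → MultipleAt d (Φ d) (Σ< L term₁)
      sum-multiple whole  = ≡.subst (λ L → MultipleAt d (Φ d) (Σ< L term₁)) (≡.sym n≡kd) (F.full (1 ℕ.+ 2 ℕ.* k′))
      sum-multiple halved = ≡.subst (λ L → MultipleAt d (Φ d) (Σ< L term₁)) (≡.sym half-s) (F.up-to-half k′)

    cube-multiple : ∀ {L} → Length s L → MultipleAt n (Φ n *P Φ n *P Φ n) (w₁ * (Σ< L term₁ - value s))
    cube-multiple whole  = multiple-*ˡ (Facts.Loc-w₁ (facts s)) (Facts.full-cube (facts s))
    cube-multiple halved = multiple-*ˡ (Facts.Loc-w₁ (facts s)) (Facts.up-to-half-cube (facts s))

    represents-sum : ∀ L → Represents (sumF L term) (w₁ * Σ< L term₁)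
    represents-sum L = trans (*-congʳ (sym (Σ<-*ˡ L w₁ term₁))) (represents-sumF represents-term L)

    congruence : ∀ {L} → Length s L → ∀ B → Represents B (w₁ * value s) → CongF (sumF L term) B (modulus n)
    congruence {L} len B repB = congF {sumF L term} {B} (represents-sum L) repB
      (cong-≈ (solve 3 (λ w x y → w :* (x :- y) := w :* x :- w :* y) refl w₁ (Σ< L term₁) (value s)) P.refl
        (go n (≡.trans (half≡ s) (≡.cong (λ k → 1 ℕ.+ 2 ℕ.* k) (half-suc s))) (cube-multiple len) (divisor-multiple len)))
      where
      half-suc : ∀ {n} (s : Shape n) → half s ≡ suc (ℕ.pred (half s))
      half-suc (1mod4 m) = ≡.refl
      half-suc (3mod4 m) = ≡.refl
      x : Carrier
      x = w₁ * (Σ< L term₁ - value s)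
      go : ∀ n {h} → n ≡ 1 ℕ.+ 2 ℕ.* suc h → MultipleAt n (Φ n *P Φ n *P Φ n) x → (∀ d → 1 < d → d ∣ n → MultipleAt d (Φ d) x) → Cong x (modulus n)
      go .(1 ℕ.+ 2 ℕ.* suc h) {h} ≡.refl cube div = cong-modulus (h ℕ.+ (suc h ℕ.+ 0))
        (cong-one (trans (*-congʳ (solve 3 (λ w x y → w :* (x :- y) := w :* x :- w :* y) refl w₁ (Σ< L term₁) (value s))) (represents-difference {sumF L term} {B} (represents-sum L) repB)))
        (λ d 1<d _ d∣n → cong-multiple id (div d 1<d d∣n))
        (cong-multiple (λ cm → comax-sym (comax-* (comax-* (comax-sym cm) (comax-sym cm)) (comax-sym cm))) cube)

  -- Here no admissible D exists, and 1/(1 - q) is not local at Φ 1; but both sides are the same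
  -- single term, so the difference is 0.
  congruence-n≡1 : CongF (sumF 1 term) ((qpoch 2 4 0 *P qint 1) // (qpoch 4 4 0 *P X^ 0)) (modulus 1)
  congruence-n≡1 = congF {sumF 1 term} {(qpoch 2 4 0 *P qint 1) // (qpoch 4 4 0 *P X^ 0)} (represents-sumF represents-term 1) (represents-rhs 1 0)
    (congruent [] oneP comax-1 (begin
      (0# + w₁ * ((1# - q * 1# ^ 3) * (1# * 1# * 1#)) - w₁ * ((1# - q ^ 1) * (1# * 1#))) * ι oneP
        ≈⟨ solve 3 (λ w q o → (con 0ℤ :+ w :* ((one :- q :* one :^ 3) :* (one :* one :* one)) :- w :* ((one :- q :^ 1) :* (one :* one))) :* o := con 0ℤ) refl w₁ q (ι oneP) ⟩
      0# ≈⟨ ι-0 ⟨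
      ι [] ≈⟨ ι-cong (*P-zeroʳ (modulus 1)) ⟨
      ι (modulus 1 *P []) ∎))

  congruence-1mod4 : ∀ m → CongF (sumF (2 ℕ.* m ℕ.+ 1) term) ((qpoch 2 4 m *P qint (1 ℕ.+ 4 ℕ.* m)) // (qpoch 4 4 m *P X^ m)) (modulus (1 ℕ.+ 4 ℕ.* m))
    × CongF (sumF (1 ℕ.+ 4 ℕ.* m) term) ((qpoch 2 4 m *P qint (1 ℕ.+ 4 ℕ.* m)) // (qpoch 4 4 m *P X^ m)) (modulus (1 ℕ.+ 4 ℕ.* m))
  congruence-1mod4 zero    = congruence-n≡1 , congruence-n≡1
  congruence-1mod4 (suc m) = ≡.subst (λ L → CongF (sumF L term) B (modulus n₁)) (ℕₚ.+-comm 1 (2 ℕ.* suc m)) (congruence (1mod4 m) halved B rep)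
    , congruence (1mod4 m) whole B rep
    where
    n₁ : ℕ
    n₁ = 1 ℕ.+ 4 ℕ.* suc m
    B : Frac
    B = (qpoch 2 4 (suc m) *P qint n₁) // (qpoch 4 4 (suc m) *P X^ (suc m))
    rep : Represents B (w₁ * value (1mod4 m))
    rep = represents-rhs n₁ (suc m)

  congruence-3mod4 : ∀ m → CongF (sumF (1 ℕ.+ 2 ℕ.* m ℕ.+ 1) term) zeroF (modulus (3 ℕ.+ 4 ℕ.* m))
    × CongF (sumF (3 ℕ.+ 4 ℕ.* m) term) zeroF (modulus (3 ℕ.+ 4 ℕ.* m))
  congruence-3mod4 m = ≡.subst (λ L → CongF (sumF L term) zeroF (modulus (3 ℕ.+ 4 ℕ.* m))) (ℕₚ.+-comm 1 (1 ℕ.+ 2 ℕ.* m)) (congruence (3mod4 m) halved zeroF rep)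
    , congruence (3mod4 m) whole zeroF rep
    where
    rep : Represents zeroF (w₁ * value (3mod4 m))
    rep = trans (*-congʳ (zeroʳ w₁)) represents-zeroF

-- Instantiation at the fractions of ℤ[q] and translation of the indices

private
  module F = Fractions polyRing

  ι-injective : ∀ {x y} → F.ι x F.≃ F.ι y → x ≐ y
  ι-injective {x} {y} (F.cross eq) = ≐-trans (≐-sym (≐-trans (*P-comm x oneP) (*P-identityˡ x))) (≐-trans eq (≐-trans (*P-comm y oneP) (*P-identityˡ y)))

  embedding : Embedding F.fractionRing F.ι
  embedding = record { ι-cong = F.ι-cong ; ι-injective = ι-injective ; ι-1 = F.cross ≐-refl ; ι-+ = F.ι-+ ; ι-* = F.ι-*
                     ; ι-unit = λ {r} reg → F.inverse r reg , F.ι-inverse r reg }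

open Assembly F.fractionRing F.ι embedding using (congruence-1mod4; congruence-3mod4)

open import Data.Nat using (_+_)

n≡r+4[n/4] : ∀ n r → n % 4 ≡ r → n ≡ r + 4 ℕ.* (n / 4)
n≡r+4[n/4] n r n%4≡r = ≡.trans (m≡m%n+[m/n]*n n 4) (≡.cong₂ _+_ n%4≡r (ℕₚ.*-comm (n / 4) 4))

theorem1 : ∀ (n : ℕ) → n % 2 ≡ 1 →
    (n % 4 ≡ 1 →
    CongF (sumF ((n ∸ 1) / 2 + 1) term) (rhs1 n) (modulus n)
    × CongF (sumF n term) (rhs1 n) (modulus n))
    × (n % 4 ≡ 3 →
    CongF (sumF ((n ∸ 1) / 2 + 1) term) zeroF (modulus n)
    × CongF (sumF n term) zeroF (modulus n))
theorem1 n _ = case-1 , case-3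
  where
  case-1 : n % 4 ≡ 1 → _
  case-1 n%4≡1 = ≡.subst (λ n → CongF (sumF ((n ∸ 1) / 2 + 1) term) (rhs1 n) (modulus n) × CongF (sumF n term) (rhs1 n) (modulus n))
    (≡.sym (n≡r+4[n/4] n 1 n%4≡1))
    -- After n has become 1 + 4m, the quotients (n ∸ 1) / 2 and (n ∸ 1) / 4, the latter inside
    -- `rhs1`, are evaluated to 2m and m.
    (≡.subst₂ (λ h m′ → CongF (sumF (h + 1) term) (rhs m′) (modulus (1 + 4 ℕ.* m)) × CongF (sumF (1 + 4 ℕ.* m) term) (rhs m′) (modulus (1 + 4 ℕ.* m)))
      (≡.sym (≡.trans (≡.cong (_/ 2) (eq m)) (m*n/n≡m (2 ℕ.* m) 2)))
      (≡.sym (≡.trans (≡.cong (_/ 4) (ℕₚ.*-comm 4 m)) (m*n/n≡m m 4)))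
      (congruence-1mod4 m))
    where
    m : ℕ
    m = n / 4
    rhs : ℕ → Frac
    rhs m′ = (qpoch 2 4 m′ *P qint (1 + 4 ℕ.* m)) // (qpoch 4 4 m′ *P X^ m′)
    eq : ∀ m → 4 ℕ.* m ≡ 2 ℕ.* m ℕ.* 2
    eq = solve-∀
  case-3 : n % 4 ≡ 3 → _
  case-3 n%4≡3 = ≡.subst (λ n → CongF (sumF ((n ∸ 1) / 2 + 1) term) zeroF (modulus n) × CongF (sumF n term) zeroF (modulus n))
    (≡.sym (n≡r+4[n/4] n 3 n%4≡3))
    (≡.subst (λ h → CongF (sumF (h + 1) term) zeroF (modulus (3 + 4 ℕ.* m)) × CongF (sumF (3 + 4 ℕ.* m) term) zeroF (modulus (3 + 4 ℕ.* m)))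
      (≡.sym (≡.trans (≡.cong (_/ 2) (eq m)) (m*n/n≡m (1 + 2 ℕ.* m) 2)))
      (congruence-3mod4 m))
    where
    m : ℕ
    m = n / 4
    eq : ∀ m → 2 + 4 ℕ.* m ≡ (1 + 2 ℕ.* m) ℕ.* 2
    eq = solve-∀
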